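{- For every integer $n \geq 570571$, $$\sigma^{*}(n) \leq 1.3007\, n \log\log n.$$
   Context: A positive integer $d$ is a unitary divisor of the positive integer $n$ if $d \mid n$ and $\gcd(d, n/d) = 1$. The function $\sigma^{*}(n) = \sum_{d \mid n,\ \gcd(d, n/d) = 1} d$ is the sum of all unitary divisors of $n$. Here $\log$ is the natural logarithm, and $1.3007$ denotes this exact decimal number. -}

module Defs where

open import Algebra.Bundles using (CommutativeRing)
open import Data.Empty using (⊥)
open import Data.Integer as ℤ using (ℤ; +_; -[1+_])
import Data.Integer.Properties as ℤ
open import Data.List using (filter; map; upTo)
open import Data.Nat as ℕ using (ℕ; zero; suc)
open import Data.Nat.ListAction using (sum)
import Data.Nat.Properties as ℕ
open import Data.Nat.Coprimality using (1-coprimeTo) renaming (sym to coprime-sym)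
open import Data.Nat.Divisibility using (_∣_; _∣?_)
open import Data.Nat.DivMod using () renaming (_/_ to _/ℕ_)
open import Data.Nat.GCD using (gcd)
open import Data.Product using (∃; _×_; _,_; proj₁; proj₂)
open import Data.Rational
open import Data.Rational.Properties
open import Data.Rational.Solver using (module +-*-Solver)
open import Data.Sum using (_⊎_; inj₁; inj₂)
open import Relation.Binary.Definitions using (tri<; tri≈; tri>)
open import Relation.Binary.PropositionalEquality
  using (_≡_; refl; sym; trans; cong; cong₂; subst; subst₂)
open import Relation.Nullary using (Dec; yes; no; contradiction)
open import Relation.Nullary.Decidable using (_×-dec_)
open +-*-Solver using (solve; _:=_; _:+_; _:*_; _:-_; :-_; con)

open import Algebra.Definitions.RawSemiring +-*-rawSemiring using (_^_)
open import Algebra.Properties.Semiring.Exp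
  (CommutativeRing.semiring +-*-commutativeRing) using (^-assocʳ)
open import Algebra.Properties.CommutativeSemiring.Exp
  (CommutativeRing.commutativeSemiring +-*-commutativeRing) using (^-distrib-*)

UnitaryDivisor : (d n : ℕ) .{{_ : ℕ.NonZero d}} → Set
UnitaryDivisor d n = d ∣ n × gcd d (n /ℕ d) ≡ 1

unitaryDivisor? : (d n : ℕ) .{{_ : ℕ.NonZero d}} → Dec (UnitaryDivisor d n)
unitaryDivisor? d n = (d ∣? n) ×-dec (gcd d (n /ℕ d) ℕ.≟ 1)

-- The index i stands for the candidate divisor suc i, which therefore
-- runs over 1 , … , n.
σ* : ℕ → ℕ
σ* n = sum (map suc (filter (λ i → unitaryDivisor? (suc i) n) (upTo n)))

ℕ→ℚ : ℕ → ℚ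
ℕ→ℚ n = + n / 1

module Arithmetic where

  ℕ→ℚ-mk : ∀ n → ℕ→ℚ n ≡ mkℚ (+ n) 0 (coprime-sym (1-coprimeTo n))
  ℕ→ℚ-mk n = normalize-coprime (coprime-sym (1-coprimeTo n))

  ℕ→ℚ-suc : ∀ n → ℕ→ℚ (suc n) ≡ 1ℚ + ℕ→ℚ n
  ℕ→ℚ-suc n = sym (trans (cong (λ v → 1ℚ + v) (ℕ→ℚ-mk n))
    (cong (λ i → i / 1) (cong (ℤ._+_ (+ 1)) (ℤ.*-identityʳ (+ n)))))

  0≤ℕ→ℚ : ∀ n → 0ℚ ≤ ℕ→ℚ n
  0≤ℕ→ℚ n = nonNegative⁻¹ (ℕ→ℚ n) {{normalize-nonNeg n 1}}

  u : ℕ → ℚ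
  u m = + 1 / suc m

  0<u : ∀ m → 0ℚ < u m
  0<u m = positive⁻¹ (u m) {{normalize-pos 1 (suc m)}}

  u-mk : ∀ m → u m ≡ mkℚ (+ 1) m (1-coprimeTo (suc m))
  u-mk m = normalize-coprime (1-coprimeTo (suc m))

  u-inv : ∀ m → ℕ→ℚ (suc m) * u m ≡ 1ℚ
  u-inv m = trans (cong₂ _*_ (ℕ→ℚ-mk (suc m)) (u-mk m))
    (*-inverseʳ (mkℚ (+ suc m) 0 (coprime-sym (1-coprimeTo (suc m)))))

  u-* : ∀ m k → u (k ℕ.+ m ℕ.* suc k) ≡ u m * u k
  u-* m k = sym (cong₂ _*_ (u-mk m) (u-mk k))

  <-from : ∀ {x y} d → 0ℚ < d → y ≡ x + d → x < y
  <-from {x} d 0<d refl = subst (_< x + d) (+-identityʳ x) (+-monoʳ-< x 0<d)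

  ≤-from : ∀ {x y} d → 0ℚ ≤ d → y ≡ x + d → x ≤ y
  ≤-from {x} d 0≤d refl = subst (_≤ x + d) (+-identityʳ x) (+-monoʳ-≤ x 0≤d)

  <-diff : ∀ {x y} → x < y → 0ℚ < y - x
  <-diff {x} {y} x<y = subst (_< y - x) (+-inverseʳ x) (+-monoˡ-< (- x) x<y)

  ≤-diff : ∀ {x y} → x ≤ y → 0ℚ ≤ y - x
  ≤-diff {x} {y} x≤y = subst (_≤ y - x) (+-inverseʳ x) (+-monoˡ-≤ (- x) x≤y)

  *-pos : ∀ {x y} → 0ℚ < x → 0ℚ < y → 0ℚ < x * y
  *-pos {x} {y} 0<x 0<y =
    positive⁻¹ (x * y) {{pos*pos⇒pos x {{positive 0<x}} y {{positive 0<y}}}}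

  *-nonNeg : ∀ {x y} → 0ℚ ≤ x → 0ℚ ≤ y → 0ℚ ≤ x * y
  *-nonNeg {x} {y} 0≤x 0≤y =
    nonNegative⁻¹ (x * y)
      {{nonNeg*nonNeg⇒nonNeg x {{nonNegative 0≤x}} y {{nonNegative 0≤y}}}}

  *-monoʳ-< : ∀ {x y} c → 0ℚ < c → x < y → c * x < c * y
  *-monoʳ-< c 0<c = *-monoʳ-<-pos c {{positive 0<c}}

  *-monoʳ-≤ : ∀ {x y} c → 0ℚ ≤ c → x ≤ y → c * x ≤ c * y
  *-monoʳ-≤ c 0≤c = *-monoˡ-≤-nonNeg c {{nonNegative 0≤c}}

  *-monoˡ-< : ∀ {x y} c → 0ℚ < c → x < y → x * c < y * c
  *-monoˡ-< c 0<c = *-monoˡ-<-pos c {{positive 0<c}}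

  *-monoˡ-≤ : ∀ {x y} c → 0ℚ ≤ c → x ≤ y → x * c ≤ y * c
  *-monoˡ-≤ c 0≤c = *-monoʳ-≤-nonNeg c {{nonNegative 0≤c}}

  *-cancelˡ-< : ∀ {x y} c → 0ℚ ≤ c → c * x < c * y → x < y
  *-cancelˡ-< c 0≤c = *-cancelˡ-<-nonNeg c {{nonNegative 0≤c}}

  *-cancelʳ-< : ∀ {x y} c → 0ℚ ≤ c → x * c < y * c → x < y
  *-cancelʳ-< c 0≤c = *-cancelʳ-<-nonNeg c {{nonNegative 0≤c}}

  inverse : ∀ {p} → 0ℚ < p → ∃ λ i → 0ℚ < i × p * i ≡ 1ℚ
  inverse {p} 0<p = i , positive⁻¹ i {{1/pos⇒pos p {{positive 0<p}}}}
                      , *-inverseʳ p {{>-nonZero 0<p}}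
    where i = (1/ p) {{>-nonZero 0<p}}

  0≤x² : ∀ x → 0ℚ ≤ x * x
  0≤x² x with ≤-total 0ℚ x
  ... | inj₁ 0≤x = *-nonNeg 0≤x 0≤x
  ... | inj₂ x≤0 = subst (0ℚ ≤_)
    (solve 1 (λ x → (:- x) :* (:- x) := x :* x) refl x)
    (*-nonNeg (neg-antimono-≤ x≤0) (neg-antimono-≤ x≤0))

  archimedean : ∀ p → ∃ λ m → p < ℕ→ℚ (suc m)
  archimedean p@(mkℚ (+ n) d-1 _) = n ,
    subst (p <_) (sym (ℕ→ℚ-mk (suc n)))
      (*<* (subst₂ ℤ._<_ (sym (ℤ.*-identityʳ (+ n))) refl
        (ℤ.+<+ (ℕ.<-≤-trans (ℕ.n<1+n n) (ℕ.m≤m*n (suc n) (suc d-1))))))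
  archimedean p@(mkℚ -[1+ n ] d-1 _) = 0 , <-trans (negative⁻¹ p) (0<u 0)

  small : ∀ c → ∃ λ m → c * u m < 1ℚ
  small c with archimedean c
  ... | m , c<m = m , subst (c * u m <_) (u-inv m) (*-monoˡ-< (u m) (0<u m) c<m)

  small-≤ : ∀ {a c} m → a ≤ c → c * u m < 1ℚ → 0ℚ < 1ℚ - a * u m
  small-≤ {a} m a≤c cu<1 =
    <-diff (≤-<-trans (*-monoˡ-≤ (u m) (<⇒≤ (0<u m)) a≤c) cu<1)

  ^-pos : ∀ {z} n → 0ℚ < z → 0ℚ < z ^ n
  ^-pos zero    0<z = 0<u 0
  ^-pos (suc n) 0<z = *-pos 0<z (^-pos n 0<z)

  ^-mono : ∀ {x y} n → 0ℚ < x → x ≤ y → x ^ n ≤ y ^ n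
  ^-mono zero    0<x x≤y = ≤-refl
  ^-mono {x} {y} (suc n) 0<x x≤y = ≤-trans
    (*-monoʳ-≤ x (<⇒≤ 0<x) (^-mono n 0<x x≤y))
    (*-monoˡ-≤ (y ^ n) (<⇒≤ (^-pos n (<-≤-trans 0<x x≤y))) x≤y)

  bernoulli : ∀ {z} n → 0ℚ ≤ z → 1ℚ + ℕ→ℚ n * (z - 1ℚ) ≤ z ^ n
  bernoulli {z} zero 0≤z = ≤-reflexive
    (solve 1 (λ z → con 1ℚ :+ con 0ℚ :* (z :- con 1ℚ) := con 1ℚ) refl z)
  bernoulli {z} (suc n) 0≤z = ≤-trans
    (≤-from (ℕ→ℚ n * ((z - 1ℚ) * (z - 1ℚ)))
      (*-nonNeg (0≤ℕ→ℚ n) (0≤x² (z - 1ℚ)))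
      (trans
        (solve 2 (λ z k → z :* (con 1ℚ :+ k :* (z :- con 1ℚ)) :=
          (con 1ℚ :+ (con 1ℚ :+ k) :* (z :- con 1ℚ))
          :+ k :* ((z :- con 1ℚ) :* (z :- con 1ℚ))) refl z (ℕ→ℚ n))
        (cong (λ k → (1ℚ + k * (z - 1ℚ)) + ℕ→ℚ n * ((z - 1ℚ) * (z - 1ℚ)))
          (sym (ℕ→ℚ-suc n)))))
    (*-monoʳ-≤ z 0≤z (bernoulli n 0≤z))

  1^n≡1 : ∀ n → 1ℚ ^ n ≡ 1ℚ
  1^n≡1 zero    = refl
  1^n≡1 (suc n) = trans (*-identityˡ _) (1^n≡1 n)

  1<^ : ∀ {z} n → 1ℚ < z → 1ℚ < z ^ suc n
  1<^ {z} n 1<z = <-≤-trans 1<z (subst (_≤ z * z ^ n) (*-identityʳ z)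
    (*-monoʳ-≤ z (<⇒≤ (<-trans (0<u 0) 1<z))
      (subst (_≤ z ^ n) (1^n≡1 n) (^-mono n (0<u 0) (<⇒≤ 1<z)))))

  factor-pos : ∀ {s w} → 0ℚ < w → 1ℚ < s * w → 0ℚ < s
  factor-pos {s} {w} 0<w 1<sw = *-cancelʳ-< w (<⇒≤ 0<w)
    (subst (_< s * w) (sym (*-zeroˡ w)) (<-trans (0<u 0) 1<sw))

  1<-multiple : ∀ {w} → 0ℚ < w → ∃ λ s → 1ℚ < s * w
  1<-multiple {w} 0<w =
    let i , 0<i , wi≡1 = inverse 0<w
    in i + 1ℚ , <-from w 0<w
      (trans (solve 2 (λ i w → (i :+ con 1ℚ) :* w := w :* i :+ w) refl i w)
        (cong (_+ w) wi≡1))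

  1<-lower : ∀ {s w} → 0ℚ < w → 1ℚ < s * w → ∃ λ t → t < s × 1ℚ < t * w
  1<-lower {s} {w} 0<w 1<sw =
    let i , 0<i , wi≡1 = inverse 0<w
        iw≡1 = trans (*-comm i w) wi≡1
        t , i<t , t<s = <-dense (*-cancelʳ-< {i} {s} w (<⇒≤ 0<w)
          (subst (_< s * w) (sym iw≡1) 1<sw))
    in t , t<s , subst (_< t * w) iw≡1 (*-monoˡ-< w 0<w i<t)

  <-factor : ∀ {v w} → 0ℚ < v → v < w → ∃ λ d → 0ℚ < d × d < 1ℚ × v < w * d
  <-factor {v} {w} 0<v v<w =
    let 0<w = <-trans 0<v v<w
        i , 0<i , wi≡1 = inverse 0<w
        d , vi<d , d<1 = <-dense (subst (v * i <_) wi≡1 (*-monoˡ-< i 0<i v<w))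
    in d , <-trans (*-pos 0<v 0<i) vi<d , d<1
      , subst (_< w * d)
          (trans (solve 3 (λ v w i → w :* (v :* i) := v :* (w :* i)) refl v w i)
            (trans (cong (v *_) wi≡1) (*-identityʳ v)))
          (*-monoʳ-< w 0<w vi<d)

open Arithmetic

-- Located Dedekind cuts: L x q means q < x, and U x q means x < q.
record ℝ : Set₁ where
  field
    L U         : ℚ → Set
    L-inhabited : ∃ L
    U-inhabited : ∃ U
    L-closed    : ∀ {q r} → q < r → L r → L q
    U-closed    : ∀ {q r} → q < r → U q → U r
    L-open      : ∀ {q} → L q → ∃ λ r → q < r × L r
    U-open      : ∀ {q} → U q → ∃ λ r → r < q × U r
    disjoint    : ∀ {q} → L q → U q → ⊥
    located     : ∀ {q r} → q < r → L q ⊎ U r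

open ℝ

infix 4 _<ᴿ_ _≤ᴿ_

_<ᴿ_ : ℝ → ℝ → Set
x <ᴿ y = ∃ λ q → U x q × L y q

_≤ᴿ_ : ℝ → ℝ → Set
x ≤ᴿ y = ∀ q → L x q → L y q

module Cut where

  L<U : ∀ x {q r} → L x q → U x r → q < r
  L<U x {q} {r} Lq Ur with <-cmp q r
  ... | tri< q<r _ _  = q<r
  ... | tri≈ _ refl _ = contradiction Ur (disjoint x Lq)
  ... | tri> _ _ r<q  = contradiction Ur (disjoint x (L-closed x r<q Lq))

open Cut

fromℚ : ℚ → ℝ
fromℚ p = record
  { L           = _< p
  ; U           = p <_
  ; L-inhabited = p - 1ℚ , <-from 1ℚ (0<u 0)
      (solve 1 (λ p → p := (p :- con 1ℚ) :+ con 1ℚ) refl p)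
  ; U-inhabited = p + 1ℚ , <-from 1ℚ (0<u 0) refl
  ; L-closed    = <-trans
  ; U-closed    = λ q<r p<q → <-trans p<q q<r
  ; L-open      = <-dense
  ; U-open      = λ p<q → let r , p<r , r<q = <-dense p<q in r , r<q , p<r
  ; disjoint    = λ q<p p<q → <-asym q<p p<q
  ; located     = located′
  }
  where
  located′ : ∀ {q r} → q < r → q < p ⊎ p < r
  located′ {q} {r} q<r with q <? p
  ... | yes q<p = inj₁ q<p
  ... | no  q≮p = inj₂ (≤-<-trans (≮⇒≥ q≮p) q<r)

fromℕ : ℕ → ℝ
fromℕ n = fromℚ (ℕ→ℚ n)

module Scale (c : ℚ) (x : ℝ) where

  -- c need not be positive: the open interval of the values c y with
  -- a < y < b has end points c a and c b in one order or the other.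
  Lc Uc : ℚ → Set
  Lc q = ∃ λ a → ∃ λ b → L x a × U x b × q < c * a × q < c * b
  Uc q = ∃ λ a → ∃ λ b → L x a × U x b × c * a < q × c * b < q

  ⊓-elim : ∀ (P : ℚ → Set) {y z} → P y → P z → P (y ⊓ z)
  ⊓-elim P {y} {z} py pz with ≤-total y z
  ... | inj₁ y≤z = subst P (sym (p≤q⇒p⊓q≡p y≤z)) py
  ... | inj₂ z≤y = subst P (sym (p≥q⇒p⊓q≡q z≤y)) pz

  ⊔-elim : ∀ (P : ℚ → Set) {y z} → P y → P z → P (y ⊔ z)
  ⊔-elim P {y} {z} py pz with ≤-total y z
  ... | inj₁ y≤z = subst P (sym (p≤q⇒p⊔q≡q y≤z)) pz
  ... | inj₂ z≤y = subst P (sym (p≥q⇒p⊔q≡p z≤y)) py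

  Lc-open : ∀ {q} → Lc q → ∃ λ r → q < r × Lc r
  Lc-open {q} (a , b , La , Ub , q<ca , q<cb)
    with <-dense (⊓-elim (q <_) q<ca q<cb)
  ... | r , q<r , r<m = r , q<r , a , b , La , Ub
    , <-≤-trans r<m (p⊓q≤p (c * a) (c * b))
    , <-≤-trans r<m (p⊓q≤q (c * a) (c * b))

  Uc-open : ∀ {q} → Uc q → ∃ λ r → r < q × Uc r
  Uc-open {q} (a , b , La , Ub , ca<q , cb<q)
    with <-dense (⊔-elim (_< q) ca<q cb<q)
  ... | r , m<r , r<q = r , r<q , a , b , La , Ub
    , ≤-<-trans (p≤p⊔q (c * a) (c * b)) m<r
    , ≤-<-trans (p≤q⊔p (c * a) (c * b)) m<r

  Lc-inhabited : ∃ Lc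
  Lc-inhabited = m - 1ℚ , a , b , proj₂ (L-inhabited x) , proj₂ (U-inhabited x)
    , <-≤-trans m-1<m (p⊓q≤p (c * a) (c * b))
    , <-≤-trans m-1<m (p⊓q≤q (c * a) (c * b))
    where
    a = proj₁ (L-inhabited x)
    b = proj₁ (U-inhabited x)
    m = (c * a) ⊓ (c * b)
    m-1<m : m - 1ℚ < m
    m-1<m = <-from 1ℚ (0<u 0)
      (solve 1 (λ p → p := (p :- con 1ℚ) :+ con 1ℚ) refl m)

  Uc-inhabited : ∃ Uc
  Uc-inhabited = m + 1ℚ , a , b , proj₂ (L-inhabited x) , proj₂ (U-inhabited x)
    , ≤-<-trans (p≤p⊔q (c * a) (c * b)) m<m+1
    , ≤-<-trans (p≤q⊔p (c * a) (c * b)) m<m+1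
    where
    a = proj₁ (L-inhabited x)
    b = proj₁ (U-inhabited x)
    m = (c * a) ⊔ (c * b)
    m<m+1 : m < m + 1ℚ
    m<m+1 = <-from 1ℚ (0<u 0) refl

  neg-* : ∀ {y z} → c ≤ 0ℚ → y ≤ z → c * z ≤ c * y
  neg-* {y} {z} c≤0 = *-monoˡ-≤-nonPos c {{nonPositive c≤0}}

  c-disjoint : ∀ {q} → Lc q → Uc q → ⊥
  c-disjoint (a , b , La , Ub , q<ca , q<cb) (a′ , b′ , La′ , Ub′ , ca′<q , cb′<q)
    with ≤-total 0ℚ c
  ... | inj₁ 0≤c = <-asym
    (<-≤-trans q<ca (*-monoʳ-≤ c 0≤c (<⇒≤ (L<U x La Ub′)))) cb′<q
  ... | inj₂ c≤0 = <-asym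
    (<-≤-trans q<cb (neg-* c≤0 (<⇒≤ (L<U x La′ Ub)))) ca′<q

  c-located : ∀ {q r} → q < r → Lc q ⊎ Uc r
  c-located {q} {r} q<r with <-cmp 0ℚ c | <-dense q<r
  ... | tri< 0<c _ _ | s , q<s , s<r
    with <-dense q<s | inverse 0<c
  ...   | p , q<p , p<s | i , 0<i , ci≡1 with located x (*-monoʳ-< i 0<i p<s)
  ...     | inj₁ Lp = inj₁ (i * p , proj₁ (U-inhabited x) , Lp , proj₂ (U-inhabited x)
    , q<cip , <-trans q<cip (*-monoʳ-< c 0<c (L<U x Lp (proj₂ (U-inhabited x)))))
    where
    q<cip : q < c * (i * p)
    q<cip = subst (q <_) (sym (trans (sym (*-assoc c i p))
      (trans (cong (_* p) ci≡1) (*-identityˡ p)))) q<p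
  ...     | inj₂ Us = inj₂ (proj₁ (L-inhabited x) , i * s , proj₂ (L-inhabited x) , Us
    , <-trans (*-monoʳ-< c 0<c (L<U x (proj₂ (L-inhabited x)) Us)) cis<r , cis<r)
    where
    cis<r : c * (i * s) < r
    cis<r = subst (_< r) (sym (trans (sym (*-assoc c i s))
      (trans (cong (_* s) ci≡1) (*-identityˡ s)))) s<r
  c-located {q} {r} q<r | tri≈ _ refl _ | _ with q <? 0ℚ
  ... | yes q<0 = inj₁ (a , b , proj₂ (L-inhabited x) , proj₂ (U-inhabited x)
    , subst (q <_) (sym (*-zeroˡ a)) q<0 , subst (q <_) (sym (*-zeroˡ b)) q<0)
    where
    a = proj₁ (L-inhabited x)
    b = proj₁ (U-inhabited x)
  ... | no q≮0 = inj₂ (a , b , proj₂ (L-inhabited x) , proj₂ (U-inhabited x)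
    , subst (_< r) (sym (*-zeroˡ a)) 0<r , subst (_< r) (sym (*-zeroˡ b)) 0<r)
    where
    a = proj₁ (L-inhabited x)
    b = proj₁ (U-inhabited x)
    0<r : 0ℚ < r
    0<r = ≤-<-trans (≮⇒≥ q≮0) q<r
  c-located {q} {r} q<r | tri> _ _ c<0 | s , q<s , s<r
    with <-dense q<s | inverse (neg-antimono-< c<0)
  ... | p , q<p , p<s | i , 0<i , -ci≡1
    with located x (neg-antimono-< (*-monoʳ-< i 0<i p<s))
  ...   | inj₁ Ls = inj₂ (_ , proj₁ (U-inhabited x) , Ls , proj₂ (U-inhabited x)
    , cs<r , ≤-<-trans
        (neg-* (<⇒≤ c<0) (<⇒≤ (L<U x Ls (proj₂ (U-inhabited x))))) cs<r)
    where
    cs<r : c * - (i * s) < r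
    cs<r = subst (_< r) (sym (trans
      (solve 3 (λ c i s → c :* (:- (i :* s)) := ((:- c) :* i) :* s) refl c i s)
      (trans (cong (_* s) -ci≡1) (*-identityˡ s)))) s<r
  ...   | inj₂ Up = inj₁ (proj₁ (L-inhabited x) , _ , proj₂ (L-inhabited x) , Up
    , <-≤-trans q<cp
        (neg-* (<⇒≤ c<0) (<⇒≤ (L<U x (proj₂ (L-inhabited x)) Up))) , q<cp)
    where
    q<cp : q < c * - (i * p)
    q<cp = subst (q <_) (sym (trans
      (solve 3 (λ c i s → c :* (:- (i :* s)) := ((:- c) :* i) :* s) refl c i p)
      (trans (cong (_* p) -ci≡1) (*-identityˡ p)))) q<p

infixr 7 _⋆_

_⋆_ : ℚ → ℝ → ℝ
c ⋆ x = record
  { L           = Lc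
  ; U           = Uc
  ; L-inhabited = Lc-inhabited
  ; U-inhabited = Uc-inhabited
  ; L-closed    = λ q<r (a , b , La , Ub , r<ca , r<cb) →
      a , b , La , Ub , <-trans q<r r<ca , <-trans q<r r<cb
  ; U-closed    = λ q<r (a , b , La , Ub , ca<q , cb<q) →
      a , b , La , Ub , <-trans ca<q q<r , <-trans cb<q q<r
  ; L-open      = Lc-open
  ; U-open      = Uc-open
  ; disjoint    = c-disjoint
  ; located     = c-located
  }
  where open Scale c x

-- M = suc m throughout, so that no division by zero can occur.
base : ℚ → ℕ → ℚ
base q m = 1ℚ + q * (+ 1 / suc m)

approx : ℚ → ℕ → ℚ
approx q m = base q m ^ suc m

-- e^q = lim (1 + q/M)^M = lim 1/(1 - q/M)^M.  As long as the bases are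
-- positive, the first sequence increases and the second one decreases, so
-- that e^q is the supremum of the former and the infimum of the latter.
LExp UExp : ℚ → ℚ → Set
LExp q s = ∃ λ m → 0ℚ < base q m × s < approx q m
UExp q s = ∃ λ m → 0ℚ < base (- q) m × 1ℚ < s * approx (- q) m

module Exp where

  base-mono : ∀ {q r} m → q < r → base q m < base r m
  base-mono m q<r = +-monoʳ-< 1ℚ (*-monoˡ-< (u m) (0<u m) q<r)

  base-small : ∀ {c} q m → - q ≤ c → c * u m < 1ℚ → 0ℚ < base q m
  base-small q m -q≤c cu<1 = subst (0ℚ <_)
    (solve 2 (λ q u → con 1ℚ :- (:- q) :* u := con 1ℚ :+ q :* u) refl q (u m))
    (small-≤ m -q≤c cu<1)

  approx-pos : ∀ q m → 0ℚ < base q m → 0ℚ < approx q m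
  approx-pos q m = ^-pos (suc m)

  base-refine : ∀ q m k → 0ℚ < base q m → 0ℚ < base q (k ℕ.+ m ℕ.* suc k)
  base-refine q m k 0<b = subst (0ℚ <_) eq
    (<-≤-trans (*-pos 0<b (0<u k)) (≤-from (u k * ℕ→ℚ k)
      (*-nonNeg (<⇒≤ (0<u k)) (0≤ℕ→ℚ k)) refl))
    where
    eq : base q m * u k + u k * ℕ→ℚ k ≡ base q (k ℕ.+ m ℕ.* suc k)
    eq = trans
      (solve 4 (λ q a b k → (con 1ℚ :+ q :* a) :* b :+ b :* k
          := (con 1ℚ :+ k) :* b :+ q :* (a :* b)) refl q (u m) (u k) (ℕ→ℚ k))
      (cong₂ (λ y z → y + q * z)
        (trans (cong (_* u k) (sym (ℕ→ℚ-suc k))) (u-inv k))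
        (sym (u-* m k)))

  approx-refine : ∀ q m k → 0ℚ < base q m →
                  approx q m ≤ approx q (k ℕ.+ m ℕ.* suc k)
  approx-refine q m k 0<b = ≤-trans (^-mono (suc m) 0<b b≤z^K) (≤-reflexive
    (trans (^-assocʳ z (suc k) (suc m)) (cong (z ^_) (ℕ.*-comm (suc k) (suc m)))))
    where
    z = base q (k ℕ.+ m ℕ.* suc k)
    eq : 1ℚ + ℕ→ℚ (suc k) * (z - 1ℚ) ≡ base q m
    eq = trans (cong (λ v → 1ℚ + ℕ→ℚ (suc k) * ((1ℚ + q * v) - 1ℚ)) (u-* m k))
      (trans (solve 4 (λ q a b K → con 1ℚ :+ K :* ((con 1ℚ :+ q :* (a :* b)) :- con 1ℚ)
          := con 1ℚ :+ q :* a :* (K :* b)) refl q (u m) (u k) (ℕ→ℚ (suc k)))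
        (trans (cong (λ v → 1ℚ + q * u m * v) (u-inv k))
          (cong (λ v → 1ℚ + v) (*-identityʳ (q * u m)))))
    b≤z^K : base q m ≤ z ^ suc k
    b≤z^K = subst (_≤ z ^ suc k) eq
      (bernoulli (suc k) (<⇒≤ (base-refine q m k 0<b)))

  base-product : ∀ q m → base q m * base (- q) m ≡ 1ℚ - (q * u m) * (q * u m)
  base-product q m = solve 2 (λ q u → (con 1ℚ :+ q :* u) :* (con 1ℚ :+ (:- q) :* u)
    := con 1ℚ :- (q :* u) :* (q :* u)) refl q (u m)

  approx-product : ∀ q m → approx q m * approx (- q) m
                           ≡ (1ℚ - (q * u m) * (q * u m)) ^ suc m
  approx-product q m = trans (sym (^-distrib-* (base q m) (base (- q) m) (suc m)))
    (cong (_^ suc m) (base-product q m))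

  approx-≤1 : ∀ q m → 0ℚ < base q m → 0ℚ < base (- q) m →
              approx q m * approx (- q) m ≤ 1ℚ
  approx-≤1 q m 0<a 0<b = subst₂ _≤_ (sym (approx-product q m)) (1^n≡1 (suc m))
    (^-mono (suc m) (subst (0ℚ <_) (base-product q m) (*-pos 0<a 0<b))
      (≤-from ((q * u m) * (q * u m)) (0≤x² (q * u m))
        (solve 1 (λ y → con 1ℚ := (con 1ℚ :- y) :+ y) refl ((q * u m) * (q * u m)))))

  LExp<UExp : ∀ {q s t} → LExp q s → UExp q t → s < t
  LExp<UExp {q} {s} {t} (m , 0<a , s<A) (k , 0<b , 1<tB) =
    *-cancelʳ-< B′ (<⇒≤ 0<B′) (<-trans (<-≤-trans sB<AB AB≤1) 1<tB′)
    where
    N  = k ℕ.+ m ℕ.* suc k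
    N′ = m ℕ.+ k ℕ.* suc m
    A′ = approx q N
    B′ = approx (- q) N
    N′≡N : N′ ≡ N
    N′≡N = ℕ.suc-injective (ℕ.*-comm (suc k) (suc m))
    0<b′ : 0ℚ < base (- q) N
    0<b′ = subst (λ n → 0ℚ < base (- q) n) N′≡N (base-refine (- q) k m 0<b)
    0<B′ : 0ℚ < B′
    0<B′ = approx-pos (- q) N 0<b′
    0<t : 0ℚ < t
    0<t = factor-pos (approx-pos (- q) k 0<b) 1<tB
    1<tB′ : 1ℚ < t * B′
    1<tB′ = <-≤-trans 1<tB (*-monoʳ-≤ t (<⇒≤ 0<t)
      (subst (λ n → approx (- q) k ≤ approx (- q) n) N′≡N
        (approx-refine (- q) k m 0<b)))
    sB<AB : s * B′ < A′ * B′
    sB<AB = *-monoˡ-< B′ 0<B′ (<-≤-trans s<A (approx-refine q m k 0<a))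
    AB≤1 : A′ * B′ ≤ 1ℚ
    AB≤1 = approx-≤1 q N (base-refine q m k 0<a) 0<b′

  approx-≥ : ∀ q m → 0ℚ < base q m → 0ℚ < base (- q) m →
             1ℚ - (q * q) * u m ≤ approx q m * approx (- q) m
  approx-≥ q m 0<a 0<b = subst₂ _≤_ eq (sym (approx-product q m))
    (bernoulli (suc m) (<⇒≤ (subst (0ℚ <_) (base-product q m) (*-pos 0<a 0<b))))
    where
    eq : 1ℚ + ℕ→ℚ (suc m) * ((1ℚ - (q * u m) * (q * u m)) - 1ℚ)
         ≡ 1ℚ - (q * q) * u m
    eq = trans
      (solve 3 (λ q u M →
        con 1ℚ :+ M :* ((con 1ℚ :- (q :* u) :* (q :* u)) :- con 1ℚ)
        := con 1ℚ :- (q :* q) :* ((M :* u) :* u)) refl q (u m) (ℕ→ℚ (suc m)))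
      (cong (λ v → 1ℚ - (q * q) * v)
        (trans (cong (_* u m) (u-inv m)) (*-identityˡ (u m))))

  exp-located : ∀ q {s t} → s < t → LExp q s ⊎ UExp q t
  exp-located q {s} {t} s<t = decide (s <? A)
    where
    i = proj₁ (inverse (<-diff s<t))
    di≡1 : (t - s) * i ≡ 1ℚ
    di≡1 = proj₂ (proj₂ (inverse (<-diff s<t)))
    C₁ = - q
    C₂ = - (- q)
    C₃ = (t * (q * q)) * i
    C  = C₁ ⊔ (C₂ ⊔ C₃)
    m  = proj₁ (small C)
    Cu<1 : C * u m < 1ℚ
    Cu<1 = proj₂ (small C)
    0<a : 0ℚ < base q m
    0<a = base-small q m (p≤p⊔q C₁ (C₂ ⊔ C₃)) Cu<1
    0<b : 0ℚ < base (- q) m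
    0<b = base-small (- q) m
      (≤-trans (p≤p⊔q C₂ C₃) (p≤q⊔p C₁ (C₂ ⊔ C₃))) Cu<1
    A = approx q m
    B = approx (- q) m
    0<B : 0ℚ < B
    0<B = approx-pos (- q) m 0<b
    gap : s < t * (1ℚ - (q * q) * u m)
    gap = <-from ((t - s) * (1ℚ - C₃ * u m))
      (*-pos (<-diff s<t) (small-≤ m
        (≤-trans (p≤q⊔p C₂ C₃) (p≤q⊔p C₁ (C₂ ⊔ C₃))) Cu<1))
      (sym (trans
        (solve 5 (λ k s t i u →
          s :+ (t :- s) :* (con 1ℚ :- (k :* i) :* u)
          := t :- k :* ((t :- s) :* i) :* u) refl (t * (q * q)) s t i (u m))
        (trans (cong (λ v → t - (t * (q * q)) * v * u m) di≡1)
          (solve 3 (λ k t u → t :- (t :* k) :* con 1ℚ :* u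
            := t :* (con 1ℚ :- k :* u)) refl (q * q) t (u m)))))
    upper : 0ℚ ≤ s → A ≤ s → UExp q t
    upper 0≤s A≤s = m , 0<b , *-cancelˡ-< s 0≤s
      (subst₂ _<_ (sym (*-identityʳ s))
        (solve 3 (λ s t B → t :* (s :* B) := s :* (t :* B)) refl s t B)
        (<-≤-trans gap (*-monoʳ-≤ t (<⇒≤ (≤-<-trans 0≤s s<t))
          (≤-trans (approx-≥ q m 0<a 0<b) (*-monoˡ-≤ B (<⇒≤ 0<B) A≤s)))))
    decide : Dec (s < A) → LExp q s ⊎ UExp q t
    decide (yes s<A) = inj₁ (m , 0<a , s<A)
    decide (no  s≮A) = inj₂ (upper
      (≤-trans (<⇒≤ (approx-pos q m 0<a)) (≮⇒≥ s≮A)) (≮⇒≥ s≮A))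

  LExp-inhabited : ∀ q → ∃ (LExp q)
  LExp-inhabited q = 0ℚ , m , 0<a , approx-pos q m 0<a
    where
    m = proj₁ (small (- q))
    0<a : 0ℚ < base q m
    0<a = base-small q m ≤-refl (proj₂ (small (- q)))

  UExp-inhabited : ∀ q → ∃ (UExp q)
  UExp-inhabited q = proj₁ t , m , 0<b , proj₂ t
    where
    m = proj₁ (small (- (- q)))
    0<b : 0ℚ < base (- q) m
    0<b = base-small (- q) m ≤-refl (proj₂ (small (- (- q))))
    t = 1<-multiple (approx-pos (- q) m 0<b)

  LExp-open : ∀ q {s} → LExp q s → ∃ λ t → s < t × LExp q t
  LExp-open q (m , 0<a , s<A) =
    let t , s<t , t<A = <-dense s<A in t , s<t , m , 0<a , t<A

  UExp-open : ∀ q {s} → UExp q s → ∃ λ t → t < s × UExp q t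
  UExp-open q (m , 0<b , 1<sB) =
    let t , t<s , 1<tB = 1<-lower (approx-pos (- q) m 0<b) 1<sB
    in t , t<s , m , 0<b , 1<tB

open Exp

exp : ℚ → ℝ
exp q = record
  { L           = LExp q
  ; U           = UExp q
  ; L-inhabited = LExp-inhabited q
  ; U-inhabited = UExp-inhabited q
  ; L-closed    = λ s<t (m , 0<a , t<A) → m , 0<a , <-trans s<t t<A
  ; U-closed    = λ s<t (m , 0<b , 1<sB) →
      m , 0<b , <-trans 1<sB (*-monoˡ-< _ (approx-pos (- q) m 0<b) s<t)
  ; L-open      = LExp-open q
  ; U-open      = UExp-open q
  ; disjoint    = λ Ls Us → <-irrefl refl (LExp<UExp {q} Ls Us)
  ; located     = exp-located q
  }

module ExpContinuity where

  -- (1 + q/M)^M shrinks by at most a factor d when q decreases by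
  -- (1 + q/M) (1 - d).
  shrink : ∀ q m d → 0ℚ < base q m → 0ℚ < d → d < 1ℚ →
           ∃ λ r → r < q × 0ℚ < base r m × approx q m * d ≤ approx r m
  shrink q m d 0<w 0<d d<1 = q - w * η
    , <-from (w * η) (*-pos 0<w 0<η)
        (solve 2 (λ q y → q := (q :- y) :+ y) refl q (w * η))
    , subst (0ℚ <_) (sym base≡) (*-pos 0<w 0<z)
    , subst (approx q m * d ≤_)
        (trans (sym (^-distrib-* w z (suc m))) (cong (_^ suc m) (sym base≡)))
        (*-monoʳ-≤ (approx q m) (<⇒≤ (approx-pos q m 0<w)) d≤z^M)
    where
    w = base q m
    η = 1ℚ - d
    z = 1ℚ - η * u m
    0<η : 0ℚ < η
    0<η = <-diff d<1
    base≡ : base (q - w * η) m ≡ w * z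
    base≡ = solve 3 (λ q η u →
      con 1ℚ :+ (q :- (con 1ℚ :+ q :* u) :* η) :* u
      := (con 1ℚ :+ q :* u) :* (con 1ℚ :- η :* u)) refl q η (u m)
    Mu : u m + u m * ℕ→ℚ m ≡ 1ℚ
    Mu = trans (solve 2 (λ u k → u :+ u :* k := (con 1ℚ :+ k) :* u) refl (u m) (ℕ→ℚ m))
      (trans (cong (_* u m) (sym (ℕ→ℚ-suc m))) (u-inv m))
    0<z : 0ℚ < z
    0<z = <-≤-trans 0<d (≤-from (η * (u m * ℕ→ℚ m))
      (*-nonNeg (<⇒≤ 0<η) (*-nonNeg (<⇒≤ (0<u m)) (0≤ℕ→ℚ m)))
      (trans
        (solve 3 (λ d u y → con 1ℚ :- (con 1ℚ :- d) :* u
          := d :+ (con 1ℚ :- d) :* (con 1ℚ :- u)) refl d (u m) (u m * ℕ→ℚ m))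
        (cong (λ v → d + η * v)
          (trans (cong (_- u m) (sym Mu))
            (solve 2 (λ u y → (u :+ y) :- u := y) refl (u m) (u m * ℕ→ℚ m))))))
    d≤z^M : d ≤ z ^ suc m
    d≤z^M = subst (_≤ z ^ suc m)
      (trans
        (solve 3 (λ d u M → con 1ℚ :+ M :* ((con 1ℚ :- (con 1ℚ :- d) :* u) :- con 1ℚ)
          := con 1ℚ :- (con 1ℚ :- d) :* (M :* u)) refl d (u m) (ℕ→ℚ (suc m)))
        (trans (cong (λ v → 1ℚ - η * v) (u-inv m))
          (solve 1 (λ d → con 1ℚ :- (con 1ℚ :- d) :* con 1ℚ := d) refl d)))
      (bernoulli (suc m) (<⇒≤ 0<z))

  LExp-lower : ∀ {q s v} → LExp q s → 0ℚ < v → v < s → ∃ λ r → r < q × LExp r v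
  LExp-lower {q} (m , 0<a , s<A) 0<v v<s =
    let d , 0<d , d<1 , v<Ad = <-factor 0<v (<-trans v<s s<A)
        r , r<q , 0<b , Ad≤ = shrink q m d 0<a 0<d d<1
    in r , r<q , m , 0<b , <-≤-trans v<Ad Ad≤

  UExp-raise : ∀ {q s v} → UExp q s → s < v → ∃ λ r → q < r × UExp r v
  UExp-raise {q} {s} {v} (m , 0<b , 1<sB) s<v =
    let d , 0<d , d<1 , 1<vBd = <-factor (0<u 0)
          (<-trans 1<sB (*-monoˡ-< (approx (- q) m) 0<B s<v))
        r , r<-q , 0<b′ , Bd≤ = shrink (- q) m d 0<b 0<d d<1
    in - r
      , subst (_< - r) (neg-neg q) (neg-antimono-< r<-q)
      , m , subst (λ p → 0ℚ < base p m) (sym (neg-neg r)) 0<b′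
      , subst (λ p → 1ℚ < v * approx p m) (sym (neg-neg r))
          (<-≤-trans (subst (1ℚ <_) (*-assoc v (approx (- q) m) d) 1<vBd)
            (*-monoʳ-≤ v (<⇒≤ 0<v) Bd≤))
    where
    neg-neg : ∀ p → - (- p) ≡ p
    neg-neg = solve 1 (λ p → :- (:- p) := p) refl
    0<B : 0ℚ < approx (- q) m
    0<B = approx-pos (- q) m 0<b
    0<v : 0ℚ < v
    0<v = <-trans (factor-pos 0<B 1<sB) s<v

  LExp-mono : ∀ {q r s} → q < r → LExp q s → LExp r s
  LExp-mono q<r (m , 0<a , s<A) = m , <-trans 0<a (base-mono m q<r)
    , <-≤-trans s<A (^-mono (suc m) 0<a (<⇒≤ (base-mono m q<r)))

  UExp-mono : ∀ {q r s} → q < r → UExp r s → UExp q s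
  UExp-mono {q} {r} {s} q<r (m , 0<b , 1<sB) = m , <-trans 0<b lt
    , <-≤-trans 1<sB (*-monoʳ-≤ s
        (<⇒≤ (factor-pos (approx-pos (- r) m 0<b) 1<sB))
        (^-mono (suc m) 0<b (<⇒≤ lt)))
    where
    lt : base (- r) m < base (- q) m
    lt = base-mono m (neg-antimono-< q<r)

  exp-strict : ∀ {q r} → q < r → ∃ λ s → ∃ λ t → UExp q s × s < t × LExp r t
  exp-strict {q} {r} q<r = split (UExp-open q {A} (m , 0<b , 1<AB))
    where
    i = proj₁ (inverse (<-diff q<r))
    di≡1 : (r - q) * i ≡ 1ℚ
    di≡1 = proj₂ (proj₂ (inverse (<-diff q<r)))
    C₁ = - (- q)
    C₂ = - r
    C₃ = (r * q) * i
    C  = C₁ ⊔ (C₂ ⊔ C₃)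
    m  = proj₁ (small C)
    Cu<1 : C * u m < 1ℚ
    Cu<1 = proj₂ (small C)
    0<b : 0ℚ < base (- q) m
    0<b = base-small (- q) m (p≤p⊔q C₁ (C₂ ⊔ C₃)) Cu<1
    0<a : 0ℚ < base r m
    0<a = base-small r m (≤-trans (p≤p⊔q C₂ C₃) (p≤q⊔p C₁ (C₂ ⊔ C₃))) Cu<1
    z = base r m * base (- q) m
    δ = (r - q) * (1ℚ - C₃ * u m) * u m
    0<δ : 0ℚ < δ
    0<δ = *-pos (*-pos (<-diff q<r) (small-≤ m
      (≤-trans (p≤q⊔p C₂ C₃) (p≤q⊔p C₁ (C₂ ⊔ C₃))) Cu<1)) (0<u m)
    z≡ : z ≡ 1ℚ + δ
    z≡ = sym (trans
      (solve 4 (λ d k i u →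
        con 1ℚ :+ d :* (con 1ℚ :- (k :* i) :* u) :* u
        := con 1ℚ :+ (d :- k :* (d :* i) :* u) :* u)
        refl (r - q) (r * q) i (u m))
      (trans (cong (λ v → 1ℚ + ((r - q) - (r * q) * v * u m) * u m) di≡1)
        (solve 3 (λ q r u →
          con 1ℚ :+ ((r :- q) :- (r :* q) :* con 1ℚ :* u) :* u
          := (con 1ℚ :+ r :* u) :* (con 1ℚ :+ (:- q) :* u)) refl q r (u m))))
    1<z : 1ℚ < z
    1<z = <-from δ 0<δ z≡
    A = approx r m
    B = approx (- q) m
    0<B : 0ℚ < B
    0<B = approx-pos (- q) m 0<b
    1<AB : 1ℚ < A * B
    1<AB = subst (1ℚ <_) (^-distrib-* (base r m) (base (- q) m) (suc m)) (1<^ m 1<z)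
    split : (∃ λ s → s < A × UExp q s) → ∃ λ s → ∃ λ t → UExp q s × s < t × LExp r t
    split (s , s<A , Us) =
      let t , s<t , t<A = <-dense s<A in s , t , Us , s<t , m , 0<a , t<A

open ExpContinuity

module Log (x : ℝ) (0<x : L x 0ℚ) where

  U-pos : ∀ {t} → U x t → 0ℚ < t
  U-pos = L<U x 0<x

  LLog-inhabited : ∃ λ q → exp q <ᴿ x
  LLog-inhabited with L-open x 0<x
  ... | s , 0<s , Ls with inverse 0<s
  ...   | i , 0<i , si≡1 = - i , s , (0 , 0<b , 1<sb) , Ls
    where
    b≡ : 1ℚ + i ≡ base (- (- i)) 0
    b≡ = solve 1 (λ i → con 1ℚ :+ i := con 1ℚ :+ (:- (:- i)) :* con 1ℚ) refl i
    0<b : 0ℚ < base (- (- i)) 0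
    0<b = subst (0ℚ <_) b≡ (<-trans 0<i (<-from 1ℚ (0<u 0) (+-comm 1ℚ i)))
    1<sb : 1ℚ < s * approx (- (- i)) 0
    1<sb = <-from s 0<s (trans
      (solve 2 (λ s i → s :* ((con 1ℚ :+ (:- (:- i)) :* con 1ℚ) :* con 1ℚ)
        := s :* i :+ s) refl s i)
      (cong (_+ s) si≡1))

  ULog-inhabited : ∃ λ q → x <ᴿ exp q
  ULog-inhabited with U-inhabited x
  ... | t , Ut = t , t , Ut , 0
    , <-trans (U-pos Ut) t<b
    , subst (t <_) (sym (*-identityʳ (base t 0))) t<b
    where
    t<b : t < base t 0
    t<b = <-from 1ℚ (0<u 0)
      (solve 1 (λ t → con 1ℚ :+ t :* con 1ℚ := t :+ con 1ℚ) refl t)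

  LLog-open : ∀ {q} → exp q <ᴿ x → ∃ λ r → q < r × exp r <ᴿ x
  LLog-open {q} (s , Us , Ls) =
    let v , s<v , Lv = L-open x Ls
        r , q<r , Uv = UExp-raise {q} {s} {v} Us s<v
    in r , q<r , v , Uv , Lv

  ULog-open : ∀ {q} → x <ᴿ exp q → ∃ λ r → r < q × x <ᴿ exp r
  ULog-open {q} (s , Us , Ls) =
    let v , v<s , Uv = U-open x Us
        r , r<q , Lv = LExp-lower {q} {s} {v} Ls (U-pos Uv) v<s
    in r , r<q , v , Uv , Lv

  log-disjoint : ∀ {q} → exp q <ᴿ x → x <ᴿ exp q → ⊥
  log-disjoint {q} (s , Us , Ls) (t , Ut , Lt) =
    <-asym (LExp<UExp {q} {t} {s} Lt Us) (L<U x Ls Ut)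

  log-located : ∀ {q r} → q < r → exp q <ᴿ x ⊎ x <ᴿ exp r
  log-located {q} {r} q<r =
    let s , t , Us , s<t , Lt = exp-strict {q} {r} q<r in compare Us Lt (located x s<t)
    where
    compare : ∀ {s t} → UExp q s → LExp r t → L x s ⊎ U x t → exp q <ᴿ x ⊎ x <ᴿ exp r
    compare {s} Us Lt (inj₁ Ls) = inj₁ (s , Us , Ls)
    compare {t = t} Us Lt (inj₂ Ut) = inj₂ (t , Ut , Lt)

-- The inverse of the exponential: q < log x when e^q < x, and log x < q
-- when x < e^q.
log : (x : ℝ) → L x 0ℚ → ℝ
log x 0<x = record
  { L           = λ q → exp q <ᴿ x
  ; U           = λ q → x <ᴿ exp q
  ; L-inhabited = LLog-inhabited
  ; U-inhabited = ULog-inhabited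
  ; L-closed    = λ q<r (s , Us , Ls) → s , UExp-mono {s = s} q<r Us , Ls
  ; U-closed    = λ q<r (s , Us , Ls) → s , Us , LExp-mono {s = s} q<r Ls
  ; L-open      = LLog-open
  ; U-open      = ULog-open
  ; disjoint    = λ {q} → log-disjoint {q}
  ; located     = log-located
  }
  where open Log x 0<x

log-positive : (x : ℝ) (0<x : L x 0ℚ) → L x 1ℚ → L (log x 0<x) 0ℚ
log-positive x 0<x 1<x with L-open x 1<x
... | s , 1<s , Ls = s , (0 , 0<u 0 , subst (1ℚ <_) (sym (*-identityʳ s)) 1<s) , Ls

ℕ→ℚ-mono-< : ∀ {m n} → m ℕ.< n → ℕ→ℚ m < ℕ→ℚ n
ℕ→ℚ-mono-< {m} {n} m<n = subst₂ _<_ (sym (ℕ→ℚ-mk m)) (sym (ℕ→ℚ-mk n))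
  (*<* (subst₂ ℤ._<_ (sym (ℤ.*-identityʳ (+ m))) (sym (ℤ.*-identityʳ (+ n))) (ℤ.+<+ m<n)))

loglog : (n : ℕ) → 1 ℕ.< n → ℝ
loglog n 1<n = log (log (fromℕ n) 0<n) (log-positive (fromℕ n) 0<n (ℕ→ℚ-mono-< 1<n))
  where
  0<n : L (fromℕ n) 0ℚ
  0<n = ℕ→ℚ-mono-< (ℕ.<-trans (ℕ.n<1+n 0) 1<n)

{-# OPTIONS --safe #-}

-- The ratio σ*(n)/n is at most ∏ (1 + 1/q) over the primes q dividing n.  If n
-- has at most 1900 prime factors, the i-th of them is at least the i-th prime,
-- so that a product over the first few primes bounds the ratio from above while
-- another one bounds n from below, and a short table settles the inequality.
-- Otherwise n ≥ 2^16384.  The q ≤ 2¹⁴ contribute at most the product over all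
-- such primes.  For the larger ones, Legendre's formula for (2^j)! together with
-- Chebyshev's bound on the primes between M and 2M gives a dyadic form of
-- Mertens' first theorem, Σ i/p ≤ j - 14 + 1.47 over 2¹⁴ < p ≤ 2^j with
-- 2^i < p ≤ 2^(i+1).  These bounds for all j and Σ log₂ q ≤ log₂ n are the
-- constraints of a linear program for Σ 1/q.  A dual solution, made explicit by
-- Abel summation, bounds ∏ (1 + 1/q) by a rational function of J, where
-- 2^J ≤ ⌊log₂ n⌋ < 2^(J+1).

module Submission where

-- The upper limit of σ*(n)/(n log log n) is 6e^γ/π² ≈ 1.083, so large n leave room for crude
-- constants, whereas 570570 gives 1.312 and the product of the first 8 primes still 1.293: the
-- tight cases are finite in number. For unbounded n, a comparison with the first primes would ask
-- for a lower bound on their product and for an estimate of ∏ (1 + 1/p) over all of them. The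
-- linear program replaces both: it takes Mertens' bound from above only, and the size of n enters
-- through its own binary digits instead of through a product of consecutive primes. The cutoff 2¹⁴
-- is a compromise: below it everything is computed, and above it the error 1.47 is divided by the
-- first weight 14, a loss of about a tenth in Σ 1/q. Logarithms are met only through lower bounds
-- for log log n, multiples of 1/1000 certified by comparing powers of 1000 and 999, so that the
-- finite and the infinite case both end in inequalities between natural numbers.

-- Unitary divisors and the prime support of n

module UnitaryDivisors where
  open import Data.Nat
  open import Data.Nat.Properties
  open import Data.Nat.Coprimality using (Coprime; coprime⇒gcd≡1; gcd≡1⇒coprime; coprime-divisor)
    renaming (sym to coprime-sym)
  open import Data.Nat.Divisibility
  open import Data.Nat.DivMod using (m*n/n≡m)
  open import Data.Nat.GCD using (gcd)
  open import Data.Nat.ListAction using (sum; product)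
  open import Data.Nat.ListAction.Properties using (sum-++; sum-↭)
  open import Data.Nat.Primality
  open import Data.Nat.Solver using (module +-*-Solver)
  open import Data.List using (List; []; _∷_; _++_; map; filter; upTo)
  open import Data.List.Membership.Propositional using (_∈_)
  open import Data.List.Membership.Propositional.Properties
    using (∈-map⁺; ∈-map⁻; ∈-filter⁺; ∈-filter⁻; ∈-upTo⁺; ∈-++⁺ˡ; ∈-++⁺ʳ; ∈-∃++)
  open import Data.List.Relation.Binary.Permutation.Propositional.Properties using (shift; ∈-resp-↭)
  open import Data.List.Relation.Unary.All using (All; []; _∷_)
  import Data.List.Relation.Unary.All as All
  open import Data.List.Relation.Unary.AllPairs using ([]; _∷_)
  open import Data.List.Relation.Unary.Any using (here; there)
  open import Data.List.Relation.Unary.Unique.Propositional using (Unique)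
  import Data.List.Relation.Unary.Unique.Propositional.Properties as Unique
  open import Data.Product using (∃; ∃₂; _×_; _,_; proj₂)
  open import Data.Sum using (inj₁; inj₂)
  open import Relation.Nullary using (yes; no; contradiction)
  open import Relation.Binary.PropositionalEquality
  open import Defs using (σ*; unitaryDivisor?)
  open +-*-Solver using (solve; _:=_; _:+_; _:*_; con)

  -- For an upper bound of `σ*` it is enough to include the unitary divisors in a list of
  -- candidates, which may contain repetitions and non-divisors.
  sum-⊆ : ∀ {xs} ys → Unique xs → (∀ {x} → x ∈ xs → x ∈ ys) → sum xs ≤ sum ys
  sum-⊆ ys [] xs⊆ys = z≤n
  sum-⊆ {x ∷ xs} ys (x∉xs ∷ u) xs⊆ys with ∈-∃++ (xs⊆ys (here refl))
  ... | as , bs , refl = subst (x + sum xs ≤_) (sym (sum-↭ (shift x as bs)))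
    (+-monoʳ-≤ x (sum-⊆ (as ++ bs) u λ y∈xs → rest y∈xs (∈-resp-↭ (shift x as bs) (xs⊆ys (there y∈xs)))))
    where
    rest : ∀ {y} → y ∈ xs → y ∈ x ∷ as ++ bs → y ∈ as ++ bs
    rest y∈xs (here refl) = contradiction refl (All.lookup x∉xs y∈xs)
    rest y∈xs (there y∈)  = y∈

  coprime-* : ∀ {a b x} → Coprime a x → Coprime b x → Coprime (a * b) x
  coprime-* {a} {b} a⊥x b⊥x {i} (i∣ab , i∣x) = b⊥x (coprime-divisor i⊥a i∣ab , i∣x)
    where
    i⊥a : Coprime i a
    i⊥a (j∣i , j∣a) = a⊥x (j∣a , ∣-trans j∣i i∣x)

  coprime-^ : ∀ {a x} k → Coprime a x → Coprime (a ^ k) x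
  coprime-^ zero    a⊥x (i∣1 , _) = ∣1⇒≡1 i∣1
  coprime-^ (suc k) a⊥x = coprime-* a⊥x (coprime-^ k a⊥x)

  prime∤⇒coprime : ∀ {p x} → Prime p → p ∤ x → Coprime p x
  prime∤⇒coprime pp p∤x (i∣p , i∣x) with prime⇒irreducible pp i∣p
  ... | inj₁ i≡1  = i≡1
  ... | inj₂ refl = contradiction i∣x p∤x

  prime∤1 : ∀ {p} → Prime p → p ∤ 1
  prime∤1 pp p∣1 = ¬prime[1] (subst Prime (∣1⇒≡1 p∣1) pp)

  unitaryDivisors : ℕ → List ℕ
  unitaryDivisors n = map suc (filter (λ i → unitaryDivisor? (suc i) n) (upTo n))

  ∈-unitaryDivisors⁻ : ∀ {d n} → d ∈ unitaryDivisors n → ∃ λ e → d * e ≡ n × Coprime d e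
  ∈-unitaryDivisors⁻ {n = n} d∈ with ∈-map⁻ suc d∈
  ... | i , i∈ , refl with proj₂ (∈-filter⁻ (λ i → unitaryDivisor? (suc i) n) {xs = upTo n} i∈)
  ...   | divides e n≡ed , gcd≡1 = e , trans (*-comm (suc i) e) (sym n≡ed)
    , gcd≡1⇒coprime (subst (λ x → gcd (suc i) x ≡ 1)
        (trans (cong (_/ suc i) n≡ed) (m*n/n≡m e (suc i))) gcd≡1)

  ∈-unitaryDivisors⁺ : ∀ {d e} .{{_ : NonZero (d * e)}} → Coprime d e → d ∈ unitaryDivisors (d * e)
  ∈-unitaryDivisors⁺ {zero} ⦃ () ⦄
  ∈-unitaryDivisors⁺ {suc i} {e} d⊥e = ∈-map⁺ suc (∈-filter⁺ (λ j → unitaryDivisor? (suc j) (suc i * e))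
    (∈-upTo⁺ (∣⇒≤ (m∣m*n {suc i} e)))
    (m∣m*n e , trans (cong (gcd (suc i)) (trans (cong (_/ suc i) (*-comm (suc i) e)) (m*n/n≡m e (suc i))))
      (coprime⇒gcd≡1 d⊥e)))

  unitaryDivisors-unique : ∀ n → Unique (unitaryDivisors n)
  unitaryDivisors-unique n = Unique.map⁺ suc-injective
    (Unique.filter⁺ (λ i → unitaryDivisor? (suc i) n) (Unique.upTo⁺ n))

  sum-map-* : ∀ c xs → sum (map (c *_) xs) ≡ c * sum xs
  sum-map-* c []       = sym (*-zeroʳ c)
  sum-map-* c (x ∷ xs) = trans (cong (c * x +_) (sum-map-* c xs)) (sym (*-distribˡ-+ c x (sum xs)))

  -- A unitary divisor of p^k m is either prime to p or divisible by p^k.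
  σ*-*-≤ : ∀ {p m} k .{{_ : NonZero m}} → Prime p → p ∤ m → σ* (p ^ suc k * m) ≤ (1 + p ^ suc k) * σ* m
  σ*-*-≤ {p} {m} k pp p∤m = subst (σ* (q * m) ≤_)
    (trans (sum-++ (unitaryDivisors m) (map (q *_) (unitaryDivisors m)))
      (cong (σ* m +_) (sum-map-* q (unitaryDivisors m))))
    (sum-⊆ (unitaryDivisors m ++ map (q *_) (unitaryDivisors m)) (unitaryDivisors-unique (q * m)) split)
    where
    q = p ^ suc k
    instance
      _ : NonZero p
      _ = prime⇒nonZero pp
      _ : NonZero q
      _ = m^n≢0 p (suc k)
    p∣q : p ∣ q
    p∣q = m∣m*n (p ^ k)
    member : ∀ {d e} → d * e ≡ m → Coprime d e → d ∈ unitaryDivisors m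
    member refl d⊥e = ∈-unitaryDivisors⁺ d⊥e
    cancel : ∀ {x} → q * x ≡ q * m → x ≡ m
    cancel {x} = *-cancelˡ-≡ x m q
    split : ∀ {d} → d ∈ unitaryDivisors (q * m) → d ∈ unitaryDivisors m ++ map (q *_) (unitaryDivisors m)
    split {d} d∈ with ∈-unitaryDivisors⁻ d∈ | p ∣? d
    ... | e , de≡qm , d⊥e | no p∤d
      with coprime-divisor {o = e} (coprime-^ (suc k) (prime∤⇒coprime pp p∤d)) (subst (q ∣_) (sym de≡qm) (m∣m*n m))
    ...   | divides e′ refl = ∈-++⁺ˡ (member
      (cancel (trans (solve 3 (λ q d e → q :* (d :* e) := d :* (e :* q)) refl q d e′) de≡qm))
      λ (i∣d , i∣e′) → d⊥e (i∣d , ∣m⇒∣m*n q i∣e′))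
    split {d} d∈ | e , de≡qm , d⊥e | yes p∣d
      with coprime-divisor {o = d} (coprime-^ (suc k) (prime∤⇒coprime pp λ p∣e → prime∤1 pp (∣-reflexive (d⊥e (p∣d , p∣e)))))
             (subst (q ∣_) (trans (sym de≡qm) (*-comm d e)) (m∣m*n m))
    ...   | divides d′ refl = ∈-++⁺ʳ (unitaryDivisors m) (subst (_∈ map (q *_) (unitaryDivisors m)) (*-comm q d′)
      (∈-map⁺ (q *_) (member
        (cancel (trans (solve 3 (λ q d e → q :* (d :* e) := (d :* q) :* e) refl q d′ e) de≡qm))
        λ (i∣d′ , i∣e) → d⊥e (∣m⇒∣m*n q i∣d′ , i∣e))))

  infixr 5 _∷_

  data AscendingPrimes (a : ℕ) : List ℕ → Set where
    []  : AscendingPrimes a []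
    _∷_ : ∀ {q qs} → (a < q × Prime q) → AscendingPrimes q qs → AscendingPrimes a (q ∷ qs)

  ascending-weaken : ∀ {a b qs} → a ≤ b → AscendingPrimes b qs → AscendingPrimes a qs
  ascending-weaken a≤b []               = []
  ascending-weaken a≤b ((b<q , pq) ∷ A) = (≤-<-trans a≤b b<q , pq) ∷ A

  record Support (n a : ℕ) : Set where
    constructor support
    field
      primes    : List ℕ
      ascending : AscendingPrimes a primes
      divides-n : product primes ∣ n
      bound     : σ* n * product primes ≤ n * product (map suc primes)

  strip : ∀ {p} → Prime p → ∀ m → .{{NonZero m}} → ∃₂ λ k m′ → m ≡ p ^ k * m′ × NonZero m′ × p ∤ m′
  strip {p} pp m = go m m ≤-refl
    where
    instance
      _ : NonZero p
      _ = prime⇒nonZero pp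
    go : ∀ b m → .{{NonZero m}} → m ≤ b → ∃₂ λ k m′ → m ≡ p ^ k * m′ × NonZero m′ × p ∤ m′
    go zero (suc m) ()
    go (suc b) m m≤b with p ∣? m
    ... | no p∤m = 0 , m , sym (*-identityˡ m) , nonZero′ , p∤m
      where
      nonZero′ : NonZero m
      nonZero′ = >-nonZero (>-nonZero⁻¹ m)
    ... | yes (divides m′ refl) with go b m′ {{m*n≢0⇒m≢0 m′}}
        (s≤s⁻¹ (<-≤-trans (m<m*n m′ p {{m*n≢0⇒m≢0 m′}} (nonTrivial⇒n>1 p {{prime⇒nonTrivial pp}})) m≤b))
    ...   | k , m″ , refl , nz , p∤ = suc k , m″
      , solve 3 (λ p x m → x :* m :* p := p :* x :* m) refl p (p ^ k) m″ , nz , p∤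

  -- Trial division in increasing order keeps the list ascending, and roughness makes each divisor
  -- found a prime. Stripping p^k costs the factor (1 + p^k)/p^k ≤ (1 + p)/p, which forgets the
  -- exponents.
  prime-support : ∀ n → .{{NonZero n}} → Support n 1
  prime-support n = go n 0 n (m≤n+m n 1) 2-rough
    where
    go : ∀ k b n → .{{NonZero n}} → n ≤ suc b + k → (2 + b) Rough n → Support n (suc b)
    go k b 1 n≤ rough = support [] [] ∣-refl ≤-refl
    -- The fuel `k` is spent once n ≤ b + 1, but a (2 + b)-rough n > 1 is at least b + 2.
    go zero b n@(2+ _) n≤ rough =
      contradiction (rough⇒≤ rough) (<⇒≱ (s≤s (subst (n ≤_) (+-identityʳ (suc b)) n≤)))
    go (suc k) b n@(2+ _) n≤ rough with (2 + b) ∣? n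
    ... | no p∤n =
      let support qs A d s = go k (suc b) n (subst (n ≤_) (+-suc (suc b) k) n≤) (∤⇒rough-suc p∤n rough)
      in support qs (ascending-weaken (n≤1+n (suc b)) A) d s
    ... | yes p∣n with strip pp n
      where
      pp : Prime (2 + b)
      pp = rough∧∣⇒prime rough p∣n
    ...   | zero , m , n≡ , nz , p∤m = contradiction (subst (2 + b ∣_) (trans n≡ (*-identityˡ m)) p∣n) p∤m
    ...   | suc j , m , n≡ , nz , p∤m = extend (go k (suc b) m {{nz}} m≤
      (∤⇒rough-suc p∤m (rough∧∣⇒rough rough m∣n)))
      where
      p = 2 + b
      q = p ^ suc j
      m∣n : m ∣ n
      m∣n = divides q n≡
      m≤ : m ≤ 2 + b + k
      m≤ = ≤-trans (∣⇒≤ m∣n) (subst (n ≤_) (+-suc (suc b) k) n≤)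
      p≤q : p ≤ q
      p≤q = ∣⇒≤ {{m^n≢0 p (suc j)}} (m∣m*n (p ^ j))
      pp : Prime p
      pp = rough∧∣⇒prime rough p∣n
      open ≤-Reasoning
      extend : Support m p → Support n (suc b)
      extend (support qs A d s) = support (p ∷ qs) ((≤-refl , pp) ∷ A)
        (subst (p * product qs ∣_) (sym n≡) (*-pres-∣ (m∣m*n {p} (p ^ j)) d))
        (begin
          σ* n * (p * product qs)
            ≡⟨ cong (λ x → σ* x * (p * product qs)) n≡ ⟩
          σ* (q * m) * (p * product qs)
            ≤⟨ *-monoˡ-≤ (p * product qs) (σ*-*-≤ j {{nz}} pp p∤m) ⟩
          (1 + q) * σ* m * (p * product qs)
            ≡⟨ solve 4 (λ q s p x → (con 1 :+ q) :* s :* (p :* x) := (p :+ q :* p) :* (s :* x)) refl q (σ* m) p (product qs) ⟩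
          (p + q * p) * (σ* m * product qs)
            ≤⟨ *-mono-≤ (+-monoˡ-≤ (q * p) p≤q) s ⟩
          (q + q * p) * (m * product (map suc qs))
            ≡⟨ solve 4 (λ q p m y → (q :+ q :* p) :* (m :* y) := (q :* m) :* ((con 1 :+ p) :* y)) refl q p m (product (map suc qs)) ⟩
          q * m * (suc p * product (map suc qs))
            ≡⟨ cong (_* (suc p * product (map suc qs))) n≡ ⟨
          n * (suc p * product (map suc qs)) ∎)

-- Lists of primes and their comparison

module PrimeLists where
  open import Data.Nat
  open import Data.Nat.Properties
  open import Data.Nat.Divisibility
  open import Data.Nat.ListAction using (product)
  open import Data.Nat.Primality
  open import Data.Nat.Solver using (module +-*-Solver)
  open import Data.List using (List; []; _∷_; _++_; map; filter; length; take)
  open import Data.List.Properties using (filter-++)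
  open import Data.List.Relation.Binary.Sublist.Propositional using (_⊆_; []; _∷_; _∷ʳ_; minimum)
  open import Data.List.Relation.Unary.All using (All; []; _∷_)
  open import Data.Product using (_,_)
  open import Function using (it)
  open import Relation.Nullary using (Dec; yes; no; contradiction)
  open import Relation.Binary.PropositionalEquality
  open UnitaryDivisors using (AscendingPrimes; []; _∷_; ascending-weaken)
  open +-*-Solver using (solve; _:=_; _:*_)

  -- Trial division up to the square root: the test in the library divides by
  -- every smaller number, which is too slow to list the primes below 2¹⁴.
  prime-from? : ∀ k d m .{{_ : NonTrivial m}} .{{_ : NonTrivial d}} →
                d Rough m → m < (d + k) * (d + k) → Dec (Prime m)
  prime-from? zero d m rough m<d² =
    yes (rough∧square>⇒prime rough (subst (λ x → m < x * x) (+-identityʳ d) m<d²))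
  prime-from? (suc k) d m rough m<d² with m <? d * d
  ... | yes m<dd = yes (rough∧square>⇒prime rough m<dd)
  ... | no  m≮dd with d ∣? m
  ...   | yes d∣m = no (composite⇒¬prime (composite (≤∧≢⇒< (∣⇒≤ {{nonTrivial⇒nonZero m}} d∣m)
    λ { refl → m≮dd (m<m*n m m {{nonTrivial⇒nonZero m}} (nonTrivial⇒n>1 m)) }) d∣m))
  ...   | no  d∤m = prime-from? k (suc d) m {{it}} {{n>1⇒nonTrivial (m<n⇒m<1+n (nonTrivial⇒n>1 d))}}
    (∤⇒rough-suc d∤m rough) (subst (λ x → m < x * x) (+-suc d k) m<d²)

  isPrime? : ∀ m → Dec (Prime m)
  isPrime? 0 = no ¬prime[0]
  isPrime? 1 = no ¬prime[1]
  isPrime? m@(2+ _) = prime-from? m 2 m 2-rough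
    (≤-trans (m<m*n m m (s≤s (s≤s z≤n))) (*-mono-≤ {m} {2 + m} {m} {2 + m} (m≤n+m m 2) (m≤n+m m 2)))

  range : ℕ → ℕ → List ℕ
  range a zero    = []
  range a (suc k) = suc a ∷ range (suc a) k

  primesIn : ℕ → ℕ → List ℕ
  primesIn a k = filter isPrime? (range a k)

  range-++ : ∀ a k l → range a (k + l) ≡ range a k ++ range (a + k) l
  range-++ a zero    l = cong (λ b → range b l) (sym (+-identityʳ a))
  range-++ a (suc k) l = cong (suc a ∷_)
    (trans (range-++ (suc a) k l) (cong (λ b → range (suc a) k ++ range b l) (sym (+-suc a k))))

  primesIn-++ : ∀ a k l → primesIn a (k + l) ≡ primesIn a k ++ primesIn (a + k) l
  primesIn-++ a k l = trans (cong (filter isPrime?) (range-++ a k l)) (filter-++ isPrime? (range a k) (range (a + k) l))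

  primesIn-ascending : ∀ a k → AscendingPrimes a (primesIn a k)
  primesIn-ascending a zero = []
  primesIn-ascending a (suc k) with isPrime? (suc a)
  ... | yes pp = (≤-refl , pp) ∷ primesIn-ascending (suc a) k
  ... | no  _  = ascending-weaken (n≤1+n a) (primesIn-ascending (suc a) k)

  primesIn-≤ : ∀ a k → All (_≤ a + k) (primesIn a k)
  primesIn-≤ a zero = []
  primesIn-≤ a (suc k) with isPrime? (suc a)
  ... | yes _ = subst (suc a ≤_) (sym (+-suc a k)) (m≤m+n (suc a) k)
    ∷ subst (λ b → All (_≤ b) (primesIn (suc a) k)) (sym (+-suc a k)) (primesIn-≤ (suc a) k)
  ... | no  _ = subst (λ b → All (_≤ b) (primesIn (suc a) k)) (sym (+-suc a k)) (primesIn-≤ (suc a) k)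

  -- Either list may run out first, so that one relation serves for products, where `rs` has to be
  -- the shorter list, and for the ratios ∏ (1 + 1/q), where `qs` has to be.
  data Below : List ℕ → List ℕ → Set where
    []ˡ : ∀ {qs} → Below [] qs
    []ʳ : ∀ {rs} → Below rs []
    _∷_ : ∀ {r rs q qs} → r ≤ q → Below rs qs → Below (r ∷ rs) (q ∷ qs)

  -- The next prime after `a` is at most the head of `qs`, and the tail of `qs` ascends beyond that
  -- prime, so the comparison continues term by term.
  primesIn-below : ∀ {a qs} k → AscendingPrimes a qs → Below (primesIn a k) qs
  primesIn-below zero A = []ˡ
  primesIn-below (suc k) [] = []ʳ
  primesIn-below {a} (suc k) ((a<q , pq) ∷ A) with isPrime? (suc a)
  ... | yes _  = a<q ∷ primesIn-below k (ascending-weaken a<q A)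
  ... | no ¬pp = primesIn-below k ((≤∧≢⇒< a<q (λ { refl → ¬pp pq }) , pq) ∷ A)

  below-take : ∀ {rs qs} k → Below rs qs → Below (take k rs) qs
  below-take zero    B         = []ˡ
  below-take (suc k) []ˡ       = []ˡ
  below-take (suc k) []ʳ       = []ʳ
  below-take (suc k) (r≤q ∷ B) = r≤q ∷ below-take k B

  below-product : ∀ {rs qs a} → AscendingPrimes a qs → Below rs qs → length rs ≤ length qs →
                  product rs ≤ product qs
  below-product []              []ˡ _ = ≤-refl
  below-product ((a<q , _) ∷ A) []ˡ _ =
    *-mono-≤ (≤-trans (s≤s z≤n) a<q) (below-product A []ˡ z≤n)
  below-product {[]}    []  []ʳ _  = ≤-refl
  below-product {_ ∷ _} []  []ʳ ()
  below-product (_ ∷ A) (r≤q ∷ B) (s≤s l) = *-mono-≤ r≤q (below-product A B l)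

  product≤product-suc : ∀ rs → product rs ≤ product (map suc rs)
  product≤product-suc []       = ≤-refl
  product≤product-suc (r ∷ rs) = *-mono-≤ (n≤1+n r) (product≤product-suc rs)

  interchange : ∀ a b c d → (a * b) * (c * d) ≡ (a * c) * (b * d)
  interchange = solve 4 (λ a b c d → (a :* b) :* (c :* d) := (a :* c) :* (b :* d)) refl

  -- The ratios are cross-multiplied to stay in ℕ: 1 + 1/q decreases in q, and the surplus factors
  -- of `rs` exceed 1.
  below-ratio : ∀ {rs qs} → Below rs qs → length qs ≤ length rs →
                product (map suc qs) * product rs ≤ product (map suc rs) * product qs
  below-ratio {qs = []} []ˡ _ = ≤-refl
  below-ratio {qs = _ ∷ _} []ˡ ()
  below-ratio {rs} []ʳ _ = subst₂ _≤_ (sym (*-identityˡ (product rs)))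
    (sym (*-identityʳ (product (map suc rs)))) (product≤product-suc rs)
  below-ratio {r ∷ rs} {q ∷ qs} (r≤q ∷ B) (s≤s l) = subst₂ _≤_
    (sym (interchange (suc q) (product (map suc qs)) r (product rs)))
    (sym (interchange (suc r) (product (map suc rs)) q (product qs)))
    (*-mono-≤ (subst (suc q * r ≤_) (cong (q +_) (*-comm q r)) (+-monoˡ-≤ (q * r) r≤q)) (below-ratio B l))

  ⊆-ratio : ∀ {qs rs} → qs ⊆ rs →
            product (map suc qs) * product rs ≤ product (map suc rs) * product qs
  ⊆-ratio [] = ≤-refl
  ⊆-ratio {qs} {rs = _ ∷ rs} (r ∷ʳ S) = subst₂ _≤_
    (solve 3 (λ x r y → r :* (x :* y) := x :* (r :* y)) refl (product (map suc qs)) r (product rs))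
    (sym (*-assoc (suc r) (product (map suc rs)) (product qs)))
    (*-mono-≤ (n≤1+n r) (⊆-ratio S))
  ⊆-ratio {q ∷ qs} {rs = _ ∷ rs} (refl ∷ S) = subst₂ _≤_
    (sym (interchange (suc q) (product (map suc qs)) q (product rs)))
    (sym (interchange (suc q) (product (map suc rs)) q (product qs)))
    (*-monoʳ-≤ (suc q * q) (⊆-ratio S))

  record Split (a k : ℕ) (qs : List ℕ) : Set where
    constructor split
    field
      low high  : List ℕ
      qs≡       : qs ≡ low ++ high
      low⊆      : low ⊆ primesIn a k
      ascending : AscendingPrimes (a + k) high

  ⊆-skip : ∀ {a xs} k → xs ⊆ primesIn (suc a) k → xs ⊆ primesIn a (suc k)
  ⊆-skip {a} k S with isPrime? (suc a)
  ... | yes _ = suc a ∷ʳ S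
  ... | no  _ = S

  ⊆-keep : ∀ {a xs} k → Prime (suc a) → xs ⊆ primesIn (suc a) k → suc a ∷ xs ⊆ primesIn a (suc k)
  ⊆-keep {a} k pp S with isPrime? (suc a)
  ... | yes _  = refl ∷ S
  ... | no ¬pp = contradiction pp ¬pp

  split-primes : ∀ {a qs} k → AscendingPrimes a qs → Split a k qs
  split-primes {a} {qs} zero A = split [] qs refl [] (subst (λ b → AscendingPrimes b qs) (sym (+-identityʳ a)) A)
  split-primes (suc k) [] = split [] [] refl (minimum _) []
  split-primes {a} {q ∷ qs} (suc k) ((a<q , pq) ∷ A) with suc a ≟ q
  ... | yes refl =
    let split low high eq low⊆ asc = split-primes k A
    in split (suc a ∷ low) high (cong (suc a ∷_) eq) (⊆-keep k pq low⊆)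
         (subst (λ b → AscendingPrimes b high) (sym (+-suc a k)) asc)
  ... | no a+1≢q =
    let split low high eq low⊆ asc = split-primes k ((≤∧≢⇒< a<q a+1≢q , pq) ∷ A)
    in split low high eq (⊆-skip k low⊆) (subst (λ b → AscendingPrimes b high) (sym (+-suc a k)) asc)

-- Legendre's formula and Chebyshev's bound

module Chebyshev where
  open import Data.Nat
  open import Data.Nat.Properties
  open import Data.Nat.Combinatorics using ([n∸k]!k!∣n!)
  open import Data.Nat.Coprimality using (Coprime; coprime-divisor) renaming (sym to coprime-sym)
  open import Data.Nat.Divisibility
  open import Data.Nat.DivMod using (m/n*n≤m; m/n/o≡m/[n*o]; m≡m%n+[m/n]*n; m%n<n)
  open import Data.Nat.ListAction using (sum; product)
  open import Data.Nat.ListAction.Properties using (product-++)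
  open import Data.Nat.Primality
  open import Data.Nat.Solver using (module +-*-Solver)
  open import Data.List using (List; []; _∷_; _++_; map)
  open import Data.List.Membership.Propositional using (_∈_)
  open import Data.List.Properties using (map-++)
  open import Data.List.Relation.Unary.All as All using (All; []; _∷_)
  open import Data.List.Relation.Unary.Any using (here; there)
  open import Data.Product using (_,_)
  open import Data.Sum using (inj₁; inj₂)
  open import Function using (it)
  open import Relation.Nullary using (contradiction)
  open import Relation.Binary.PropositionalEquality
  open UnitaryDivisors
  open PrimeLists
  open +-*-Solver using (solve; _:=_; _:+_; _:*_; con)

  -- The value 0 at divisor 0 lets exponents be plain functions of p, without a proof that p is
  -- nonzero.
  _÷_ : ℕ → ℕ → ℕ
  N ÷ zero    = 0
  N ÷ q@(suc _) = N / q

  ÷-* : ∀ N q r .{{_ : NonZero q}} .{{_ : NonZero r}} → N ÷ (q * r) ≡ (N ÷ q) ÷ r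
  ÷-* N q@(suc _) r@(suc _) = sym (m/n/o≡m/[n*o] N q r)

  ÷-upper : ∀ N q .{{_ : NonZero q}} → N ≤ suc (N ÷ q) * q
  ÷-upper N q@(suc _) = begin
    N                     ≡⟨ m≡m%n+[m/n]*n N q ⟩
    N % q + (N / q) * q   ≤⟨ +-monoˡ-≤ ((N / q) * q) (<⇒≤ (m%n<n N q)) ⟩
    q + (N / q) * q       ∎
    where open ≤-Reasoning

  ÷-lower : ∀ N q → (N ÷ q) * q ≤ N
  ÷-lower N zero      = z≤n
  ÷-lower N q@(suc _) = m/n*n≤m N q

  -- legendre f p p N = ⌊N/p⌋ + ⌊N/p²⌋ + … + ⌊N/p^f⌋.
  legendre : ℕ → ℕ → ℕ → ℕ → ℕ
  legendre zero    q p N = 0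
  legendre (suc f) q p N = N ÷ q + legendre f (q * p) p N

  legendre-÷ : ∀ f q r p N .{{_ : NonZero q}} .{{_ : NonZero r}} .{{_ : NonZero p}} →
               legendre f (q * r) p N ≡ legendre f r p (N ÷ q)
  legendre-÷ zero    q r p N = refl
  legendre-÷ (suc f) q r p N = cong₂ _+_ (÷-* N q r)
    (trans (cong (λ x → legendre f x p N) (*-assoc q r p)) (legendre-÷ f q (r * p) p N {{it}} {{m*n≢0 r p}}))

  -- For each of the `f` powers q, ⌊M/q⌋/M ≤ 1/q ≤ (⌊N/q⌋ + 1)/N. This carries exponents computed
  -- once, at a fixed M, over to every N.
  legendre-scale : ∀ f q p M N .{{_ : NonZero q}} .{{_ : NonZero p}} →
                   N * legendre f q p M ≤ M * (legendre f q p N + f)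
  legendre-scale zero    q p M N = subst (_≤ M * 0) (sym (*-zeroʳ N)) z≤n
  legendre-scale (suc f) q p M N = begin
    N * (M ÷ q + legendre f (q * p) p M)
      ≡⟨ *-distribˡ-+ N (M ÷ q) _ ⟩
    N * (M ÷ q) + N * legendre f (q * p) p M
      ≤⟨ +-mono-≤ head (legendre-scale f (q * p) p M N {{m*n≢0 q p}}) ⟩
    M * suc (N ÷ q) + M * (legendre f (q * p) p N + f)
      ≡⟨ solve 4 (λ M a b f → M :* (con 1 :+ a) :+ M :* (b :+ f) := M :* (a :+ b :+ (con 1 :+ f))) refl M (N ÷ q) (legendre f (q * p) p N) f ⟩
    M * (N ÷ q + legendre f (q * p) p N + suc f) ∎
    where
    open ≤-Reasoning
    head : N * (M ÷ q) ≤ M * suc (N ÷ q)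
    head = begin
      N * (M ÷ q)                   ≤⟨ *-monoˡ-≤ (M ÷ q) (÷-upper N q) ⟩
      suc (N ÷ q) * q * (M ÷ q)     ≡⟨ solve 3 (λ a q b → a :* q :* b := (b :* q) :* a) refl (suc (N ÷ q)) q (M ÷ q) ⟩
      (M ÷ q) * q * suc (N ÷ q)     ≤⟨ *-monoˡ-≤ (suc (N ÷ q)) (÷-lower M q) ⟩
      M * suc (N ÷ q)               ∎

  ^-factorial : ∀ p .{{_ : NonZero p}} k → p ^ k * k ! ∣ (k * p) !
  ^-factorial p           zero    = ∣-refl
  ^-factorial p@(suc p-1) (suc k) = subst (_∣ (suc k * p) !)
    (solve 4 (λ p k a b → (p :+ k :* p) :* (a :* b) := p :* a :* (b :+ k :* b)) refl p k (p ^ k) (k !))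
    (*-monoʳ-∣ (suc k * p) (∣-trans (^-factorial p k) (m≤n⇒m!∣n! (m≤n+m (k * p) p-1))))

  -- The multiples of p up to N contribute p^⌊N/p⌋ · ⌊N/p⌋!, and the induction continues with ⌊N/p⌋;
  -- cutting it off after `f` powers leaves a divisor.
  legendre-∣ : ∀ f p N .{{_ : NonZero p}} → p ^ legendre f p p N ∣ N !
  legendre-∣ zero    p N = 1∣ (N !)
  legendre-∣ (suc f) p N = subst (_∣ N !)
    (trans (sym (^-distribˡ-+-* p (N ÷ p) (legendre f p p (N ÷ p))))
      (cong (λ x → p ^ (N ÷ p + x)) (sym (legendre-÷ f p p p N))))
    (∣-trans (*-monoʳ-∣ (p ^ (N ÷ p)) (legendre-∣ f p (N ÷ p)))
      (∣-trans (^-factorial p (N ÷ p)) (m≤n⇒m!∣n! (÷-lower N p))))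

  prime-∣! : ∀ {p} n → Prime p → p ∣ n ! → p ≤ n
  prime-∣! zero    pp p∣1 = contradiction p∣1 (prime∤1 pp)
  prime-∣! (suc n) pp p∣ with euclidsLemma (suc n) (n !) pp p∣
  ... | inj₁ p∣n  = ∣⇒≤ p∣n
  ... | inj₂ p∣n! = m≤n⇒m≤1+n (prime-∣! n pp p∣n!)

  powers : (ℕ → ℕ) → List ℕ → ℕ
  powers e ps = product (map (λ p → p ^ e p) ps)

  powers-++ : ∀ e ps qs → powers e (ps ++ qs) ≡ powers e ps * powers e qs
  powers-++ e ps qs = trans (cong product (map-++ (λ p → p ^ e p) ps qs)) (product-++ (map (λ p → p ^ e p) ps) _)

  coprime-powers : ∀ {p a ps} e → Prime p → p ≤ a → AscendingPrimes a ps → Coprime p (powers e ps)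
  coprime-powers e pp p≤a [] (i∣p , i∣1) = ∣1⇒≡1 i∣1
  coprime-powers {p} {a} {q ∷ ps} e pp p≤a ((a<q , pq) ∷ A) =
    coprime-sym (coprime-* (coprime-^ (e q) (coprime-sym (prime∤⇒coprime pp p∤q)))
      (coprime-sym (coprime-powers e pp (≤-trans p≤a (<⇒≤ a<q)) A)))
    where
    p∤q : p ∤ q
    p∤q p∣q with prime⇒irreducible pq p∣q
    ... | inj₁ refl = contradiction pp ¬prime[1]
    ... | inj₂ refl = contradiction a<q (≤⇒≯ p≤a)

  powers-∣ : ∀ {a ps X} e → AscendingPrimes a ps → (∀ {p} → p ∈ ps → Prime p → p ^ e p ∣ X) → powers e ps ∣ X
  powers-∣ e [] h = 1∣ _
  powers-∣ {ps = p ∷ ps} {X} e ((_ , pp) ∷ A) h with powers-∣ e A (λ p∈ → h (there p∈))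
  ... | divides k refl = subst (p ^ e p * powers e ps ∣_) (*-comm (powers e ps) k)
    (*-monoˡ-∣′ (coprime-divisor {o = k} (coprime-^ (e p) (coprime-powers e pp ≤-refl A))
      (subst (p ^ e p ∣_) (*-comm k (powers e ps)) (h (here refl) pp))))
    where
    *-monoˡ-∣′ : p ^ e p ∣ k → p ^ e p * powers e ps ∣ powers e ps * k
    *-monoˡ-∣′ d = subst (p ^ e p * powers e ps ∣_) (*-comm k (powers e ps)) (*-monoˡ-∣ (powers e ps) d)

  weighted : (W e : ℕ → ℕ) → List ℕ → ℕ
  weighted W e ps = sum (map (λ p → W p * e p) ps)

  ^-distrib-* : ∀ m n k → (m * n) ^ k ≡ m ^ k * n ^ k
  ^-distrib-* m n zero    = refl
  ^-distrib-* m n (suc k) = trans (cong (m * n *_) (^-distrib-* m n k)) (interchange m n (m ^ k) (n ^ k))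

  2^-cancel-≤ : ∀ {m n} → 2 ^ m ≤ 2 ^ n → m ≤ n
  2^-cancel-≤ h = ≮⇒≥ λ n<m → <⇒≱ (^-monoʳ-< 2 (s≤s (s≤s z≤n)) n<m) h

  -- `W p` is an integer lower bound for R log₂ p, so that logarithms occur only as exponents of 2;
  -- R = 16 gives a precision of 1/16 bit.
  2^weighted : ∀ {ps} W e R → All (λ p → 2 ^ W p ≤ p ^ R) ps → 2 ^ weighted W e ps ≤ powers e ps ^ R
  2^weighted W e R [] = ≤-reflexive (sym (^-zeroˡ R))
  2^weighted {p ∷ ps} W e R (w ∷ ws) = begin
    2 ^ (W p * e p + weighted W e ps)      ≡⟨ ^-distribˡ-+-* 2 (W p * e p) _ ⟩
    2 ^ (W p * e p) * 2 ^ weighted W e ps  ≤⟨ *-mono-≤ head (2^weighted W e R ws) ⟩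
    (p ^ e p) ^ R * powers e ps ^ R        ≡⟨ ^-distrib-* (p ^ e p) (powers e ps) R ⟨
    (p ^ e p * powers e ps) ^ R            ∎
    where
    open ≤-Reasoning
    head : 2 ^ (W p * e p) ≤ (p ^ e p) ^ R
    head = begin
      2 ^ (W p * e p)   ≡⟨ ^-*-assoc 2 (W p) (e p) ⟨
      (2 ^ W p) ^ e p   ≤⟨ ^-monoˡ-≤ (e p) w ⟩
      (p ^ R) ^ e p     ≡⟨ trans (^-*-assoc p R (e p)) (trans (cong (p ^_) (*-comm R (e p))) (sym (^-*-assoc p (e p) R))) ⟩
      (p ^ e p) ^ R     ∎

  factorial-double : ∀ M → (M + M) ! ≤ 4 ^ M * (M ! * M !)
  factorial-double zero    = ≤-refl
  factorial-double (suc M) = begin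
    (suc M + suc M) !
      ≡⟨ cong (λ x → suc x !) (+-suc M M) ⟩
    (2 + (M + M)) * ((1 + (M + M)) * (M + M) !)
      ≤⟨ *-monoʳ-≤ (2 + (M + M)) (*-monoˡ-≤ ((M + M) !) (n≤1+n (1 + (M + M)))) ⟩
    (2 + (M + M)) * ((2 + (M + M)) * (M + M) !)
      ≤⟨ *-monoʳ-≤ (2 + (M + M)) (*-monoʳ-≤ (2 + (M + M)) (factorial-double M)) ⟩
    (2 + (M + M)) * ((2 + (M + M)) * (4 ^ M * (M ! * M !)))
      ≡⟨ solve 3 (λ M x f → (con 2 :+ (M :+ M)) :* ((con 2 :+ (M :+ M)) :* (x :* (f :* f))) :=
           con 4 :* x :* (((con 1 :+ M) :* f) :* ((con 1 :+ M) :* f))) refl M (4 ^ M) (M !) ⟩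
    4 ^ suc M * (suc M ! * suc M !) ∎
    where open ≤-Reasoning

  block : ℕ → List ℕ
  block i = primesIn (2 ^ i) (2 ^ i)

  ascending-∈ : ∀ {a ps p} → AscendingPrimes a ps → p ∈ ps → a < p
  ascending-∈ ((a<q , _) ∷ A) (here refl) = a<q
  ascending-∈ ((a<q , _) ∷ A) (there p∈)  = <-trans a<q (ascending-∈ A p∈)

  -- The primes between M and 2M divide the central binomial coefficient.
  block-weight : ∀ i → weighted (λ _ → i) (λ _ → 1) (block i) ≤ 2 ^ suc i
  block-weight i with subst (λ x → M ! * x ! ∣ (M + M) !) (m+n∸n≡m M M) (subst (_∣ (M + M) !) (*-comm ((M + M ∸ M) !) (M !)) ([n∸k]!k!∣n! (m≤m+n M M)))
    where M = 2 ^ i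
  ... | divides C n!≡ = 2^-cancel-≤ (begin
    2 ^ weighted (λ _ → i) (λ _ → 1) (block i)
      ≤⟨ 2^weighted (λ _ → i) (λ _ → 1) 1 (All.tabulate λ {p} p∈ →
           subst (2 ^ i ≤_) (sym (^-identityʳ p)) (<⇒≤ (ascending-∈ (primesIn-ascending M M) p∈))) ⟩
    powers (λ _ → 1) (block i) ^ 1
      ≡⟨ ^-identityʳ _ ⟩
    powers (λ _ → 1) (block i)
      ≤⟨ ∣⇒≤ {{C≢0}} (powers-∣ (λ _ → 1) (primesIn-ascending M M) λ {p} p∈ pp → subst (_∣ C) (sym (^-identityʳ p)) (divides-C p∈ pp)) ⟩
    C
      ≤⟨ *-cancelʳ-≤ C (4 ^ M) (M ! * M !) {{M !* M !≢0}} (subst (_≤ 4 ^ M * (M ! * M !)) n!≡ (factorial-double M)) ⟩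
    4 ^ M
      ≡⟨ ^-*-assoc 2 2 M ⟩
    2 ^ (2 * M) ∎)
    where
    open ≤-Reasoning
    M = 2 ^ i
    C≢0 : NonZero C
    C≢0 = m*n≢0⇒m≢0 C {{subst NonZero n!≡ ((M + M) !≢0)}}
    divides-C : ∀ {p} → p ∈ block i → Prime p → p ∣ C
    divides-C {p} p∈ pp with euclidsLemma C (M ! * M !) pp (subst (p ∣_) n!≡ (p∣2M!))
      where
      ∣! : ∀ n → 0 < n → n ∣ n !
      ∣! (suc n) _ = m∣m*n (n !)
      p∣2M! : p ∣ (M + M) !
      p∣2M! = ∣-trans (∣! p (≤-<-trans z≤n (ascending-∈ (primesIn-ascending M M) p∈))) (m≤n⇒m!∣n! (All.lookup (primesIn-≤ M M) p∈))
    ... | inj₁ p∣C = p∣C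
    ... | inj₂ p∣MM with euclidsLemma (M !) (M !) pp p∣MM
    ...   | inj₁ p∣M = contradiction (prime-∣! M pp p∣M) (<⇒≱ (ascending-∈ (primesIn-ascending M M) p∈))
    ...   | inj₂ p∣M = contradiction (prime-∣! M pp p∣M) (<⇒≱ (ascending-∈ (primesIn-ascending M M) p∈))

-- Computations with the primes below 2¹⁴

module SmallPrimes where
  open import Data.List using (List; map; length; take)
  open import Data.Nat
  open import Data.Nat.DivMod using (m/n*n≤m)
  open import Data.Nat.ListAction using (product)
  open import Data.Nat.Properties
  open import Data.Product using (∃₂; _×_; _,_; proj₁; proj₂)
  open import Data.Unit using (⊤)
  open import Relation.Nullary using (Dec; yes; no; contradiction)
  open import Relation.Nullary.Decidable using (_×-dec_; toWitness)
  open import Relation.Binary.PropositionalEquality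
  open UnitaryDivisors using (AscendingPrimes)
  open PrimeLists
  open Chebyshev

  -- The first argument is fuel. Running out only lowers the result, so `2^lg≤` holds for every
  -- amount; p^16 ≤ 2^224 stays within the 300 halvings of `weight`.
  lg : ℕ → ℕ → ℕ
  lg zero    m = 0
  lg (suc k) m with m / 2
  ... | zero      = 0
  ... | h@(suc _) = suc (lg k h)

  2^lg≤ : ∀ k m .{{_ : NonZero m}} → 2 ^ lg k m ≤ m
  2^lg≤ zero    m = >-nonZero⁻¹ m
  2^lg≤ (suc k) m with m / 2 in eq
  ... | zero      = >-nonZero⁻¹ m
  ... | h@(suc _) = begin
    2 * 2 ^ lg k h  ≤⟨ *-monoʳ-≤ 2 (2^lg≤ k h) ⟩
    2 * h           ≡⟨ trans (*-comm 2 h) (cong (_* 2) (sym eq)) ⟩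
    m / 2 * 2       ≤⟨ m/n*n≤m m 2 ⟩
    m               ∎
    where open ≤-Reasoning

  -- ⌊16 log₂ p⌋
  weight : ℕ → ℕ
  weight p = lg 300 (p ^ 16)

  -- The powers p, p², … , p^(depth p) are at most 2¹⁴ when p is.
  depth : ℕ → ℕ
  depth p = suc (14 / suc (lg 20 p) ∸ 1)

  exponent : ℕ → ℕ → ℕ
  exponent N p = legendre (depth p) p p N

  -- step b L K : Steps a c settles the n with a to b distinct prime factors:
  -- 13007/10000 · K/1000 bounds ∏ (1 + 1/p) over the first b primes, and n is at
  -- least the product of the first a primes, hence at least 2^L.
  data Steps : ℕ → ℕ → Set where
    []   : ∀ {a} → Steps a a
    step : ∀ {a c} b (L K : ℕ) → Steps (suc b) c → Steps a c

  Valid : List ℕ → ℕ → ℕ → ℕ → ℕ → Set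
  Valid ps a b L K =
    product (map suc (take b ps)) * 10000000 ≤ 13007 * K * product (take b ps)
    × 2 ^ L ≤ product (take a ps)
    × 1 ≤ L
    -- As log n ≥ L log 2 > 692 L/1000 and 1000/999 > e^(1/1000), this places K/1000 below log log
    -- n.
    × 1000 ^ K * 1000 < 692 * L * 999 ^ K

  AllValid : List ℕ → ∀ {a c} → Steps a c → Set
  AllValid ps []               = ⊤
  AllValid ps {a} (step b L K s) = Valid ps a b L K × AllValid ps s

  allValid? : ∀ ps {a c} (s : Steps a c) → Dec (AllValid ps s)
  allValid? ps []               = yes _
  allValid? ps {a} (step b L K s) =
    ((_ ≤? _) ×-dec (_ ≤? _) ×-dec (_ ≤? _) ×-dec (_ <? _)) ×-dec allValid? ps s

  abstract
    -- Products of consecutive primes leave the least room at 8 factors, so the first intervals are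
    -- single counts; they widen as the slack grows, and the last one breaks off at the 1900 primes
    -- available.
    steps : Steps 8 1901
    steps = step 8 23 2765 (step 9 27 2926 (step 11 32 3096 (step 14 42 3367 (step 20 59 3707
      (step 33 95 4183 (step 64 182 4833 (step 152 424 5678 (step 459 1231 6744
      (step 1840 4578 8056 (step 1900 22626 9653 []))))))))))

  -- The first bound says that Σ log₂ p / p^a over the prime powers p^a ≤ 2¹⁴ is
  -- about 224928632027 / (16 · 2³⁰), up to rounding.
  Facts : List ℕ → Set
  Facts ps =
    224928632027 ≤ weighted weight (exponent (2 ^ 30)) ps
    × weighted weight depth ps ≤ 32 * 2 ^ 14
    × product (map suc ps) * 1000 ≤ 10518 * product ps
    × 2 ^ 16384 ≤ product ps
    × length ps ≡ 1900
    × AllValid ps steps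

  facts? : ∀ ps → Dec (Facts ps)
  facts? ps = (_ ≤? _) ×-dec (_ ≤? _) ×-dec (_ ≤? _) ×-dec (_ ≤? _) ×-dec (_ ≟ _) ×-dec allValid? ps steps

  abstract
    small : List ℕ
    small = primesIn 0 (2 ^ 14)

    small≡ : small ≡ primesIn 0 (2 ^ 14)
    small≡ = refl

    -- Evaluating facts? on an argument shares the list of primes between the
    -- checks.
    facts : Facts small
    facts = toWitness {a? = facts? small} _

    -- 205748 = ⌈log₂ (2¹⁴)!⌉.
    small-factorial : (2 ^ 14) ! ≤ 2 ^ 205748
    small-factorial = ≤ᵇ⇒≤ ((2 ^ 14) !) (2 ^ 205748) _

    -- Divided by 1600 · 2⁴⁴ this reads 205748/2¹⁴ + 2 - 224928632027/(16 · 2³⁰) ≤ 1.47, numerically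
    -- 12.558 + 2 - 13.093: the bits of the factorial per factor, plus Chebyshev's constant, minus
    -- the share of the small primes.
    mertens-constant : 100 * (2 ^ 30 * 16 * 205748 + 2 ^ 30 * 32 * 2 ^ 14)
                       ≤ 147 * (2 ^ 30 * 16 * 2 ^ 14) + 100 * 224928632027 * 2 ^ 14
    mertens-constant = ≤ᵇ⇒≤ (100 * (2 ^ 30 * 16 * 205748 + 2 ^ 30 * 32 * 2 ^ 14))
                       (147 * (2 ^ 30 * 16 * 2 ^ 14) + 100 * 224928632027 * 2 ^ 14) _

  small-ascending : AscendingPrimes 0 small
  small-ascending = subst (AscendingPrimes 0) (sym small≡) (primesIn-ascending 0 (2 ^ 14))

  small-weights : 224928632027 ≤ weighted weight (exponent (2 ^ 30)) small
  small-weights = proj₁ facts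

  small-depths : weighted weight depth small ≤ 32 * 2 ^ 14
  small-depths = proj₁ (proj₂ facts)

  small-ratio : product (map suc small) * 1000 ≤ 10518 * product small
  small-ratio = proj₁ (proj₂ (proj₂ facts))

  small-product : 2 ^ 16384 ≤ product small
  small-product = proj₁ (proj₂ (proj₂ (proj₂ facts)))

  small-length : length small ≡ 1900
  small-length = proj₁ (proj₂ (proj₂ (proj₂ (proj₂ facts))))

  steps-valid : AllValid small steps
  steps-valid = proj₂ (proj₂ (proj₂ (proj₂ (proj₂ facts))))

  find-step : ∀ {a c ps} k (s : Steps a c) → AllValid ps s → a ≤ k → k < c →
              ∃₂ λ a b → ∃₂ λ L K → a ≤ k × k ≤ b × Valid ps a b L K
  find-step k [] _ a≤k k<a = contradiction a≤k (<⇒≱ k<a)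
  find-step {a} k (step b L K s) (valid , rest) a≤k k<c with k ≤? b
  ... | yes k≤b = a , b , L , K , a≤k , k≤b , valid
  ... | no  k≰b = find-step k s rest (≰⇒> k≰b) k<c

-- A dyadic form of Mertens' first theorem

module Mertens where
  open import Data.List using (List; []; _∷_; _++_)
  open import Data.List.Relation.Unary.All as All using (All; []; _∷_)
  open import Data.Nat
  open import Data.Nat.Divisibility using (∣⇒≤)
  open import Data.Nat.Properties
  open import Data.Nat.Primality using (Prime; prime⇒nonZero)
  open import Data.Nat.Solver using (module +-*-Solver)
  open import Data.Product using (_,_)
  open import Relation.Binary.PropositionalEquality
  open UnitaryDivisors
  open PrimeLists
  open Chebyshev
  open SmallPrimes
  open +-*-Solver using (solve; _:=_; _:+_; _:*_; con)

  -- Iterating (2N)! ≤ 4^N (N!)² adds one bit per factor at each doubling, which is the growth of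
  -- the leading term N log₂ N; no form of Stirling's formula is involved.
  factorial-scale : ∀ k → (2 ^ (k + 14)) ! ≤ 2 ^ (2 ^ k * 205748 + 2 ^ (k + 14) * k)
  factorial-scale zero = small-factorial
  factorial-scale (suc k) = begin
    (2 * N) !
      ≡⟨ cong (λ x → (N + x) !) (+-identityʳ N) ⟩
    (N + N) !
      ≤⟨ factorial-double N ⟩
    4 ^ N * (N ! * N !)
      ≤⟨ *-monoʳ-≤ (4 ^ N) (*-mono-≤ (factorial-scale k) (factorial-scale k)) ⟩
    4 ^ N * (2 ^ a * 2 ^ a)
      ≡⟨ cong₂ _*_ (^-*-assoc 2 2 N) (sym (^-distribˡ-+-* 2 a a)) ⟩
    2 ^ (2 * N) * 2 ^ (a + a)
      ≡⟨ ^-distribˡ-+-* 2 (2 * N) (a + a) ⟨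
    2 ^ (2 * N + (a + a))
      ≡⟨ cong (2 ^_) (solve 4 (λ N x A k → con 2 :* N :+ ((x :* A :+ N :* k) :+ (x :* A :+ N :* k)) :=
           con 2 :* x :* A :+ con 2 :* N :* (con 1 :+ k)) refl N (2 ^ k) 205748 k) ⟩
    2 ^ (2 ^ suc k * 205748 + 2 * N * suc k) ∎
    where
    open ≤-Reasoning
    N = 2 ^ (k + 14)
    a = 2 ^ k * 205748 + N * k

  blocks : (ℕ → ℕ) → ℕ → ℕ
  blocks e zero    = 0
  blocks e (suc k) = blocks e k + weighted (λ _ → k + 14) e (block (k + 14))

  weighted-mono : ∀ {ps} W {e f} → All (λ p → e p ≤ f p) ps → weighted W e ps ≤ weighted W f ps
  weighted-mono W [] = z≤n
  weighted-mono {p ∷ _} W (e≤f ∷ h) = +-mono-≤ (*-monoʳ-≤ (W p) e≤f) (weighted-mono W h)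

  weighted-+ : ∀ ps W e f → weighted W (λ p → e p + f p) ps ≡ weighted W e ps + weighted W f ps
  weighted-+ [] W e f = refl
  weighted-+ (p ∷ ps) W e f = trans (cong (W p * (e p + f p) +_) (weighted-+ ps W e f))
    (solve 5 (λ w a b x y → w :* (a :+ b) :+ (x :+ y) := w :* a :+ x :+ (w :* b :+ y)) refl
      (W p) (e p) (f p) (weighted W e ps) (weighted W f ps))

  weighted-* : ∀ ps c w e → weighted (λ _ → c * w) e ps ≡ c * weighted (λ _ → w) e ps
  weighted-* [] c w e = sym (*-zeroʳ c)
  weighted-* (p ∷ ps) c w e = trans (cong (c * w * e p +_) (weighted-* ps c w e))
    (solve 4 (λ c w a x → c :* w :* a :+ c :* x := c :* (w :* a :+ x)) refl c w (e p) (weighted (λ _ → w) e ps))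

  ascending-All : ∀ {P : ℕ → Set} {a ps} → AscendingPrimes a ps → (∀ {p} → a < p → Prime p → P p) → All P ps
  ascending-All [] f = []
  ascending-All ((a<q , pq) ∷ A) f = f a<q pq ∷ ascending-All A (λ q<p → f (<-trans a<q q<p))

  block-All : ∀ {P : ℕ → Set} i → (∀ {p} → 2 ^ i < p → Prime p → P p) → All P (block i)
  block-All i = ascending-All (primesIn-ascending (2 ^ i) (2 ^ i))

  blocks-mono : ∀ {e f} → (∀ {p} → Prime p → e p ≤ f p) → ∀ k → blocks e k ≤ blocks f k
  blocks-mono h zero    = z≤n
  blocks-mono h (suc k) = +-mono-≤ (blocks-mono h k) (weighted-mono (λ _ → k + 14) (block-All (k + 14) (λ _ pp → h pp)))

  blocks-suc : ∀ e k → blocks (λ p → 1 + e p) k ≡ blocks (λ _ → 1) k + blocks e k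
  blocks-suc e zero = refl
  blocks-suc e (suc k) = trans (cong₂ _+_ (blocks-suc e k) (weighted-+ (block (k + 14)) (λ _ → k + 14) (λ _ → 1) e))
    (solve 4 (λ a b c d → a :+ b :+ (c :+ d) := a :+ c :+ (b :+ d)) refl (blocks (λ _ → 1) k) (blocks e k)
      (weighted (λ _ → k + 14) (λ _ → 1) (block (k + 14))) (weighted (λ _ → k + 14) e (block (k + 14))))

  -- Chebyshev's bounds 2^(i+1) telescope. The 2 · 2¹⁴ kept on the left later cancels the rounding
  -- loss `small-depths` at the small primes.
  blocks-count : ∀ k → blocks (λ _ → 1) k + 2 * 2 ^ 14 ≤ 2 * 2 ^ (k + 14)
  blocks-count zero = ≤-refl
  blocks-count (suc k) = begin
    blocks (λ _ → 1) k + weighted (λ _ → k + 14) (λ _ → 1) (block (k + 14)) + 2 * 2 ^ 14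
      ≤⟨ +-monoˡ-≤ (2 * 2 ^ 14) (+-monoʳ-≤ (blocks (λ _ → 1) k) (block-weight (k + 14))) ⟩
    blocks (λ _ → 1) k + 2 ^ suc (k + 14) + 2 * 2 ^ 14
      ≡⟨ solve 3 (λ a b c → a :+ b :+ c := a :+ c :+ b) refl (blocks (λ _ → 1) k) (2 ^ suc (k + 14)) (2 * 2 ^ 14) ⟩
    blocks (λ _ → 1) k + 2 * 2 ^ 14 + 2 ^ suc (k + 14)
      ≤⟨ +-monoˡ-≤ (2 ^ suc (k + 14)) (blocks-count k) ⟩
    2 ^ suc (k + 14) + 2 ^ suc (k + 14)
      ≡⟨ cong (2 ^ suc (k + 14) +_) (sym (+-identityʳ _)) ⟩
    2 * 2 ^ suc (k + 14) ∎
    where open ≤-Reasoning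

  upTo-2^ : ℕ → List ℕ
  upTo-2^ i = primesIn 0 (2 ^ i)

  upTo-2^-suc : ∀ i → upTo-2^ (suc i) ≡ upTo-2^ i ++ block i
  upTo-2^-suc i = trans (cong (λ x → primesIn 0 (2 ^ i + x)) (+-identityʳ (2 ^ i))) (primesIn-++ 0 (2 ^ i) (2 ^ i))

  2^blocks : ∀ e k → 2 ^ (weighted weight e small + 16 * blocks e k) ≤ powers e (upTo-2^ (k + 14)) ^ 16
  2^blocks e zero = subst₂ (λ x ps → 2 ^ x ≤ powers e ps ^ 16) (sym (+-identityʳ (weighted weight e small))) small≡
    (2^weighted weight e 16 (ascending-All small-ascending λ {p} 0<p _ → 2^lg≤ 300 (p ^ 16) {{m^n≢0 p 16 {{>-nonZero 0<p}}}}))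
  2^blocks e (suc k) = begin
    2 ^ (s + 16 * (b + w))
      ≡⟨ cong (2 ^_) (trans (solve 3 (λ s b w → s :+ con 16 :* (b :+ w) := s :+ con 16 :* b :+ con 16 :* w) refl s b w)
           (cong (s + 16 * b +_) (sym (weighted-* (block i) 16 i e)))) ⟩
    2 ^ (s + 16 * b + w′)
      ≡⟨ ^-distribˡ-+-* 2 (s + 16 * b) w′ ⟩
    2 ^ (s + 16 * b) * 2 ^ w′
      ≤⟨ *-mono-≤ (2^blocks e k) (2^weighted (λ _ → 16 * i) e 16 (block-All i λ {p} 2^i<p _ →
           subst (_≤ p ^ 16) (trans (^-*-assoc 2 i 16) (cong (2 ^_) (*-comm i 16))) (^-monoˡ-≤ 16 (<⇒≤ 2^i<p)))) ⟩
    powers e (upTo-2^ i) ^ 16 * powers e (block i) ^ 16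
      ≡⟨ ^-distrib-* (powers e (upTo-2^ i)) (powers e (block i)) 16 ⟨
    (powers e (upTo-2^ i) * powers e (block i)) ^ 16
      ≡⟨ cong (_^ 16) (sym (trans (cong (powers e) (upTo-2^-suc i)) (powers-++ e (upTo-2^ i) (block i)))) ⟩
    powers e (upTo-2^ (suc i)) ^ 16 ∎
    where
    open ≤-Reasoning
    i = k + 14
    s = weighted weight e small
    b = blocks e k
    w = weighted (λ _ → i) e (block i)
    w′ = weighted (λ _ → 16 * i) e (block i)

  -- Legendre's formula for (2^(k+14))!, in units of 1/16 bit.
  legendre-bound : ∀ k → let N = 2 ^ (k + 14) in
                   weighted weight (exponent N) small + 16 * blocks (N ÷_) k ≤ 16 * (2 ^ k * 205748 + N * k)
  legendre-bound k = 2^-cancel-≤ (begin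
    2 ^ (weighted weight e small + 16 * blocks (N ÷_) k)
      ≤⟨ ^-monoʳ-≤ 2 (+-monoʳ-≤ (weighted weight e small) (*-monoʳ-≤ 16 (blocks-mono (λ {p} _ → m≤m+n (N ÷ p) _) k))) ⟩
    2 ^ (weighted weight e small + 16 * blocks e k)
      ≤⟨ 2^blocks e k ⟩
    powers e (upTo-2^ (k + 14)) ^ 16
      ≤⟨ ^-monoˡ-≤ 16 (∣⇒≤ {{N !≢0}} (powers-∣ e (primesIn-ascending 0 N) λ {p} _ pp → legendre-∣ (depth p) p N {{prime⇒nonZero pp}})) ⟩
    (N !) ^ 16
      ≤⟨ ^-monoˡ-≤ 16 (factorial-scale k) ⟩
    (2 ^ a) ^ 16
      ≡⟨ trans (^-*-assoc 2 a 16) (cong (2 ^_) (*-comm a 16)) ⟩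
    2 ^ (16 * a) ∎)
    where
    open ≤-Reasoning
    N = 2 ^ (k + 14)
    e = exponent N
    a = 2 ^ k * 205748 + N * k

  weighted-scale : ∀ {ps} M N → All Prime ps →
                   N * weighted weight (exponent M) ps ≤ M * (weighted weight (exponent N) ps + weighted weight depth ps)
  weighted-scale M N [] = subst (_≤ M * 0) (sym (*-zeroʳ N)) z≤n
  weighted-scale {p ∷ ps} M N (pp ∷ h) = begin
    N * (W * a + x)
      ≡⟨ solve 4 (λ N W a x → N :* (W :* a :+ x) := W :* (N :* a) :+ N :* x) refl N W a x ⟩
    W * (N * a) + N * x
      ≤⟨ +-mono-≤ (*-monoʳ-≤ W (legendre-scale (depth p) p p M N {{prime⇒nonZero pp}} {{prime⇒nonZero pp}})) (weighted-scale M N h) ⟩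
    W * (M * (b + depth p)) + M * (y + z)
      ≡⟨ solve 6 (λ W M b d y z → W :* (M :* (b :+ d)) :+ M :* (y :+ z) := M :* (W :* b :+ y :+ (W :* d :+ z))) refl W M b (depth p) y z ⟩
    M * (W * b + y + (W * depth p + z)) ∎
    where
    open ≤-Reasoning
    W = weight p
    a = exponent M p
    b = exponent N p
    x = weighted weight (exponent M) ps
    y = weighted weight (exponent N) ps
    z = weighted weight depth ps

  -- The constants are variables here to keep the ring solver away from them.
  mertens-arithmetic : ∀ T h A κ P k D Q s Ψ {N} .{{_ : NonZero T}} → N ≡ P * h →
    s + 16 * D ≤ 16 * (P * A + N * k) → Q + 2 * h ≤ 2 * N → N * κ ≤ T * (s + Ψ) → Ψ ≤ 32 * h →
    100 * (T * 16 * A + T * 32 * h) ≤ 147 * (T * 16 * h) + 100 * κ * h →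
    100 * (Q + D) ≤ N * (100 * k + 147)
  mertens-arithmetic T h A κ P k D Q s Ψ refl h₁ h₂ h₃ h₄ h₅ =
    *-cancelˡ-≤ (16 * T) {{m*n≢0 16 T}} (+-cancelʳ-≤ (100 * (N * κ)) _ _ (begin
      16 * T * (100 * (Q + D)) + 100 * (N * κ)
        ≤⟨ +-monoʳ-≤ (16 * T * (100 * (Q + D))) (*-monoʳ-≤ 100 h₃) ⟩
      16 * T * (100 * (Q + D)) + 100 * (T * (s + Ψ))
        ≤⟨ +-monoʳ-≤ (16 * T * (100 * (Q + D))) (*-monoʳ-≤ 100 (*-monoʳ-≤ T (+-monoʳ-≤ s h₄))) ⟩
      16 * T * (100 * (Q + D)) + 100 * (T * (s + 32 * h))
        ≡⟨ solve 5 (λ T Q D s h → con 16 :* T :* (con 100 :* (Q :+ D)) :+ con 100 :* (T :* (s :+ con 32 :* h)) :=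
             con 100 :* T :* (con 16 :* (Q :+ con 2 :* h) :+ (s :+ con 16 :* D))) refl T Q D s h ⟩
      100 * T * (16 * (Q + 2 * h) + (s + 16 * D))
        ≤⟨ *-monoʳ-≤ (100 * T) (+-mono-≤ (*-monoʳ-≤ 16 h₂) h₁) ⟩
      100 * T * (16 * (2 * N) + 16 * (P * A + N * k))
        ≡⟨ solve 5 (λ T h A P k → con 100 :* T :* (con 16 :* (con 2 :* (P :* h)) :+ con 16 :* (P :* A :+ P :* h :* k)) :=
             con 100 :* (T :* con 16 :* A :+ T :* con 32 :* h) :* P :+ con 1600 :* T :* (P :* h :* k)) refl T h A P k ⟩
      100 * (T * 16 * A + T * 32 * h) * P + 1600 * T * (N * k)
        ≤⟨ +-monoˡ-≤ (1600 * T * (N * k)) (*-monoˡ-≤ P h₅) ⟩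
      (147 * (T * 16 * h) + 100 * κ * h) * P + 1600 * T * (N * k)
        ≡⟨ solve 5 (λ T h κ P k → (con 147 :* (T :* con 16 :* h) :+ con 100 :* κ :* h) :* P :+ con 1600 :* T :* (P :* h :* k) :=
             con 16 :* T :* (P :* h :* (con 100 :* k :+ con 147)) :+ con 100 :* (P :* h :* κ)) refl T h κ P k ⟩
      16 * T * (N * (100 * k + 147)) + 100 * (N * κ) ∎))
    where
    open ≤-Reasoning
    N = P * h

  -- `suc (N ÷ p)` bounds N/p from above, which a sum of reciprocals requires; the extra 1 per prime
  -- is paid for by `blocks-count`.
  mertens : ∀ k → let N = 2 ^ (k + 14) in 100 * blocks (λ p → suc (N ÷ p)) k ≤ N * (100 * k + 147)
  mertens k = subst (λ x → 100 * x ≤ N * (100 * k + 147)) (sym (blocks-suc (N ÷_) k))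
    (mertens-arithmetic (2 ^ 30) (2 ^ 14) 205748 224928632027 (2 ^ k) k (blocks (N ÷_) k) (blocks (λ _ → 1) k)
      (weighted weight (exponent N) small) (weighted weight depth small) {N}
      (^-distribˡ-+-* 2 k 14) (legendre-bound k) (blocks-count k)
      (≤-trans (*-monoʳ-≤ N small-weights)
        (weighted-scale {small} (2 ^ 30) N (ascending-All small-ascending λ _ pp → pp)))
      small-depths mertens-constant)
    where
    N = 2 ^ (k + 14)

-- Upper bounds for the exponential function

module Exponential where
  open import Algebra.Bundles using (CommutativeRing)
  open import Data.List using (List; []; _∷_; map; foldr)
  open import Data.List.Relation.Unary.All using ([]; _∷_)
  open import Data.Nat as ℕ using (ℕ; zero; suc)
  import Data.Nat.Properties as ℕ
  open import Data.Product using (_,_)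
  open import Data.Rational
  open import Data.Rational.Properties
  open import Data.Rational.Solver using (module +-*-Solver)
  open import Data.Sum using ([_,_]′)
  open import Relation.Nullary using (¬_; contradiction)
  open import Relation.Binary.PropositionalEquality
  open +-*-Solver using (solve; _:=_; _:+_; _:*_; _:-_; :-_; con)
  open import Algebra.Definitions.RawSemiring +-*-rawSemiring using (_^_)
  open import Algebra.Properties.CommutativeSemiring.Exp
    (CommutativeRing.commutativeSemiring +-*-commutativeRing) using (^-distrib-*)
  open import Defs
  open Arithmetic
  open Cut
  open Exp

  ℕ→ℚ-+ : ∀ m n → ℕ→ℚ (m ℕ.+ n) ≡ ℕ→ℚ m + ℕ→ℚ n
  ℕ→ℚ-+ zero    n = sym (+-identityˡ (ℕ→ℚ n))
  ℕ→ℚ-+ (suc m) n = trans (ℕ→ℚ-suc (m ℕ.+ n)) (trans (cong (1ℚ +_) (ℕ→ℚ-+ m n))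
    (trans (sym (+-assoc 1ℚ (ℕ→ℚ m) (ℕ→ℚ n))) (cong (_+ ℕ→ℚ n) (sym (ℕ→ℚ-suc m)))))

  ℕ→ℚ-* : ∀ m n → ℕ→ℚ (m ℕ.* n) ≡ ℕ→ℚ m * ℕ→ℚ n
  ℕ→ℚ-* zero    n = sym (*-zeroˡ (ℕ→ℚ n))
  ℕ→ℚ-* (suc m) n = trans (ℕ→ℚ-+ n (m ℕ.* n)) (trans (cong (ℕ→ℚ n +_) (ℕ→ℚ-* m n))
    (trans (solve 2 (λ m n → n :+ m :* n := (con 1ℚ :+ m) :* n) refl (ℕ→ℚ m) (ℕ→ℚ n))
      (cong (_* ℕ→ℚ n) (sym (ℕ→ℚ-suc m)))))

  ℕ→ℚ-mono-≤ : ∀ {m n} → m ℕ.≤ n → ℕ→ℚ m ≤ ℕ→ℚ n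
  ℕ→ℚ-mono-≤ {m} m≤n with ℕ.m≤n⇒∃[o]m+o≡n m≤n
  ... | o , refl = ≤-from (ℕ→ℚ o) (0≤ℕ→ℚ o) (ℕ→ℚ-+ m o)

  *-mono-≤ : ∀ {a b c d} → 0ℚ ≤ a → 0ℚ ≤ c → a ≤ b → c ≤ d → a * c ≤ b * d
  *-mono-≤ {a} {b} {c} 0≤a 0≤c a≤b c≤d =
    ≤-trans (*-monoˡ-≤ c 0≤c a≤b) (*-monoʳ-≤ b (≤-trans 0≤a a≤b) c≤d)

  *-cancelʳ-≤ : ∀ {x y} c → 0ℚ < c → x * c ≤ y * c → x ≤ y
  *-cancelʳ-≤ c 0<c = *-cancelʳ-≤-pos c {{positive 0<c}}

  <⇒≱ : ∀ {x y} → x < y → ¬ y ≤ x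
  <⇒≱ x<y y≤x = <-irrefl refl (<-≤-trans x<y y≤x)

  0<ℕ→ℚ : ∀ n .{{_ : ℕ.NonZero n}} → 0ℚ < ℕ→ℚ n
  0<ℕ→ℚ n = ℕ→ℚ-mono-< {0} {n} (ℕ.>-nonZero⁻¹ n)

  ℕ→ℚ-cancel-≤ : ∀ {m n} → ℕ→ℚ m ≤ ℕ→ℚ n → m ℕ.≤ n
  ℕ→ℚ-cancel-≤ {m} {n} m≤n = ℕ.≮⇒≥ λ n<m → <⇒≱ (ℕ→ℚ-mono-< n<m) m≤n

  abstract
    -- Taking `pred` gives `inv 0` the value 1, so that positivity holds for every argument.
    inv : ℕ → ℚ
    inv q = u (ℕ.pred q)

    0<inv : ∀ q → 0ℚ < inv q
    0<inv q = 0<u (ℕ.pred q)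

    inv-inverse : ∀ q .{{_ : ℕ.NonZero q}} → ℕ→ℚ q * inv q ≡ 1ℚ
    inv-inverse (suc q) = u-inv q

  sumℚ productℚ : List ℚ → ℚ
  sumℚ = foldr _+_ 0ℚ
  productℚ = foldr _*_ 1ℚ

  infix 4 _⊑_

  -- X ⊑ s expresses e^X ≤ s for X ≥ 0.
  _⊑_ : ℚ → ℚ → Set
  X ⊑ s = ∀ m → approx X m ≤ s

  base-nonNeg : ∀ {X} m → 0ℚ ≤ X → 0ℚ < base X m
  base-nonNeg {X} m 0≤X = <-≤-trans (0<u 0) (≤-from (X * u m) (*-nonNeg 0≤X (<⇒≤ (0<u m))) refl)

  approx-mono : ∀ {X Y} m → 0ℚ ≤ X → X ≤ Y → approx X m ≤ approx Y m
  approx-mono {X} {Y} m 0≤X X≤Y = ^-mono (suc m) (base-nonNeg m 0≤X)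
    (+-monoʳ-≤ 1ℚ (*-monoˡ-≤ (u m) (<⇒≤ (0<u m)) X≤Y))

  ⊑-mono : ∀ {X Y s} → 0ℚ ≤ X → X ≤ Y → Y ⊑ s → X ⊑ s
  ⊑-mono 0≤X X≤Y Y⊑s m = ≤-trans (approx-mono m 0≤X X≤Y) (Y⊑s m)

  -- (1 + X/M)(1 + Y/M) exceeds 1 + (X + Y)/M by XY/M², so the exponents add at each M, before any
  -- limit.
  ⊑-+ : ∀ {X Y s t} → 0ℚ ≤ X → 0ℚ ≤ Y → X ⊑ s → Y ⊑ t → X + Y ⊑ s * t
  ⊑-+ {X} {Y} 0≤X 0≤Y X⊑s Y⊑t m = ≤-trans
    (^-mono (suc m) (base-nonNeg m (subst (_≤ X + Y) (+-identityˡ 0ℚ) (+-mono-≤ 0≤X 0≤Y)))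
      (≤-from ((X * u m) * (Y * u m))
        (*-nonNeg (*-nonNeg 0≤X (<⇒≤ (0<u m))) (*-nonNeg 0≤Y (<⇒≤ (0<u m))))
        (solve 3 (λ X Y u → (con 1ℚ :+ X :* u) :* (con 1ℚ :+ Y :* u) :=
          (con 1ℚ :+ (X :+ Y) :* u) :+ (X :* u) :* (Y :* u)) refl X Y (u m))))
    (subst (_≤ _) (sym (^-distrib-* (base X m) (base Y m) (suc m)))
      (*-mono-≤ (<⇒≤ (approx-pos X m (base-nonNeg m 0≤X))) (<⇒≤ (approx-pos Y m (base-nonNeg m 0≤Y)))
        (X⊑s m) (Y⊑t m)))

  0⊑1 : 0ℚ ⊑ 1ℚ
  0⊑1 m = ≤-reflexive (trans (cong (_^ suc m) (trans (cong (1ℚ +_) (*-zeroˡ (u m))) (+-identityʳ 1ℚ))) (1^n≡1 (suc m)))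

  ⊑-* : ∀ {X s} k → 0ℚ ≤ X → X ⊑ s → ℕ→ℚ k * X ⊑ s ^ k
  ⊑-* {X} zero    0≤X X⊑s = subst (_⊑ 1ℚ) (sym (*-zeroˡ X)) 0⊑1
  ⊑-* {X} {s} (suc k) 0≤X X⊑s = subst (_⊑ s ^ suc k)
    (trans (solve 2 (λ X k → X :+ k :* X := (con 1ℚ :+ k) :* X) refl X (ℕ→ℚ k)) (cong (_* X) (sym (ℕ→ℚ-suc k))))
    (⊑-+ 0≤X (*-nonNeg (0≤ℕ→ℚ k) 0≤X) X⊑s (⊑-* k 0≤X X⊑s))

  abstract
    -- Locatedness puts e^X above s or below t, and the former would give an M with (1 + X/M)^M > s.
    ⊑⇒UExp : ∀ X {s t} → X ⊑ s → s < t → UExp X t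
    ⊑⇒UExp X X⊑s s<t =
      [ (λ (m , _ , s<A) → contradiction (X⊑s m) (<⇒≱ s<A)) , (λ e → e) ]′ (exp-located X s<t)

  -- This is e^X ≤ 1/(1 - X): for each M, (1 + X/M)^M (1 - X/M)^M ≤ 1, while (1 - X/M)^M ≥ 1 - X by
  -- Bernoulli's inequality.
  ⊑-reciprocal : ∀ {X s} → 0ℚ ≤ X → X < 1ℚ → 1ℚ ≤ s * (1ℚ - X) → X ⊑ s
  ⊑-reciprocal {X} {s} 0≤X X<1 1≤s m = *-cancelʳ-≤ (1ℚ - X) (<-diff X<1) (≤-trans
    (*-monoʳ-≤ (approx X m) (<⇒≤ (approx-pos X m (base-nonNeg m 0≤X)))
      (subst (_≤ approx (- X) m) eq (bernoulli (suc m) (<⇒≤ 0<b))))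
    (≤-trans (approx-≤1 X m (base-nonNeg m 0≤X) 0<b) 1≤s))
    where
    0<b : 0ℚ < base (- X) m
    0<b = base-small (- X) m (≤-reflexive (solve 1 (λ X → :- (:- X) := X) refl X))
      (≤-<-trans (subst (X * u m ≤_) (*-identityʳ X) (*-monoʳ-≤ X 0≤X u≤1)) X<1)
      where
      u≤1 : u m ≤ 1ℚ
      u≤1 = subst (_≤ 1ℚ) (*-identityˡ (u m)) (subst (1ℚ * u m ≤_) (u-inv m)
        (*-monoˡ-≤ (u m) (<⇒≤ (0<u m)) (ℕ→ℚ-mono-≤ {1} {suc m} (ℕ.s≤s ℕ.z≤n))))
    eq : 1ℚ + ℕ→ℚ (suc m) * (base (- X) m - 1ℚ) ≡ 1ℚ - X
    eq = trans (solve 3 (λ X u M → con 1ℚ :+ M :* ((con 1ℚ :+ (:- X) :* u) :- con 1ℚ) :=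
        con 1ℚ :- X :* (M :* u)) refl X (u m) (ℕ→ℚ (suc m)))
      (trans (cong (λ v → 1ℚ - X * v) (u-inv m)) (cong (λ v → 1ℚ - v) (*-identityʳ X)))

  -- (1 + 2δ)^k ≤ (1 + kδ) / (1 - kδ), by the addition law of tanh.
  tanh-bound : ∀ {δ} k → 0ℚ ≤ δ → 0ℚ < 1ℚ - ℕ→ℚ k * δ →
               (1ℚ + (δ + δ)) ^ k * (1ℚ - ℕ→ℚ k * δ) ≤ 1ℚ + ℕ→ℚ k * δ
  tanh-bound {δ} zero 0≤δ _ = ≤-reflexive
    (solve 1 (λ δ → con 1ℚ :* (con 1ℚ :- con 0ℚ :* δ) := con 1ℚ :+ con 0ℚ :* δ) refl δ)
  tanh-bound {δ} (suc k) 0≤δ 0<1-b = subst (λ b → y * v * (1ℚ - b) ≤ 1ℚ + b) (sym a+δ)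
    (*-cancelʳ-≤ (1ℚ - a) 0<1-a (begin
      y * v * (1ℚ - (a + δ)) * (1ℚ - a)
        ≡⟨ solve 4 (λ y v a δ → y :* v :* (con 1ℚ :- (a :+ δ)) :* (con 1ℚ :- a) :=
             (y :* (con 1ℚ :- (a :+ δ))) :* (v :* (con 1ℚ :- a))) refl y v a δ ⟩
      y * (1ℚ - (a + δ)) * (v * (1ℚ - a))
        ≤⟨ *-monoʳ-≤ (y * (1ℚ - (a + δ))) (*-nonNeg 0≤y (<⇒≤ 0<1-a-δ)) (tanh-bound k 0≤δ 0<1-a) ⟩
      y * (1ℚ - (a + δ)) * (1ℚ + a)
        ≤⟨ ≤-from ((δ + δ) * (a * a + δ + a * δ))
             (*-nonNeg 0≤2δ (0≤+ (0≤+ (0≤x² a) 0≤δ) (*-nonNeg 0≤a 0≤δ)))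
             (solve 2 (λ a δ → (con 1ℚ :+ (a :+ δ)) :* (con 1ℚ :- a) :=
               (con 1ℚ :+ (δ :+ δ)) :* (con 1ℚ :- (a :+ δ)) :* (con 1ℚ :+ a)
               :+ (δ :+ δ) :* (a :* a :+ δ :+ a :* δ)) refl a δ) ⟩
      (1ℚ + (a + δ)) * (1ℚ - a) ∎))
    where
    open ≤-Reasoning
    0≤+ : ∀ {x y} → 0ℚ ≤ x → 0ℚ ≤ y → 0ℚ ≤ x + y
    0≤+ {x} {y} 0≤x 0≤y = subst (_≤ x + y) (+-identityˡ 0ℚ) (+-mono-≤ 0≤x 0≤y)
    a = ℕ→ℚ k * δ
    y = 1ℚ + (δ + δ)
    v = y ^ k
    0≤a : 0ℚ ≤ a
    0≤a = *-nonNeg (0≤ℕ→ℚ k) 0≤δ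
    0≤2δ : 0ℚ ≤ δ + δ
    0≤2δ = 0≤+ 0≤δ 0≤δ
    0≤y : 0ℚ ≤ y
    0≤y = 0≤+ (<⇒≤ (0<u 0)) 0≤2δ
    a+δ : ℕ→ℚ (suc k) * δ ≡ a + δ
    a+δ = trans (cong (_* δ) (ℕ→ℚ-suc k)) (solve 2 (λ k δ → (con 1ℚ :+ k) :* δ := k :* δ :+ δ) refl (ℕ→ℚ k) δ)
    0<1-a-δ : 0ℚ < 1ℚ - (a + δ)
    0<1-a-δ = subst (λ b → 0ℚ < 1ℚ - b) a+δ 0<1-b
    0<1-a : 0ℚ < 1ℚ - a
    0<1-a = <-≤-trans 0<1-a-δ (≤-from δ 0≤δ
      (solve 2 (λ a δ → con 1ℚ :- a := (con 1ℚ :- (a :+ δ)) :+ δ) refl a δ))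

  -- `tanh-bound` with δ = x/M and k = M gives e^(2x) ≤ (1 + x)/(1 - x). Its error is of third order
  -- in x, against second order for `⊑-reciprocal`, which matters when many terms are added.
  ⊑-tanh : ∀ {x s} → 0ℚ ≤ x → x < 1ℚ → 1ℚ + x ≤ s * (1ℚ - x) → x + x ⊑ s
  ⊑-tanh {x} {s} 0≤x x<1 h m = *-cancelʳ-≤ (1ℚ - x) (<-diff x<1)
    (≤-trans (subst₂ (λ b c → b ^ suc m * (1ℚ - c) ≤ 1ℚ + c)
      (cong (1ℚ +_) (sym (*-distribʳ-+ (u m) x x))) Mδ≡x
      (tanh-bound (suc m) (*-nonNeg 0≤x (<⇒≤ (0<u m))) (subst (λ b → 0ℚ < 1ℚ - b) (sym Mδ≡x) (<-diff x<1)))) h)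
    where
    Mδ≡x : ℕ→ℚ (suc m) * (x * u m) ≡ x
    Mδ≡x = trans (solve 3 (λ M x u → M :* (x :* u) := x :* (M :* u)) refl (ℕ→ℚ (suc m)) x (u m))
      (trans (cong (x *_) (u-inv m)) (*-identityʳ x))

  -- A fixed-M form of ∏ (1 + x) ≤ e^(Σ x), shaped to contradict a membership in `UExp`. It holds
  -- factor by factor because 1 - (x + X)/M ≤ (1 - x/M)(1 - X/M).
  1+sum≤exp : ∀ qs m → 0ℚ < base (- sumℚ (map inv qs)) m →
              productℚ (map (λ q → 1ℚ + inv q) qs) * approx (- sumℚ (map inv qs)) m ≤ 1ℚ
  1+sum≤exp [] m 0<b = ≤-reflexive (trans (*-identityˡ (approx (- 0ℚ) m))
    (trans (cong (_^ suc m) (trans (cong (1ℚ +_) (*-zeroˡ (u m))) (+-identityʳ 1ℚ))) (1^n≡1 (suc m))))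
  1+sum≤exp (q ∷ qs) m 0<b = begin
    (1ℚ + x) * P * approx (- (x + X)) m
      ≤⟨ *-monoʳ-≤ ((1ℚ + x) * P) (*-nonNeg 0≤1+x 0≤P) split ⟩
    (1ℚ + x) * P * (approx (- x) m * approx (- X) m)
      ≡⟨ solve 4 (λ a b c d → a :* b :* (c :* d) := (a :* c) :* (b :* d)) refl (1ℚ + x) P (approx (- x) m) (approx (- X) m) ⟩
    ((1ℚ + x) * approx (- x) m) * (P * approx (- X) m)
      ≤⟨ *-mono-≤ (*-nonNeg 0≤1+x (<⇒≤ (approx-pos (- x) m 0<bx))) (*-nonNeg 0≤P (<⇒≤ (approx-pos (- X) m 0<bX)))
           (≤-trans (*-monoˡ-≤ (approx (- x) m) (<⇒≤ (approx-pos (- x) m 0<bx)) 1+x≤) (approx-≤1 x m (base-nonNeg m 0≤x) 0<bx))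
           (1+sum≤exp qs m 0<bX) ⟩
    1ℚ * 1ℚ ≡⟨⟩
    1ℚ ∎
    where
    open ≤-Reasoning
    x = inv q
    X = sumℚ (map inv qs)
    P = productℚ (map (λ q → 1ℚ + inv q) qs)
    0≤+ : ∀ {x y} → 0ℚ ≤ x → 0ℚ ≤ y → 0ℚ ≤ x + y
    0≤+ {x} {y} 0≤x 0≤y = subst (_≤ x + y) (+-identityˡ 0ℚ) (+-mono-≤ 0≤x 0≤y)
    0≤x : 0ℚ ≤ x
    0≤x = <⇒≤ (0<inv q)
    0≤1+x : 0ℚ ≤ 1ℚ + x
    0≤1+x = 0≤+ (<⇒≤ (0<u 0)) 0≤x
    0≤sum : ∀ rs → 0ℚ ≤ sumℚ (map inv rs)
    0≤sum []       = ≤-refl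
    0≤sum (r ∷ rs) = 0≤+ (<⇒≤ (0<inv r)) (0≤sum rs)
    0≤product : ∀ rs → 0ℚ ≤ productℚ (map (λ q → 1ℚ + inv q) rs)
    0≤product []       = <⇒≤ (0<u 0)
    0≤product (r ∷ rs) = *-nonNeg (0≤+ (<⇒≤ (0<u 0)) (<⇒≤ (0<inv r))) (0≤product rs)
    0≤P : 0ℚ ≤ P
    0≤P = 0≤product qs
    0≤X : 0ℚ ≤ X
    0≤X = 0≤sum qs
    larger : ∀ z {y} → 0ℚ ≤ y → - (z + y) ≤ - z
    larger z {y} 0≤y = ≤-from y 0≤y (solve 2 (λ z y → :- z := :- (z :+ y) :+ y) refl z y)
    0<bx : 0ℚ < base (- x) m
    0<bx = <-≤-trans 0<b (+-monoʳ-≤ 1ℚ (*-monoˡ-≤ (u m) (<⇒≤ (0<u m)) (larger x 0≤X)))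
    0<bX : 0ℚ < base (- X) m
    0<bX = <-≤-trans 0<b (+-monoʳ-≤ 1ℚ (*-monoˡ-≤ (u m) (<⇒≤ (0<u m))
      (subst (λ z → - z ≤ - X) (+-comm X x) (larger X 0≤x))))
    split : approx (- (x + X)) m ≤ approx (- x) m * approx (- X) m
    split = ≤-trans (^-mono (suc m) 0<b (≤-from ((x * u m) * (X * u m))
        (*-nonNeg (*-nonNeg 0≤x (<⇒≤ (0<u m))) (*-nonNeg 0≤X (<⇒≤ (0<u m))))
        (solve 3 (λ X Y u → (con 1ℚ :+ (:- X) :* u) :* (con 1ℚ :+ (:- Y) :* u) :=
          (con 1ℚ :+ (:- (X :+ Y)) :* u) :+ (X :* u) :* (Y :* u)) refl x X (u m))))
      (≤-reflexive (^-distrib-* (base (- x) m) (base (- X) m) (suc m)))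
    1+x≤ : 1ℚ + x ≤ approx x m
    1+x≤ = subst (_≤ approx x m)
      (trans (solve 3 (λ X u M → con 1ℚ :+ M :* ((con 1ℚ :+ X :* u) :- con 1ℚ) :=
          con 1ℚ :+ X :* (M :* u)) refl x (u m) (ℕ→ℚ (suc m)))
        (trans (cong (λ v → 1ℚ + x * v) (u-inv m)) (cong (1ℚ +_) (*-identityʳ x))))
      (bernoulli (suc m) (<⇒≤ (base-nonNeg m 0≤x)))

  ⊑-product : ∀ {s} qs → sumℚ (map inv qs) ⊑ s → productℚ (map (λ q → 1ℚ + inv q) qs) ≤ s
  ⊑-product {s} qs X⊑s = ≮⇒≥ λ s<P →
    let m , 0<b , 1<PB = ⊑⇒UExp (sumℚ (map inv qs)) X⊑s s<P in <⇒≱ 1<PB (1+sum≤exp qs m 0<b)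

  -- The chain e^a < s, e^s < t < n puts the rational `a` below log log n, by the definition of both
  -- logarithms as cuts.
  σ*-criterion : ∀ n (1<n : 1 ℕ.< n) {c} a s {t} → 0ℚ ≤ c → UExp a s → UExp s t → t < ℕ→ℚ n →
                 ℕ→ℚ (σ* n) ≤ c * ℕ→ℚ n * a →
                 fromℕ (σ* n) ≤ᴿ (c * ℕ→ℚ n) ⋆ loglog n 1<n
  σ*-criterion n 1<n {c} a s {t} 0≤c Uas Ust t<n σ≤ca q q<σ =
    -- The lower cut of a scaled real asks for bounds on both sides; any upper bound `b` of log log
    -- n exceeds `a`.
    let b , Ub = ℝ.U-inhabited (loglog n 1<n)
        La     = s , Uas , t , Ust , t<n
        q<ca   = <-≤-trans q<σ σ≤ca
    in a , b , La , Ub , q<ca , <-≤-trans q<ca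
         (*-monoʳ-≤ (c * ℕ→ℚ n) (*-nonNeg 0≤c (0≤ℕ→ℚ n))
           (<⇒≤ (L<U (loglog n 1<n) La Ub)))

  -- An opaque copy of ℕ→ℚ, which keeps large numerals from being unfolded.
  abstract
    ι : ℕ → ℚ
    ι = ℕ→ℚ

    ι-0 : ι 0 ≡ 0ℚ
    ι-0 = refl

    ι-1 : ι 1 ≡ 1ℚ
    ι-1 = refl

    ι-suc : ∀ n → ι (suc n) ≡ 1ℚ + ι n
    ι-suc = ℕ→ℚ-suc

    ι-+ : ∀ m n → ι (m ℕ.+ n) ≡ ι m + ι n
    ι-+ = ℕ→ℚ-+

    ι-* : ∀ m n → ι (m ℕ.* n) ≡ ι m * ι n
    ι-* = ℕ→ℚ-*

    0≤ι : ∀ n → 0ℚ ≤ ι n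
    0≤ι = 0≤ℕ→ℚ

    0<ι : ∀ n .{{_ : ℕ.NonZero n}} → 0ℚ < ι n
    0<ι n = 0<ℕ→ℚ n

    ι-mono-≤ : ∀ {m n} → m ℕ.≤ n → ι m ≤ ι n
    ι-mono-≤ = ℕ→ℚ-mono-≤

    ι-mono-< : ∀ {m n} → m ℕ.< n → ι m < ι n
    ι-mono-< = ℕ→ℚ-mono-<

    ι-cancel-≤ : ∀ {m n} → ι m ≤ ι n → m ℕ.≤ n
    ι-cancel-≤ = ℕ→ℚ-cancel-≤

    ι-inverse : ∀ q .{{_ : ℕ.NonZero q}} → ι q * inv q ≡ 1ℚ
    ι-inverse q = inv-inverse q

-- A test of the theorem in natural numbers

module Criterion where
  open import Data.Integer using () renaming (+_ to int)
  open import Data.Nat as ℕ using (ℕ; zero; suc)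
  open import Data.Product using (_,_)
  open import Data.Rational
  open import Data.Rational.Properties
  open import Data.Rational.Solver using (module +-*-Solver)
  open import Relation.Binary.PropositionalEquality
  open +-*-Solver using (solve; _:=_; _:+_; _:*_; _:-_; :-_; con)
  open import Algebra.Definitions.RawSemiring +-*-rawSemiring using (_^_)
  open import Defs
  open Arithmetic
  open Exponential

  rate : ℚ
  rate = int 13007 / 10000

  rate≡ : rate * ℕ→ℚ 10000 ≡ ℕ→ℚ 13007
  rate≡ = refl

  0≤rate : 0ℚ ≤ rate
  0≤rate = nonNegative⁻¹ rate {{normalize-nonNeg 13007 10000}}

  root : ℕ → ℚ
  root r = ℕ→ℚ (suc r) * inv r

  -- 1 + 1/r = 1/(1 - 1/(r + 1)), so `⊑-reciprocal` applies with equality in its last hypothesis.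
  inv⊑root : ∀ r .{{_ : ℕ.NonZero r}} → inv (suc r) ⊑ root r
  inv⊑root r = ⊑-reciprocal (<⇒≤ (0<inv (suc r))) ε<1 (≤-reflexive (sym (begin
    ℕ→ℚ (suc r) * inv r * (1ℚ - inv (suc r))
      ≡⟨ solve 3 (λ a i e → a :* i :* (con 1ℚ :- e) := a :* i :- (a :* e) :* i) refl (ℕ→ℚ (suc r)) (inv r) (inv (suc r)) ⟩
    ℕ→ℚ (suc r) * inv r - (ℕ→ℚ (suc r) * inv (suc r)) * inv r
      ≡⟨ cong₂ (λ a b → a * inv r - b * inv r) (ℕ→ℚ-suc r) (inv-inverse (suc r)) ⟩
    (1ℚ + ℕ→ℚ r) * inv r - 1ℚ * inv r
      ≡⟨ solve 2 (λ a i → (con 1ℚ :+ a) :* i :- con 1ℚ :* i := a :* i) refl (ℕ→ℚ r) (inv r) ⟩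
    ℕ→ℚ r * inv r
      ≡⟨ inv-inverse r ⟩
    1ℚ ∎)))
    where
    open ≡-Reasoning
    ε<1 : inv (suc r) < 1ℚ
    ε<1 = *-cancelˡ-< (ℕ→ℚ (suc r)) (0≤ℕ→ℚ (suc r))
      (subst₂ _<_ (sym (inv-inverse (suc r))) (sym (*-identityʳ (ℕ→ℚ (suc r))))
        (ℕ→ℚ-mono-< {1} {suc r} (ℕ.s≤s (ℕ.>-nonZero⁻¹ r))))

  root-^ : ∀ r .{{_ : ℕ.NonZero r}} K → root r ^ K * ℕ→ℚ (r ℕ.^ K) ≡ ℕ→ℚ (suc r ℕ.^ K)
  root-^ r zero    = refl
  root-^ r (suc K) = begin
    root r * root r ^ K * ℕ→ℚ (r ℕ.* r ℕ.^ K)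
      ≡⟨ cong (root r * root r ^ K *_) (ℕ→ℚ-* r (r ℕ.^ K)) ⟩
    ℕ→ℚ (suc r) * inv r * root r ^ K * (ℕ→ℚ r * ℕ→ℚ (r ℕ.^ K))
      ≡⟨ solve 5 (λ a i w r k → a :* i :* w :* (r :* k) := (r :* i) :* (a :* (w :* k))) refl
           (ℕ→ℚ (suc r)) (inv r) (root r ^ K) (ℕ→ℚ r) (ℕ→ℚ (r ℕ.^ K)) ⟩
    (ℕ→ℚ r * inv r) * (ℕ→ℚ (suc r) * (root r ^ K * ℕ→ℚ (r ℕ.^ K)))
      ≡⟨ cong₂ (λ a b → a * (ℕ→ℚ (suc r) * b)) (inv-inverse r) (root-^ r K) ⟩
    1ℚ * (ℕ→ℚ (suc r) * ℕ→ℚ (suc r ℕ.^ K))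
      ≡⟨ trans (*-identityˡ _) (sym (ℕ→ℚ-* (suc r) (suc r ℕ.^ K))) ⟩
    ℕ→ℚ (suc r ℕ.* suc r ℕ.^ K) ∎
    where open ≡-Reasoning

  -- With r large, K / (r + 1) ≤ log log n is certified by
  -- (1 + 1/r)^K < K′ / (r + 1) and (1 + 1/r)^K′ < n, since 1/(r + 1) ⊑ 1 + 1/r.
  criterion : ∀ n (1<n : 1 ℕ.< n) r .{{_ : ℕ.NonZero r}} K K′ →
              σ* n ℕ.* 10000 ℕ.* suc r ℕ.≤ 13007 ℕ.* K ℕ.* n →
              suc r ℕ.^ K ℕ.* suc r ℕ.< K′ ℕ.* r ℕ.^ K →
              suc r ℕ.^ K′ ℕ.< n ℕ.* r ℕ.^ K′ →
              fromℕ (σ* n) ≤ᴿ (rate * ℕ→ℚ n) ⋆ loglog n 1<n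
  criterion n 1<n r K K′ σ≤ w^K<s w^K′<n = finish (<-dense w^K′<n′)
    where
    ε = inv (suc r)
    0≤ε : 0ℚ ≤ ε
    0≤ε = <⇒≤ (0<inv (suc r))
    scale : ∀ k → ℕ→ℚ k * ε * ℕ→ℚ (suc r) ≡ ℕ→ℚ k
    scale k = trans (solve 3 (λ k e r → k :* e :* r := k :* (r :* e)) refl (ℕ→ℚ k) ε (ℕ→ℚ (suc r)))
      (trans (cong (ℕ→ℚ k *_) (inv-inverse (suc r))) (*-identityʳ (ℕ→ℚ k)))
    w^K<s′ : root r ^ K < ℕ→ℚ K′ * ε
    w^K<s′ = *-cancelʳ-< (ℕ→ℚ (suc r)) (0≤ℕ→ℚ (suc r)) (*-cancelʳ-< (ℕ→ℚ (r ℕ.^ K)) (0≤ℕ→ℚ (r ℕ.^ K))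
      (subst₂ _<_
        (trans (ℕ→ℚ-* (suc r ℕ.^ K) (suc r)) (trans (cong (_* ℕ→ℚ (suc r)) (sym (root-^ r K)))
          (solve 3 (λ w k r → w :* k :* r := w :* r :* k) refl (root r ^ K) (ℕ→ℚ (r ℕ.^ K)) (ℕ→ℚ (suc r)))))
        (trans (ℕ→ℚ-* K′ (r ℕ.^ K)) (cong (_* ℕ→ℚ (r ℕ.^ K)) (sym (scale K′))))
        (ℕ→ℚ-mono-< w^K<s)))
    w^K′<n′ : root r ^ K′ < ℕ→ℚ n
    w^K′<n′ = *-cancelʳ-< (ℕ→ℚ (r ℕ.^ K′)) (0≤ℕ→ℚ (r ℕ.^ K′))
      (subst₂ _<_ (sym (root-^ r K′)) (ℕ→ℚ-* n (r ℕ.^ K′)) (ℕ→ℚ-mono-< w^K′<n))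
    σ≤′ : ℕ→ℚ (σ* n) ≤ rate * ℕ→ℚ n * (ℕ→ℚ K * ε)
    σ≤′ = *-cancelʳ-≤ (ℕ→ℚ 10000) (0<ℕ→ℚ 10000) (*-cancelʳ-≤ (ℕ→ℚ (suc r)) (0<ℕ→ℚ (suc r))
      (subst₂ _≤_
        (trans (ℕ→ℚ-* (σ* n ℕ.* 10000) (suc r)) (cong (_* ℕ→ℚ (suc r)) (ℕ→ℚ-* (σ* n) 10000)))
        (trans (ℕ→ℚ-* (13007 ℕ.* K) n) (trans (cong (_* ℕ→ℚ n) (ℕ→ℚ-* 13007 K))
          (trans (cong₂ (λ a b → a * b * ℕ→ℚ n) (sym rate≡) (sym (scale K)))
            (solve 5 (λ c t k n r → (c :* t) :* (k :* r) :* n := c :* n :* k :* t :* r) refl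
              rate (ℕ→ℚ 10000) (ℕ→ℚ K * ε) (ℕ→ℚ n) (ℕ→ℚ (suc r))))))
        (ℕ→ℚ-mono-≤ σ≤)))
    finish : _ → fromℕ (σ* n) ≤ᴿ (rate * ℕ→ℚ n) ⋆ loglog n 1<n
    finish (t , w^K′<t , t<n) = σ*-criterion n 1<n (ℕ→ℚ K * ε) (ℕ→ℚ K′ * ε) 0≤rate
      (⊑⇒UExp (ℕ→ℚ K * ε) (⊑-* K 0≤ε (inv⊑root r)) w^K<s′)
      (⊑⇒UExp (ℕ→ℚ K′ * ε) (⊑-* K′ 0≤ε (inv⊑root r)) w^K′<t) t<n σ≤′

-- Abel summation and Mertens' bound for reciprocals

module LargePrimes where
  open import Data.List using (List; []; _∷_; _++_; map)
  open import Data.List.Relation.Binary.Sublist.Propositional using (_⊆_; []; _∷_; _∷ʳ_)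
  open import Data.Nat as ℕ using (ℕ; zero; suc)
  import Data.Nat.Properties as ℕ
  open import Data.Product using (_,_)
  open import Data.Rational hiding (_÷_)
  open import Data.Rational.Properties
  open import Data.Rational.Solver using (module +-*-Solver)
  open import Relation.Binary.PropositionalEquality
  open +-*-Solver using (solve; _:=_; _:+_; _:*_; _:-_; :-_; con)
  open import Defs
  open Arithmetic
  open UnitaryDivisors using (AscendingPrimes; []; _∷_)
  open PrimeLists
  open Chebyshev
  open Mertens
  open Exponential

  infix 10 Σ<

  Σ< : ℕ → (ℕ → ℚ) → ℚ
  Σ< zero    f = 0ℚ
  Σ< (suc k) f = Σ< k f + f k

  -- The term with `h k` records how far the partial sum T of `b` has departed from k + 1. Lowering
  -- `h k` to `h (suc k)` then costs (h k - h (k + 1)) (k + 1 + C - T), which is nonnegative by the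
  -- bound on partial sums.
  abel : ∀ (b h : ℕ → ℚ) C k → (∀ j → Σ< j b ≤ ι j + C) → (∀ j → h (suc j) ≤ h j) →
         Σ< (suc k) (λ i → h i * b i) ≤ h k * (Σ< (suc k) b - ι (suc k)) + C * (h 0 - h k) + Σ< (suc k) h
  abel b h C zero bounds antitone = ≤-reflexive (trans
    (solve 3 (λ b h C → con 0ℚ :+ h :* b :=
      h :* (con 0ℚ :+ b :- con 1ℚ) :+ C :* (h :- h) :+ (con 0ℚ :+ h)) refl (b 0) (h 0) C)
    (cong (λ x → h 0 * (0ℚ + b 0 - x) + C * (h 0 - h 0) + (0ℚ + h 0)) (sym ι-1)))
  abel b h C (suc k) bounds antitone = begin
    Σ< (suc k) (λ i → h i * b i) + h (suc k) * b (suc k)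
      ≤⟨ +-monoˡ-≤ (h (suc k) * b (suc k)) (abel b h C k bounds antitone) ⟩
    h k * (T - ι (suc k)) + C * (h 0 - h k) + Hk + h (suc k) * b (suc k)
      ≤⟨ ≤-from ((h k - h (suc k)) * (ι (suc k) + C - T)) (*-nonNeg (≤-diff (antitone k)) (≤-diff (bounds (suc k))))
           (solve 8 (λ hk hk′ h0 T n C b H →
             hk′ :* (T :+ b :- (con 1ℚ :+ n)) :+ C :* (h0 :- hk′) :+ (H :+ hk′) :=
             hk :* (T :- n) :+ C :* (h0 :- hk) :+ H :+ hk′ :* b :+ (hk :- hk′) :* (n :+ C :- T)) refl
             (h k) (h (suc k)) (h 0) T (ι (suc k)) C (b (suc k)) Hk) ⟩
    h (suc k) * (T + b (suc k) - (1ℚ + ι (suc k))) + C * (h 0 - h (suc k)) + (Hk + h (suc k))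
      ≡⟨ cong (λ x → h (suc k) * (T + b (suc k) - x) + C * (h 0 - h (suc k)) + (Hk + h (suc k))) (sym (ι-suc (suc k))) ⟩
    h (suc k) * (T + b (suc k) - ι (suc (suc k))) + C * (h 0 - h (suc k)) + (Hk + h (suc k)) ∎
    where
    open ≤-Reasoning
    T = Σ< (suc k) b
    Hk = Σ< (suc k) h

  abel-bound : ∀ (b h : ℕ → ℚ) C k → 0ℚ ≤ C → (∀ j → Σ< j b ≤ ι j + C) → (∀ j → h (suc j) ≤ h j) → 0ℚ ≤ h k →
               Σ< k (λ i → h i * b i) ≤ C * h 0 + Σ< k h
  abel-bound b h C zero 0≤C bounds antitone 0≤h = subst (0ℚ ≤_) (sym (+-identityʳ (C * h 0))) (*-nonNeg 0≤C 0≤h)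
  abel-bound b h C (suc k) 0≤C bounds antitone 0≤h = ≤-trans (abel b h C k bounds antitone)
    (≤-from (h k * (ι (suc k) + C - Σ< (suc k) b))
      (*-nonNeg (≤-trans 0≤h (antitone k)) (≤-diff (bounds (suc k))))
      (solve 6 (λ hk T n C h0 H → C :* h0 :+ H := hk :* (T :- n) :+ C :* (h0 :- hk) :+ H :+ hk :* (n :+ C :- T)) refl
        (h k) (Σ< (suc k) b) (ι (suc k)) C (h 0) (Σ< (suc k) h)))

  reciprocals : List ℕ → ℚ
  reciprocals qs = sumℚ (map inv qs)

  reciprocals-++ : ∀ ps qs → reciprocals (ps ++ qs) ≡ reciprocals ps + reciprocals qs
  reciprocals-++ []       qs = sym (+-identityˡ (reciprocals qs))
  reciprocals-++ (p ∷ ps) qs = trans (cong (inv p +_) (reciprocals-++ ps qs)) (sym (+-assoc (inv p) (reciprocals ps) (reciprocals qs)))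

  reciprocals-⊆ : ∀ {ps qs} → ps ⊆ qs → reciprocals ps ≤ reciprocals qs
  reciprocals-⊆ []         = ≤-refl
  reciprocals-⊆ {ps} (q ∷ʳ S) = subst (_≤ _) (+-identityˡ (reciprocals ps)) (+-mono-≤ (<⇒≤ (0<inv q)) (reciprocals-⊆ S))
  reciprocals-⊆ {p ∷ _} (refl ∷ S) = +-monoʳ-≤ (inv p) (reciprocals-⊆ S)

  inv-cancel : ∀ q {x} .{{_ : ℕ.NonZero q}} → ι q * (inv q * x) ≡ x
  inv-cancel q {x} = trans (sym (*-assoc (ι q) (inv q) x)) (trans (cong (_* x) (ι-inverse q)) (*-identityˡ x))

  ≤-inv : ∀ a q {b} .{{_ : ℕ.NonZero q}} → a ≤ b * ι q → a * inv q ≤ b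
  ≤-inv a q {b} h = *-cancelʳ-≤ (ι q) (0<ι q) (subst (_≤ b * ι q)
    (sym (trans (solve 3 (λ a i q → a :* i :* q := q :* (i :* a)) refl a (inv q) (ι q)) (inv-cancel q))) h)

  ÷-inv : ∀ N p .{{_ : ℕ.NonZero p}} → ι N * inv p ≤ ι (suc (N ÷ p))
  ÷-inv N p = ≤-inv (ι N) p (subst (ι N ≤_) (ι-* (suc (N ÷ p)) p) (ι-mono-≤ (÷-upper N p)))

  -- The factor i = k + 14 normalises: Σ 1/p over 2^i < p ≤ 2^(i+1) is close to 1/i, so these values
  -- are close to 1.
  blockSum : ℕ → ℚ
  blockSum k = ι (k ℕ.+ 14) * reciprocals (block (k ℕ.+ 14))

  weighted-inv : ∀ {a ps} N w → AscendingPrimes a ps →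
                 ι N * (ι w * reciprocals ps) ≤ ι (weighted (λ _ → w) (λ p → suc (N ÷ p)) ps)
  weighted-inv N w [] = ≤-reflexive (trans (solve 2 (λ N w → N :* (w :* con 0ℚ) := con 0ℚ) refl (ι N) (ι w)) (sym ι-0))
  weighted-inv {ps = p ∷ ps} N w ((a<p , _) ∷ A) = begin
    ι N * (ι w * (inv p + reciprocals ps))
      ≡⟨ solve 4 (λ N w i r → N :* (w :* (i :+ r)) := w :* (N :* i) :+ N :* (w :* r)) refl (ι N) (ι w) (inv p) (reciprocals ps) ⟩
    ι w * (ι N * inv p) + ι N * (ι w * reciprocals ps)
      ≤⟨ +-mono-≤ (*-monoʳ-≤ (ι w) (0≤ι w) (÷-inv N p {{ℕ.>-nonZero (ℕ.≤-<-trans ℕ.z≤n a<p)}})) (weighted-inv N w A) ⟩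
    ι w * ι (suc (N ÷ p)) + ι (weighted (λ _ → w) (λ p → suc (N ÷ p)) ps)
      ≡⟨ trans (cong (_+ _) (sym (ι-* w (suc (N ÷ p))))) (sym (ι-+ (w ℕ.* suc (N ÷ p)) _)) ⟩
    ι (w ℕ.* suc (N ÷ p) ℕ.+ weighted (λ _ → w) (λ p → suc (N ÷ p)) ps) ∎
    where open ≤-Reasoning

  blocks-inv : ∀ N k → ι N * Σ< k blockSum ≤ ι (blocks (λ p → suc (N ÷ p)) k)
  blocks-inv N zero    = ≤-reflexive (trans (*-zeroʳ (ι N)) (sym ι-0))
  blocks-inv N (suc k) = subst₂ _≤_ (sym (*-distribˡ-+ (ι N) (Σ< k blockSum) (blockSum k)))
    (sym (ι-+ (blocks (λ p → suc (N ÷ p)) k) _))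
    (+-mono-≤ (blocks-inv N k) (weighted-inv N (k ℕ.+ 14) (primesIn-ascending (2 ℕ.^ (k ℕ.+ 14)) (2 ℕ.^ (k ℕ.+ 14)))))

  mertensC : ℚ
  mertensC = ι 147 * inv 100

  mertens-ℚ : ∀ k → Σ< k blockSum ≤ ι k + mertensC
  mertens-ℚ k = *-cancelˡ-≤ (ι N) (0<ι N {{ℕ.m^n≢0 2 (k ℕ.+ 14)}}) (*-cancelˡ-≤ (ι 100) (0<ι 100) (begin
    ι 100 * (ι N * Σ< k blockSum)
      ≤⟨ *-monoʳ-≤ (ι 100) (0≤ι 100) (blocks-inv N k) ⟩
    ι 100 * ι (blocks (λ p → suc (N ÷ p)) k)
      ≡⟨ sym (ι-* 100 (blocks (λ p → suc (N ÷ p)) k)) ⟩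
    ι (100 ℕ.* blocks (λ p → suc (N ÷ p)) k)
      ≤⟨ ι-mono-≤ (mertens k) ⟩
    ι (N ℕ.* (100 ℕ.* k ℕ.+ 147))
      ≡⟨ trans (ι-* N (100 ℕ.* k ℕ.+ 147)) (cong (ι N *_) (trans (ι-+ (100 ℕ.* k) 147) (cong₂ _+_ (ι-* 100 k) (sym C100)))) ⟩
    ι N * (ι 100 * ι k + ι 100 * mertensC)
      ≡⟨ solve 4 (λ N h k C → N :* (h :* k :+ h :* C) := h :* (N :* (k :+ C))) refl (ι N) (ι 100) (ι k) mertensC ⟩
    ι 100 * (ι N * (ι k + mertensC)) ∎))
    where
    open ≤-Reasoning
    N = 2 ℕ.^ (k ℕ.+ 14)
    *-cancelˡ-≤ : ∀ {x y} c → 0ℚ < c → c * x ≤ c * y → x ≤ y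
    *-cancelˡ-≤ {x} {y} c 0<c h = *-cancelʳ-≤ c 0<c (subst₂ _≤_ (*-comm c x) (*-comm c y) h)
    C100 : ι 100 * mertensC ≡ ι 147
    C100 = trans (solve 3 (λ h a i → h :* (a :* i) := a :* (h :* i)) refl (ι 100) (ι 147) (inv 100))
      (trans (cong (ι 147 *_) (ι-inverse 100)) (*-identityʳ (ι 147)))

-- The dual solution of the linear program

module Dual where
  open import Data.List using (List; []; _∷_; _++_; length)
  open import Data.Nat as ℕ using (ℕ; zero; suc)
  open import Data.Nat.ListAction using (product)
  open import Data.Nat.ListAction.Properties using (product-++)
  import Data.Nat.Properties as ℕ
  open import Data.Product using (∃; _×_; _,_)
  open import Data.Rational hiding (_÷_)
  open import Data.Rational.Properties
  open import Data.Rational.Solver using (module +-*-Solver)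
  open import Relation.Binary.PropositionalEquality hiding (J)
  open +-*-Solver using (solve; _:=_; _:+_; _:*_; _:-_; :-_; con)
  open import Defs
  open Arithmetic
  open UnitaryDivisors using (AscendingPrimes; []; _∷_; ascending-weaken)
  open PrimeLists
  open Exponential
  open LargePrimes

  ascending-2^ : ∀ {i ps} → AscendingPrimes (2 ℕ.^ i) ps → 2 ℕ.^ (i ℕ.* length ps) ℕ.≤ product ps
  ascending-2^ {i} [] = ℕ.≤-reflexive (cong (2 ℕ.^_) (ℕ.*-zeroʳ i))
  ascending-2^ {i} {p ∷ ps} ((2^i<p , _) ∷ A) = subst (ℕ._≤ p ℕ.* product ps)
    (trans (sym (ℕ.^-distribˡ-+-* 2 i (i ℕ.* length ps))) (cong (2 ℕ.^_) (sym (ℕ.*-suc i (length ps)))))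
    (ℕ.*-mono-≤ (ℕ.<⇒≤ 2^i<p) (ascending-2^ {i} (weaken A)))
    where
    weaken : ∀ {qs} → AscendingPrimes p qs → AscendingPrimes (2 ℕ.^ i) qs
    weaken = ascending-weaken (ℕ.<⇒≤ 2^i<p)

  ascending-reciprocals : ∀ {i ps} → AscendingPrimes (2 ℕ.^ i) ps →
                          ι (2 ℕ.^ i) * reciprocals ps ≤ ι (length ps)
  ascending-reciprocals {i} [] = ≤-reflexive (trans (*-zeroʳ (ι (2 ℕ.^ i))) (sym ι-0))
  ascending-reciprocals {i} {p ∷ ps} ((2^i<p , _) ∷ A) = subst₂ _≤_
    (sym (*-distribˡ-+ (ι (2 ℕ.^ i)) (inv p) (reciprocals ps))) (sym (ι-suc (length ps)))
    (+-mono-≤ (≤-inv (ι (2 ℕ.^ i)) p {1ℚ} {{ℕ.>-nonZero (ℕ.≤-<-trans ℕ.z≤n 2^i<p)}}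
        (subst (ι (2 ℕ.^ i) ≤_) (sym (*-identityˡ (ι p))) (ι-mono-≤ (ℕ.<⇒≤ 2^i<p))))
      (ascending-reciprocals {i} (ascending-weaken (ℕ.<⇒≤ 2^i<p) A)))

  low-ascending : ∀ {a ps qs} → AscendingPrimes a (ps ++ qs) → AscendingPrimes a ps
  low-ascending {ps = []}    A         = []
  low-ascending {ps = _ ∷ _} (apq ∷ A) = apq ∷ low-ascending A

  -- Maximising Σ 1/q over the prime divisors q > 2¹⁴ of n is a linear program
  -- whose constraints are Mertens' bound on each initial segment of blocks and
  -- Σ log₂ q ≤ log₂ n; the price of the latter is 1/(J 2^J).
  module _ (m : ℕ) where

    J : ℕ
    J = m ℕ.+ 14

    price : ℚ
    price = inv (J ℕ.* 2 ℕ.^ J)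

    instance
      J≢0 : ℕ.NonZero J
      J≢0 = ℕ.>-nonZero (ℕ.≤-trans (ℕ.s≤s ℕ.z≤n) (ℕ.m≤n+m 14 m))

      J2^J≢0 : ℕ.NonZero (J ℕ.* 2 ℕ.^ J)
      J2^J≢0 = ℕ.m*n≢0 J (2 ℕ.^ J) {{J≢0}} {{ℕ.m^n≢0 2 J}}

    0≤price : 0ℚ ≤ price
    0≤price = <⇒≤ (0<inv (J ℕ.* 2 ℕ.^ J))

    -- For q in block i = k + 14, 1/q = `slope k` · (i/q) + `price` · i · (2^i/q), where 2^i < q.
    -- The first term draws on Mertens' bound and the second, at most `price` · log₂ q, on the size
    -- of n. The price is chosen to make the slope vanish at i = J.
    slope : ℕ → ℚ
    slope k = inv (k ℕ.+ 14) - price * ι (2 ℕ.^ (k ℕ.+ 14))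

    i≢0 : ∀ k → ℕ.NonZero (k ℕ.+ 14)
    i≢0 k = ℕ.>-nonZero (ℕ.≤-trans (ℕ.s≤s ℕ.z≤n) (ℕ.m≤n+m 14 k))

    inv-antitone : ∀ a b .{{_ : ℕ.NonZero a}} .{{_ : ℕ.NonZero b}} → a ℕ.≤ b → inv b ≤ inv a
    inv-antitone a b a≤b = subst (_≤ inv a) (*-identityˡ (inv b)) (≤-inv 1ℚ b
      (subst (_≤ inv a * ι b) (trans (*-comm (inv a) (ι a)) (ι-inverse a))
        (*-monoʳ-≤ (inv a) (<⇒≤ (0<inv a)) (ι-mono-≤ a≤b))))

    slope-antitone : ∀ k → slope (suc k) ≤ slope k
    slope-antitone k = +-mono-≤ (inv-antitone (k ℕ.+ 14) (suc k ℕ.+ 14) {{i≢0 k}} {{i≢0 (suc k)}} (ℕ.n≤1+n _))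
      (neg-antimono-≤ (*-monoʳ-≤ price 0≤price (ι-mono-≤ (ℕ.^-monoʳ-≤ 2 (ℕ.n≤1+n (k ℕ.+ 14))))))

    price≡ : inv J ≡ price * ι (2 ℕ.^ J)
    price≡ = begin
      inv J
        ≡⟨ sym (*-identityʳ (inv J)) ⟩
      inv J * 1ℚ
        ≡⟨ cong (inv J *_) (sym (ι-inverse (J ℕ.* 2 ℕ.^ J))) ⟩
      inv J * (ι (J ℕ.* 2 ℕ.^ J) * price)
        ≡⟨ cong (λ x → inv J * (x * price)) (ι-* J (2 ℕ.^ J)) ⟩
      inv J * (ι J * ι (2 ℕ.^ J) * price)
        ≡⟨ solve 4 (λ i J P p → i :* (J :* P :* p) := (J :* i) :* (p :* P)) refl (inv J) (ι J) (ι (2 ℕ.^ J)) price ⟩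
      (ι J * inv J) * (price * ι (2 ℕ.^ J))
        ≡⟨ trans (cong (_* (price * ι (2 ℕ.^ J))) (ι-inverse J)) (*-identityˡ _) ⟩
      price * ι (2 ℕ.^ J) ∎
      where open ≡-Reasoning

    slope-J : slope m ≡ 0ℚ
    slope-J = trans (cong (_- price * ι (2 ℕ.^ J)) price≡) (+-inverseʳ (price * ι (2 ℕ.^ J)))

    slope-nonNeg : ∀ d k → d ℕ.+ k ≡ m → 0ℚ ≤ slope k
    slope-nonNeg zero    k refl = ≤-reflexive (sym slope-J)
    slope-nonNeg (suc d) k eq   = ≤-trans (slope-nonNeg d (suc k) (trans (ℕ.+-suc d k) eq)) (slope-antitone k)

    -- `bits` adds up the block index i ≤ log₂ q over the primes q already removed, the integer form
    -- of the constraint Σ log₂ q ≤ log₂ n.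
    record Progress (k : ℕ) (qs : List ℕ) : Set where
      constructor progress
      field
        rest      : List ℕ
        bits      : ℕ
        ascending : AscendingPrimes (2 ℕ.^ (k ℕ.+ 14)) rest
        spent     : 2 ℕ.^ bits ℕ.* product rest ℕ.≤ product qs
        gained    : reciprocals qs ≤ Σ< k (λ i → slope i * blockSum i) + price * ι bits + reciprocals rest

    start : ∀ {qs} → AscendingPrimes (2 ℕ.^ 14) qs → Progress 0 qs
    start {qs} A = progress qs 0 A (ℕ.≤-reflexive (ℕ.*-identityˡ (product qs)))
      (≤-reflexive (trans (solve 2 (λ r p → r := con 0ℚ :+ p :* con 0ℚ :+ r) refl (reciprocals qs) price)
        (cong (λ x → 0ℚ + price * x + reciprocals qs) (sym ι-0))))

    advance : ∀ {k qs} → 0ℚ ≤ slope k → Progress k qs → Progress (suc k) qs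
    advance {k} {qs} 0≤h (progress rest bits A spent gained) with split-primes (2 ℕ.^ (k ℕ.+ 14)) A
    ... | split low high refl low⊆ A′ = progress high (bits ℕ.+ i ℕ.* length low)
      (subst (λ x → AscendingPrimes (2 ℕ.^ i ℕ.+ x) high) (sym (ℕ.+-identityʳ (2 ℕ.^ i))) A′)
      (ℕ.≤-trans spent′ spent)
      (≤-trans gained (≤-trans (+-monoʳ-≤ (G + price * ι bits)
          (≤-trans (≤-reflexive (reciprocals-++ low high)) (+-monoˡ-≤ (reciprocals high) low-gain)))
        (≤-reflexive (trans
          (solve 6 (λ G p b g l r → G :+ p :* b :+ (g :+ p :* l :+ r) := G :+ g :+ p :* (b :+ l) :+ r) refl
            G price (ι bits) (slope k * blockSum k) (ι (i ℕ.* length low)) (reciprocals high))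
          (cong (λ x → G + slope k * blockSum k + price * x + reciprocals high) (sym (ι-+ bits (i ℕ.* length low))))))))
      where
      i = k ℕ.+ 14
      G = Σ< k (λ i → slope i * blockSum i)
      A-low : AscendingPrimes (2 ℕ.^ i) low
      A-low = low-ascending A
      spent′ : 2 ℕ.^ (bits ℕ.+ i ℕ.* length low) ℕ.* product high ℕ.≤ 2 ℕ.^ bits ℕ.* product (low ++ high)
      spent′ = begin
        2 ℕ.^ (bits ℕ.+ i ℕ.* length low) ℕ.* product high
          ≡⟨ trans (cong (ℕ._* product high) (ℕ.^-distribˡ-+-* 2 bits (i ℕ.* length low))) (ℕ.*-assoc (2 ℕ.^ bits) (2 ℕ.^ (i ℕ.* length low)) (product high)) ⟩
        2 ℕ.^ bits ℕ.* (2 ℕ.^ (i ℕ.* length low) ℕ.* product high)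
          ≤⟨ ℕ.*-monoʳ-≤ (2 ℕ.^ bits) (ℕ.*-monoˡ-≤ (product high) (ascending-2^ {i} A-low)) ⟩
        2 ℕ.^ bits ℕ.* (product low ℕ.* product high)
          ≡⟨ cong (2 ℕ.^ bits ℕ.*_) (sym (product-++ low high)) ⟩
        2 ℕ.^ bits ℕ.* product (low ++ high) ∎
        where open ℕ.≤-Reasoning
      R = reciprocals low
      low-gain : R ≤ slope k * blockSum k + price * ι (i ℕ.* length low)
      low-gain = begin
        R
          ≡⟨ sym (inv-cancel i {{i≢0 k}}) ⟩
        ι i * (inv i * R)
          ≡⟨ solve 5 (λ n v P p R → n :* (v :* R) := (v :- p :* P) :* (n :* R) :+ p :* (n :* (P :* R))) refl
               (ι i) (inv i) (ι (2 ℕ.^ i)) price R ⟩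
        slope k * (ι i * R) + price * (ι i * (ι (2 ℕ.^ i) * R))
          ≤⟨ +-mono-≤ (*-monoʳ-≤ (slope k) 0≤h (*-monoʳ-≤ (ι i) (0≤ι i) (reciprocals-⊆ low⊆)))
               (*-monoʳ-≤ price 0≤price (*-monoʳ-≤ (ι i) (0≤ι i) (ascending-reciprocals {i} A-low))) ⟩
        slope k * blockSum k + price * (ι i * ι (length low))
          ≡⟨ cong (λ x → slope k * blockSum k + price * x) (sym (ι-* i (length low))) ⟩
        slope k * blockSum k + price * ι (i ℕ.* length low) ∎
        where open ≤-Reasoning

    run : ∀ {qs} k → k ℕ.≤ m → AscendingPrimes (2 ℕ.^ 14) qs → Progress k qs
    run zero    _   A = start A
    run (suc k) k<m A = advance (slope-nonNeg (m ℕ.∸ k) k (ℕ.m∸n+n≡m (ℕ.<⇒≤ k<m))) (run k (ℕ.<⇒≤ k<m) A)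

    -- From 2^J on the slope would be negative, so the remaining primes are charged to the price
    -- alone: 1/q < 1/2^J = J · `price`.
    finish : ∀ {qs} → Progress m qs →
             ∃ λ bits → 2 ℕ.^ bits ℕ.≤ product qs × reciprocals qs ≤ Σ< m (λ i → slope i * blockSum i) + price * ι bits
    finish {qs} (progress rest bits A′ spent gained) = bits ℕ.+ J ℕ.* length rest
      , ℕ.≤-trans (ℕ.≤-reflexive (ℕ.^-distribˡ-+-* 2 bits (J ℕ.* length rest)))
          (ℕ.≤-trans (ℕ.*-monoʳ-≤ (2 ℕ.^ bits) (ascending-2^ {J} A′)) spent)
      , ≤-trans gained (≤-trans (+-monoʳ-≤ (G + price * ι bits) rest-gain)
          (≤-reflexive (trans
            (solve 4 (λ G p b l → G :+ p :* b :+ p :* l := G :+ p :* (b :+ l)) refl G price (ι bits) (ι (J ℕ.* length rest)))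
            (cong (λ x → G + price * x) (sym (ι-+ bits (J ℕ.* length rest)))))))
      where
      G = Σ< m (λ i → slope i * blockSum i)
      R = reciprocals rest
      rest-gain : R ≤ price * ι (J ℕ.* length rest)
      rest-gain = begin
        R
          ≡⟨ sym (inv-cancel (J ℕ.* 2 ℕ.^ J)) ⟩
        ι (J ℕ.* 2 ℕ.^ J) * (price * R)
          ≡⟨ cong (_* (price * R)) (ι-* J (2 ℕ.^ J)) ⟩
        ι J * ι (2 ℕ.^ J) * (price * R)
          ≡⟨ solve 4 (λ J P p R → J :* P :* (p :* R) := p :* (J :* (P :* R))) refl (ι J) (ι (2 ℕ.^ J)) price R ⟩
        price * (ι J * (ι (2 ℕ.^ J) * R))
          ≤⟨ *-monoʳ-≤ price 0≤price (*-monoʳ-≤ (ι J) (0≤ι J) (ascending-reciprocals {J} A′)) ⟩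
        price * (ι J * ι (length rest))
          ≡⟨ cong (price *_) (sym (ι-* J (length rest))) ⟩
        price * ι (J ℕ.* length rest) ∎
        where open ≤-Reasoning

    dual-bound : ∀ {qs} → AscendingPrimes (2 ℕ.^ 14) qs →
                 ∃ λ bits → 2 ℕ.^ bits ℕ.≤ product qs × reciprocals qs ≤ Σ< m (λ i → slope i * blockSum i) + price * ι bits
    dual-bound A = finish (run m ℕ.≤-refl A)

-- A rational bound for the product over the large primes

module LargeProduct where
  open import Data.List using ([]; _∷_; map)
  open import Data.Nat as ℕ using (ℕ; zero; suc)
  open import Data.Nat.ListAction using (product)
  import Data.Nat.Properties as ℕ
  import Data.Nat.Solver as ℕ
  open import Data.Product using (∃; _×_; _,_)
  open import Data.Rational hiding (_÷_)
  open import Data.Rational.Properties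
  open import Data.Rational.Solver using (module +-*-Solver)
  open import Relation.Binary.PropositionalEquality hiding (J)
  open +-*-Solver using (solve; _:=_; _:+_; _:*_; _:-_; :-_; con)
  open import Defs
  open Arithmetic
  open UnitaryDivisors using (AscendingPrimes; []; _∷_)
  open Exponential
  open LargePrimes
  open Dual

  ι-2 : ι 2 ≡ 1ℚ + 1ℚ
  ι-2 = trans (ι-suc 1) (cong (1ℚ +_) ι-1)

  -- With i = k + 14 and x = 1/(2i), `⊑-tanh` gives (2i + 1)/(2i - 1), which telescopes in
  -- `harmonic⊑`.
  inv⊑tanh : ∀ k → inv (k ℕ.+ 14) ⊑ ι (29 ℕ.+ 2 ℕ.* k) * inv (27 ℕ.+ 2 ℕ.* k)
  inv⊑tanh k = subst (_⊑ s) x+x (⊑-tanh (<⇒≤ (0<inv b)) x<1 (≤-reflexive (sym identity)))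
    where
    i = k ℕ.+ 14
    a = 27 ℕ.+ 2 ℕ.* k
    b = 28 ℕ.+ 2 ℕ.* k
    c = 29 ℕ.+ 2 ℕ.* k
    s = ι c * inv a
    x = inv b
    A = ι a
    b≡ : ι b ≡ 1ℚ + A
    b≡ = ι-suc a
    c≡ : ι c ≡ 1ℚ + ι b
    c≡ = ι-suc b
    b≡2i : ι b ≡ ι 2 * ι i
    b≡2i = trans (cong ι (ℕsolve 1 (λ k → ℕcon 28 ℕ:+ ℕcon 2 ℕ:* k ℕ:= ℕcon 2 ℕ:* (k ℕ:+ ℕcon 14)) refl k)) (ι-* 2 i)
      where open ℕ.+-*-Solver using () renaming (solve to ℕsolve; con to ℕcon; _:+_ to _ℕ:+_; _:*_ to _ℕ:*_; _:=_ to _ℕ:=_)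
    x<1 : x < 1ℚ
    x<1 = *-cancelˡ-< (ι b) (0≤ι b) (subst₂ _<_ (sym (ι-inverse b)) (sym (*-identityʳ (ι b)))
      (subst (_< ι b) ι-1 (ι-mono-< {1} {b} (ℕ.s≤s (ℕ.s≤s ℕ.z≤n)))))
    x+x : x + x ≡ inv i
    x+x = begin
      x + x
        ≡⟨ sym (inv-cancel i {{ℕ.>-nonZero (ℕ.≤-trans (ℕ.s≤s ℕ.z≤n) (ℕ.m≤n+m 14 k))}}) ⟩
      ι i * (inv i * (x + x))
        ≡⟨ solve 3 (λ i v x → i :* (v :* (x :+ x)) := (con 1ℚ :+ con 1ℚ) :* i :* x :* v) refl (ι i) (inv i) x ⟩
      (1ℚ + 1ℚ) * ι i * x * inv i
        ≡⟨ cong (λ y → y * ι i * x * inv i) (sym ι-2) ⟩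
      ι 2 * ι i * x * inv i
        ≡⟨ cong (λ y → y * x * inv i) (sym b≡2i) ⟩
      ι b * x * inv i
        ≡⟨ trans (cong (_* inv i) (ι-inverse b)) (*-identityˡ (inv i)) ⟩
      inv i ∎
      where open ≡-Reasoning
    identity : s * (1ℚ - x) ≡ 1ℚ + x
    identity = begin
      ι c * inv a * (1ℚ - x)
        ≡⟨ cong (λ y → ι c * inv a * (y - x)) (sym (ι-inverse b)) ⟩
      ι c * inv a * (ι b * x - x)
        ≡⟨ cong (λ y → ι c * inv a * (y * x - x)) b≡ ⟩
      ι c * inv a * ((1ℚ + A) * x - x)
        ≡⟨ solve 4 (λ c v A x → c :* v :* ((con 1ℚ :+ A) :* x :- x) := (A :* v) :* (c :* x)) refl (ι c) (inv a) A x ⟩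
      A * inv a * (ι c * x)
        ≡⟨ trans (cong (_* (ι c * x)) (ι-inverse a)) (*-identityˡ (ι c * x)) ⟩
      ι c * x
        ≡⟨ cong (_* x) c≡ ⟩
      (1ℚ + ι b) * x
        ≡⟨ solve 2 (λ b x → (con 1ℚ :+ b) :* x := b :* x :+ x) refl (ι b) x ⟩
      ι b * x + x
        ≡⟨ cong (_+ x) (ι-inverse b) ⟩
      1ℚ + x ∎
      where open ≡-Reasoning

  harmonic : ℕ → ℚ
  harmonic m = Σ< m (λ k → inv (k ℕ.+ 14))

  0≤harmonic : ∀ m → 0ℚ ≤ harmonic m
  0≤harmonic zero    = ≤-refl
  0≤harmonic (suc m) = subst (_≤ harmonic m + inv (m ℕ.+ 14)) (+-identityˡ 0ℚ) (+-mono-≤ (0≤harmonic m) (<⇒≤ (0<inv (m ℕ.+ 14))))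

  harmonic⊑ : ∀ m → harmonic m ⊑ ι (27 ℕ.+ 2 ℕ.* m) * inv 27
  harmonic⊑ zero    = subst (0ℚ ⊑_) (sym (ι-inverse 27)) 0⊑1
  harmonic⊑ (suc m) = subst (harmonic (suc m) ⊑_) eq
    (⊑-+ (0≤harmonic m) (<⇒≤ (0<inv (m ℕ.+ 14))) (harmonic⊑ m) (inv⊑tanh m))
    where
    a = 27 ℕ.+ 2 ℕ.* m
    eq : ι a * inv 27 * (ι (29 ℕ.+ 2 ℕ.* m) * inv a) ≡ ι (27 ℕ.+ 2 ℕ.* suc m) * inv 27
    eq = begin
      ι a * inv 27 * (ι (29 ℕ.+ 2 ℕ.* m) * inv a)
        ≡⟨ solve 4 (λ a i c v → a :* i :* (c :* v) := (a :* v) :* (c :* i)) refl (ι a) (inv 27) (ι (29 ℕ.+ 2 ℕ.* m)) (inv a) ⟩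
      ι a * inv a * (ι (29 ℕ.+ 2 ℕ.* m) * inv 27)
        ≡⟨ trans (cong (_* (ι (29 ℕ.+ 2 ℕ.* m) * inv 27)) (ι-inverse a)) (*-identityˡ _) ⟩
      ι (29 ℕ.+ 2 ℕ.* m) * inv 27
        ≡⟨ cong (λ x → ι x * inv 27) (sym (cong (27 ℕ.+_) (ℕ.*-suc 2 m))) ⟩
      ι (27 ℕ.+ 2 ℕ.* suc m) * inv 27 ∎
      where open ≡-Reasoning

  ⊑-fraction : ∀ {Z} D E .{{_ : ℕ.NonZero D}} → 0ℚ ≤ Z → ι (D ℕ.+ E) * Z ≡ ι E → Z ⊑ ι (D ℕ.+ E) * inv D
  ⊑-fraction {Z} D E 0≤Z FZ≡E = ⊑-reciprocal 0≤Z Z<1 (≤-reflexive (sym (begin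
    F * inv D * (1ℚ - Z)
      ≡⟨ solve 3 (λ F v Z → F :* v :* (con 1ℚ :- Z) := (F :- F :* Z) :* v) refl F (inv D) Z ⟩
    (F - F * Z) * inv D
      ≡⟨ cong₂ (λ x y → (x - y) * inv D) (ι-+ D E) FZ≡E ⟩
    (ι D + ι E - ι E) * inv D
      ≡⟨ solve 3 (λ D E v → (D :+ E :- E) :* v := D :* v) refl (ι D) (ι E) (inv D) ⟩
    ι D * inv D
      ≡⟨ ι-inverse D ⟩
    1ℚ ∎)))
    where
    open ≡-Reasoning
    F = ι (D ℕ.+ E)
    Z<1 : Z < 1ℚ
    Z<1 = *-cancelˡ-< F (0≤ι (D ℕ.+ E)) (subst₂ _<_ (sym FZ≡E) (sym (*-identityʳ F))
      (ι-mono-< {E} {D ℕ.+ E} (ℕ.m<n+m E (ℕ.>-nonZero⁻¹ D))))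

  product-suc : ∀ {a qs} → AscendingPrimes a qs →
                productℚ (map (λ q → 1ℚ + inv q) qs) * ι (product qs) ≡ ι (product (map suc qs))
  product-suc [] = *-identityˡ (ι 1)
  product-suc {qs = q ∷ qs} ((a<q , _) ∷ A) = begin
    (1ℚ + inv q) * P * ι (q ℕ.* product qs)
      ≡⟨ cong ((1ℚ + inv q) * P *_) (ι-* q (product qs)) ⟩
    (1ℚ + inv q) * P * (ι q * ι (product qs))
      ≡⟨ solve 4 (λ v P q r → (con 1ℚ :+ v) :* P :* (q :* r) := (q :+ q :* v) :* (P :* r)) refl (inv q) P (ι q) (ι (product qs)) ⟩
    (ι q + ι q * inv q) * (P * ι (product qs))
      ≡⟨ cong₂ (λ x y → (ι q + x) * y) (ι-inverse q {{ℕ.>-nonZero (ℕ.≤-<-trans ℕ.z≤n a<q)}}) (product-suc A) ⟩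
    (ι q + 1ℚ) * ι (product (map suc qs))
      ≡⟨ cong (_* ι (product (map suc qs))) (trans (+-comm (ι q) 1ℚ) (sym (ι-suc q))) ⟩
    ι (suc q) * ι (product (map suc qs))
      ≡⟨ sym (ι-* (suc q) (product (map suc qs))) ⟩
    ι (suc q ℕ.* product (map suc qs)) ∎
    where
    open ≡-Reasoning
    P = productℚ (map (λ q → 1ℚ + inv q) qs)

  Σ<-slope : ∀ m j → Σ< j (slope m) ≡ harmonic j - price m * (ι (2 ℕ.^ (j ℕ.+ 14)) - ι (2 ℕ.^ 14))
  Σ<-slope m zero = solve 2 (λ p x → con 0ℚ := con 0ℚ :- p :* (x :- x)) refl (price m) (ι (2 ℕ.^ 14))
  Σ<-slope m (suc j) = begin
    Σ< j (slope m) + (inv (j ℕ.+ 14) - price m * P)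
      ≡⟨ cong (_+ (inv (j ℕ.+ 14) - price m * P)) (Σ<-slope m j) ⟩
    harmonic j - price m * (P - P₀) + (inv (j ℕ.+ 14) - price m * P)
      ≡⟨ solve 5 (λ H p P P₀ i → H :- p :* (P :- P₀) :+ (i :- p :* P) := H :+ i :- p :* ((con 1ℚ :+ con 1ℚ) :* P :- P₀)) refl
           (harmonic j) (price m) P P₀ (inv (j ℕ.+ 14)) ⟩
    harmonic j + inv (j ℕ.+ 14) - price m * ((1ℚ + 1ℚ) * P - P₀)
      ≡⟨ cong (λ x → harmonic j + inv (j ℕ.+ 14) - price m * (x * P - P₀)) (sym ι-2) ⟩
    harmonic j + inv (j ℕ.+ 14) - price m * (ι 2 * P - P₀)
      ≡⟨ cong (λ x → harmonic j + inv (j ℕ.+ 14) - price m * (x - P₀)) (sym (ι-* 2 (2 ℕ.^ (j ℕ.+ 14)))) ⟩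
    harmonic (suc j) - price m * (ι (2 ℕ.^ (suc j ℕ.+ 14)) - P₀) ∎
    where
    open ≡-Reasoning
    P = ι (2 ℕ.^ (j ℕ.+ 14))
    P₀ = ι (2 ℕ.^ 14)

  1≤mertensC : 1ℚ ≤ mertensC
  1≤mertensC = subst (_≤ mertensC) (ι-inverse 100)
    (*-monoˡ-≤ (inv 100) (<⇒≤ (0<inv 100)) (ι-mono-≤ {100} {147} (ℕ.m≤m+n 100 47)))

  -- 1.47/14 is the price of Mertens' constant in `abel-bound`; t/(4J) arises when ⌊log₂ n⌋ exceeds
  -- 2^J by up to t quarters of it.
  excess : ℕ → ℕ → ℚ
  excess m t = mertensC * inv 14 + inv (J m) * ι t * inv 4

  0≤excess : ∀ m t → 0ℚ ≤ excess m t
  0≤excess m t = subst (_≤ excess m t) (+-identityˡ 0ℚ) (+-mono-≤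
    (*-nonNeg (≤-trans (<⇒≤ (0<u 0)) 1≤mertensC) (<⇒≤ (0<inv 14)))
    (*-nonNeg (*-nonNeg (<⇒≤ (0<inv (J m))) (0≤ι t)) (<⇒≤ (0<inv 4))))

  budget : ∀ m t bits → 4 ℕ.* bits ℕ.≤ (4 ℕ.+ t) ℕ.* 2 ℕ.^ J m →
           price m * ι bits ≤ price m * ι (2 ℕ.^ J m) + inv (J m) * ι t * inv 4
  budget m t bits h = *-cancelʳ-≤ (ι 4) (0<ι 4) (begin
    p * ι bits * ι 4
      ≡⟨ trans (solve 3 (λ p b f → p :* b :* f := p :* (f :* b)) refl p (ι bits) (ι 4)) (cong (p *_) (sym (ι-* 4 bits))) ⟩
    p * ι (4 ℕ.* bits)
      ≤⟨ *-monoʳ-≤ p (0≤price m) (ι-mono-≤ h) ⟩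
    p * ι ((4 ℕ.+ t) ℕ.* 2 ℕ.^ J m)
      ≡⟨ cong (p *_) (trans (ι-* (4 ℕ.+ t) (2 ℕ.^ J m)) (cong (_* P) (ι-+ 4 t))) ⟩
    p * ((ι 4 + ι t) * P)
      ≡⟨ solve 4 (λ p f t P → p :* ((f :+ t) :* P) := p :* P :* f :+ (p :* P) :* t :* con 1ℚ) refl p (ι 4) (ι t) P ⟩
    p * P * ι 4 + p * P * ι t * 1ℚ
      ≡⟨ cong₂ (λ x y → p * P * ι 4 + x * ι t * y) (sym (price≡ m)) (sym (ι-inverse 4)) ⟩
    p * P * ι 4 + inv (J m) * ι t * (ι 4 * inv 4)
      ≡⟨ solve 5 (λ x f j t v → x :* f :+ j :* t :* (f :* v) := (x :+ j :* t :* v) :* f) refl (p * P) (ι 4) (inv (J m)) (ι t) (inv 4) ⟩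
    (p * P + inv (J m) * ι t * inv 4) * ι 4 ∎)
    where
    open ≤-Reasoning
    p = price m
    P = ι (2 ℕ.^ J m)

  reciprocals-bound : ∀ m t L {qs} → AscendingPrimes (2 ℕ.^ 14) qs → product qs ℕ.< 2 ℕ.^ suc L →
                      4 ℕ.* L ℕ.≤ (4 ℕ.+ t) ℕ.* 2 ℕ.^ J m → reciprocals qs ≤ excess m t + harmonic m
  reciprocals-bound m t L {qs} A qs<2^L 4L≤ = bound (dual-bound m A)
    where
    open ≤-Reasoning
    C = mertensC
    p = price m
    P = ι (2 ℕ.^ J m)
    P₀ = ι (2 ℕ.^ 14)
    w = inv (J m) * ι t * inv 4
    bits≤L : ∀ bits → 2 ℕ.^ bits ℕ.≤ product qs → bits ℕ.≤ L
    bits≤L bits 2^bits≤ = ℕ.s≤s⁻¹ (ℕ.≰⇒> λ L<bits → ℕ.<⇒≱ qs<2^L (ℕ.≤-trans (ℕ.^-monoʳ-≤ 2 L<bits) 2^bits≤))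
    bound : (∃ λ bits → 2 ℕ.^ bits ℕ.≤ product qs × reciprocals qs ≤ Σ< m (λ i → slope m i * blockSum i) + price m * ι bits) →
            reciprocals qs ≤ excess m t + harmonic m
    bound (bits , 2^bits≤ , gain) = begin
      reciprocals qs
        ≤⟨ gain ⟩
      Σ< m (λ i → slope m i * blockSum i) + p * ι bits
        ≤⟨ +-mono-≤ (abel-bound blockSum (slope m) C m (≤-trans (<⇒≤ (0<u 0)) 1≤mertensC) mertens-ℚ (slope-antitone m) (≤-reflexive (sym (slope-J m))))
             (budget m t bits (ℕ.≤-trans (ℕ.*-monoʳ-≤ 4 (bits≤L bits 2^bits≤)) 4L≤)) ⟩
      C * slope m 0 + Σ< m (slope m) + (p * P + w)
        ≡⟨ cong (λ x → C * slope m 0 + x + (p * P + w)) (Σ<-slope m m) ⟩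
      C * (inv 14 - p * P₀) + (harmonic m - p * (P - P₀)) + (p * P + w)
        -- The two terms `p * P` cancel; `Σ<-slope` leaves + p P₀, which - C p P₀ from `slope m 0`
        -- outweighs because C ≥ 1.
        ≤⟨ ≤-from ((C - 1ℚ) * (p * P₀)) (*-nonNeg (≤-diff 1≤mertensC) (*-nonNeg (0≤price m) (0≤ι (2 ℕ.^ 14))))
             (solve 7 (λ C i p P₀ H P w → C :* i :+ w :+ H :=
               C :* (i :- p :* P₀) :+ (H :- p :* (P :- P₀)) :+ (p :* P :+ w) :+ (C :- con 1ℚ) :* (p :* P₀)) refl
               C (inv 14) p P₀ (harmonic m) P w) ⟩
      C * inv 14 + w + harmonic m ∎

  -- 147/100/14 = 420/4000.
  excess-scaled : ∀ m t → ι (4000 ℕ.* J m) * excess m t ≡ ι (420 ℕ.* J m ℕ.+ 1000 ℕ.* t)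
  excess-scaled m t = begin
    ι (4000 ℕ.* j) * (ι 147 * inv 100 * inv 14 + inv j * ι t * inv 4)
      ≡⟨ cong (_* (ι 147 * inv 100 * inv 14 + inv j * ι t * inv 4)) (ι-* 4000 j) ⟩
    ι 4000 * ι j * (ι 147 * inv 100 * inv 14 + inv j * ι t * inv 4)
      ≡⟨ solve 8 (λ g s j v a b c t → g :* j :* (s :* a :* b :+ v :* t :* c) :=
           g :* s :* a :* b :* j :+ (g :* c) :* t :* (j :* v)) refl
           (ι 4000) (ι 147) (ι j) (inv j) (inv 100) (inv 14) (inv 4) (ι t) ⟩
    ι 4000 * ι 147 * inv 100 * inv 14 * ι j + ι 4000 * inv 4 * ι t * (ι j * inv j)
      ≡⟨ cong₂ _+_ (cong (_* ι j) c₁) (cong₂ (λ x y → x * ι t * y) c₂ (ι-inverse j {{J≢0 m}})) ⟩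
    ι 420 * ι j + ι 1000 * ι t * 1ℚ
      ≡⟨ cong₂ _+_ (sym (ι-* 420 j)) (trans (*-identityʳ (ι 1000 * ι t)) (sym (ι-* 1000 t))) ⟩
    ι (420 ℕ.* j) + ι (1000 ℕ.* t)
      ≡⟨ sym (ι-+ (420 ℕ.* j) (1000 ℕ.* t)) ⟩
    ι (420 ℕ.* j ℕ.+ 1000 ℕ.* t) ∎
    where
    open ≡-Reasoning
    j = J m
    cancel : ∀ a q b .{{_ : ℕ.NonZero q}} → ι a ≡ ι q * b → ι a * inv q ≡ b
    cancel a q b eq = trans (cong (_* inv q) eq)
      (trans (solve 3 (λ q b v → q :* b :* v := q :* (v :* b)) refl (ι q) b (inv q)) (inv-cancel q))
    c₁ : ι 4000 * ι 147 * inv 100 * inv 14 ≡ ι 420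
    c₁ = trans (cong (λ x → x * inv 100 * inv 14) (sym (ι-* 4000 147)))
      (trans (cong (_* inv 14) (cancel 588000 100 (ι 5880) (ι-* 100 5880))) (cancel 5880 14 (ι 420) (ι-* 14 420)))
    c₂ : ι 4000 * inv 4 ≡ ι 1000
    c₂ = cancel 4000 4 (ι 1000) (ι-* 4 1000)

  -- D = 4000 J (1 - `excess`), so the first factor 4000 J/D is 1/(1 - `excess`) ≥ e^`excess`; the
  -- second, (27 + 2m)/27, bounds the exponential of the harmonic sum.
  large-product : ∀ m t L D {qs} .{{_ : ℕ.NonZero D}} → D ℕ.+ 1000 ℕ.* t ≡ 3580 ℕ.* J m →
                  AscendingPrimes (2 ℕ.^ 14) qs → product qs ℕ.< 2 ℕ.^ suc L → 4 ℕ.* L ℕ.≤ (4 ℕ.+ t) ℕ.* 2 ℕ.^ J m →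
                  product (map suc qs) ℕ.* (27 ℕ.* D) ℕ.≤ 4000 ℕ.* J m ℕ.* (27 ℕ.+ 2 ℕ.* m) ℕ.* product qs
  large-product m t L D {qs} D≡ A qs<2^L 4L≤ = ι-cancel-≤ (begin
    ι (product (map suc qs) ℕ.* (27 ℕ.* D))
      ≡⟨ trans (ι-* (product (map suc qs)) (27 ℕ.* D)) (cong₂ _*_ (sym (product-suc A)) (ι-* 27 D)) ⟩
    Π * Q * (ι 27 * ι D)
      ≤⟨ *-monoˡ-≤ (ι 27 * ι D) (*-nonNeg (0≤ι 27) (0≤ι D)) (*-monoˡ-≤ Q (0≤ι (product qs)) Π≤) ⟩
    F * inv D * (B * inv 27) * Q * (ι 27 * ι D)
      ≡⟨ solve 7 (λ F v B w Q s D → F :* v :* (B :* w) :* Q :* (s :* D) := F :* B :* Q :* ((s :* w) :* (D :* v))) refl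
           F (inv D) B (inv 27) Q (ι 27) (ι D) ⟩
    F * B * Q * ((ι 27 * inv 27) * (ι D * inv D))
      ≡⟨ trans (cong (F * B * Q *_) (cong₂ _*_ (ι-inverse 27) (ι-inverse D))) (*-identityʳ (F * B * Q)) ⟩
    F * B * Q
      ≡⟨ trans (cong (_* Q) (sym (ι-* (4000 ℕ.* J m) (27 ℕ.+ 2 ℕ.* m)))) (sym (ι-* (4000 ℕ.* J m ℕ.* (27 ℕ.+ 2 ℕ.* m)) (product qs))) ⟩
    ι (4000 ℕ.* J m ℕ.* (27 ℕ.+ 2 ℕ.* m) ℕ.* product qs) ∎)
    where
    open ≤-Reasoning
    E = 420 ℕ.* J m ℕ.+ 1000 ℕ.* t
    Π = productℚ (map (λ q → 1ℚ + inv q) qs)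
    Q = ι (product qs)
    F = ι (4000 ℕ.* J m)
    B = ι (27 ℕ.+ 2 ℕ.* m)
    F≡ : D ℕ.+ E ≡ 4000 ℕ.* J m
    F≡ = trans (ℕsolve 3 (λ d x y → d ℕ:+ (x ℕ:+ y) ℕ:= d ℕ:+ y ℕ:+ x) refl D (420 ℕ.* J m) (1000 ℕ.* t))
      (trans (cong (ℕ._+ 420 ℕ.* J m) D≡) (sym (ℕ.*-distribʳ-+ (J m) 3580 420)))
      where open ℕ.+-*-Solver using () renaming (solve to ℕsolve; _:+_ to _ℕ:+_; _:=_ to _ℕ:=_)
    excess⊑ : excess m t ⊑ F * inv D
    excess⊑ = subst (λ x → excess m t ⊑ ι x * inv D) F≡ (⊑-fraction D E (0≤excess m t)
      (trans (cong (λ x → ι x * excess m t) F≡) (excess-scaled m t)))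
    0≤reciprocals : ∀ rs → 0ℚ ≤ reciprocals rs
    0≤reciprocals []       = ≤-refl
    0≤reciprocals (r ∷ rs) = subst (_≤ inv r + reciprocals rs) (+-identityˡ 0ℚ) (+-mono-≤ (<⇒≤ (0<inv r)) (0≤reciprocals rs))
    Π≤ : Π ≤ F * inv D * (B * inv 27)
    Π≤ = ⊑-product qs (⊑-mono (0≤reciprocals qs) (reciprocals-bound m t L A qs<2^L 4L≤)
      (⊑-+ (0≤excess m t) (0≤harmonic m) excess⊑ (harmonic⊑ m)))

-- Certificates for n with at most 1900 prime factors

module FewPrimes where
  open import Data.List using (List; []; _∷_; map; length; take)
  open import Data.List.Properties using (length-take)
  open import Data.Nat
  open import Data.Nat.Divisibility using (divides; ∣⇒≤)
  open import Data.Nat.ListAction using (product)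
  open import Data.Nat.Primality using (prime⇒nonZero)
  open import Data.Nat.Properties
  open import Data.Nat.Solver using (module +-*-Solver)
  open import Data.Product using (∃₂; _×_; _,_)
  open import Data.Sum using (_⊎_; inj₁; inj₂)
  open import Relation.Binary.PropositionalEquality
  open import Defs using (σ*)
  open UnitaryDivisors
  open PrimeLists
  open Chebyshev using (^-distrib-*)
  open SmallPrimes
  open +-*-Solver using (solve; _:=_; _:*_)

  -- These are the hypotheses of `Criterion.criterion` at r = 999: K/1000 and K′/1000 are lower
  -- bounds for log log n and log n.
  record Certificate (n : ℕ) : Set where
    constructor certificate
    field
      K K′  : ℕ
      sum≤  : σ* n * 10000 * 1000 ≤ 13007 * K * n
      outer : 1000 ^ K * 1000 < K′ * 999 ^ K
      inner : 1000 ^ K′ < n * 999 ^ K′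

  product≢0 : ∀ {a qs} → AscendingPrimes a qs → NonZero (product qs)
  product≢0 [] = _
  product≢0 {qs = q ∷ qs} ((_ , pq) ∷ A) = m*n≢0 q (product qs) {{prime⇒nonZero pq}} {{product≢0 A}}

  ratio⇒sum≤ : ∀ {n} (S : Support n 1) X Y K .{{_ : NonZero X}} →
               product (map suc (Support.primes S)) * X ≤ Y * product (Support.primes S) →
               Y * 10000000 ≤ 13007 * K * X →
               σ* n * 10000 * 1000 ≤ 13007 * K * n
  ratio⇒sum≤ {n} (support qs A _ bound) X Y K ratio Y≤ =
    *-cancelʳ-≤ (σ* n * 10000 * 1000) (13007 * K * n) (Q * X) {{m*n≢0 Q X {{product≢0 A}}}} (begin
      σ* n * 10000 * 1000 * (Q * X)
        ≡⟨ trans (cong (_* (Q * X)) (*-assoc (σ* n) 10000 1000)) (arrange (σ* n) 10000000 Q X) ⟩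
      (σ* n * Q) * (X * 10000000)
        ≤⟨ *-monoˡ-≤ (X * 10000000) bound ⟩
      (n * Q⁺) * (X * 10000000)
        ≡⟨ arrange′ n Q⁺ X 10000000 ⟩
      (Q⁺ * X) * (n * 10000000)
        ≤⟨ *-monoˡ-≤ (n * 10000000) ratio ⟩
      (Y * Q) * (n * 10000000)
        ≡⟨ arrange″ Y Q n 10000000 ⟩
      Y * 10000000 * (Q * n)
        ≤⟨ *-monoˡ-≤ (Q * n) Y≤ ⟩
      13007 * K * X * (Q * n)
        ≡⟨ arrange‴ (13007 * K) X Q n ⟩
      13007 * K * n * (Q * X) ∎)
    where
    open ≤-Reasoning
    Q = product qs
    Q⁺ = product (map suc qs)
    arrange : ∀ s c q x → s * c * (q * x) ≡ (s * q) * (x * c)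
    arrange = solve 4 (λ s c q x → s :* c :* (q :* x) := (s :* q) :* (x :* c)) refl
    arrange′ : ∀ n q x c → (n * q) * (x * c) ≡ (q * x) * (n * c)
    arrange′ = solve 4 (λ n q x c → (n :* q) :* (x :* c) := (q :* x) :* (n :* c)) refl
    arrange″ : ∀ y q n c → (y * q) * (n * c) ≡ y * c * (q * n)
    arrange″ = solve 4 (λ y q n c → (y :* q) :* (n :* c) := y :* c :* (q :* n)) refl
    arrange‴ : ∀ k x q n → k * x * (q * n) ≡ k * n * (q * x)
    arrange‴ = solve 4 (λ k x q n → k :* x :* (q :* n) := k :* n :* (q :* x)) refl

  inner-mono : ∀ {n₀ n} K′ → n₀ ≤ n → 1000 ^ K′ < n₀ * 999 ^ K′ → 1000 ^ K′ < n * 999 ^ K′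
  inner-mono K′ n₀≤n h = <-≤-trans h (*-monoˡ-≤ (999 ^ K′) n₀≤n)

  ^-mono-< : ∀ {a b} k .{{_ : NonZero k}} → a < b → a ^ k < b ^ k
  ^-mono-< {a} {b} 1             a<b = subst₂ _<_ (sym (*-identityʳ a)) (sym (*-identityʳ b)) a<b
  ^-mono-< {a} {b} (suc k@(suc _)) a<b = *-mono-< a<b (^-mono-< k a<b)

  -- 692 is the greatest exponent for which this holds; 0.692 stands for log 2 throughout.
  1000^692<2*999^692 : 1000 ^ 692 < 2 * 999 ^ 692
  1000^692<2*999^692 = <ᵇ⇒< (1000 ^ 692) (2 * 999 ^ 692) _

  inner-2^ : ∀ {n} L .{{_ : NonZero L}} → 2 ^ L ≤ n → 1000 ^ (692 * L) < n * 999 ^ (692 * L)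
  inner-2^ {n} L 2^L≤n = begin-strict
    1000 ^ (692 * L)       ≡⟨ ^-*-assoc 1000 692 L ⟨
    (1000 ^ 692) ^ L       <⟨ ^-mono-< L 1000^692<2*999^692 ⟩
    (2 * 999 ^ 692) ^ L    ≡⟨ ^-distrib-* 2 (999 ^ 692) L ⟩
    2 ^ L * (999 ^ 692) ^ L ≡⟨ cong (2 ^ L *_) (^-*-assoc 999 692 L) ⟩
    2 ^ L * 999 ^ (692 * L) ≤⟨ *-monoˡ-≤ (999 ^ (692 * L)) 2^L≤n ⟩
    n * 999 ^ (692 * L)    ∎
    where open ≤-Reasoning

  product-support≤ : ∀ {n} .{{_ : NonZero n}} (S : Support n 1) → product (Support.primes S) ≤ n
  product-support≤ S = ∣⇒≤ (Support.divides-n S)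

  below-certificate : ∀ {n} rs K K′ .{{_ : NonZero (product rs)}} (S : Support n 1) →
                      Below rs (Support.primes S) → length (Support.primes S) ≤ length rs →
                      product (map suc rs) * 10000000 ≤ 13007 * K * product rs →
                      1000 ^ K * 1000 < K′ * 999 ^ K → 1000 ^ K′ < n * 999 ^ K′ → Certificate n
  below-certificate rs K K′ S B l r outer inner = certificate K K′
    (ratio⇒sum≤ S (product rs) (product (map suc rs)) K (below-ratio B l) r) outer inner

  ascending-take : ∀ {a ps} k → AscendingPrimes a ps → AscendingPrimes a (take k ps)
  ascending-take zero    A         = []
  ascending-take (suc k) []        = []
  ascending-take (suc k) (apq ∷ A) = apq ∷ ascending-take k A

  small-below : ∀ {qs} → AscendingPrimes 1 qs → Below small qs
  small-below {qs} A = subst (λ ps → Below ps qs) (sym small≡) (primesIn-below (2 ^ 14) (ascending-weaken z≤n A))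

  table-certificate : ∀ {n} .{{_ : NonZero n}} (S : Support n 1) →
                      8 ≤ length (Support.primes S) → length (Support.primes S) ≤ 1900 → Certificate n
  table-certificate {n} S@(support qs A _ _) 8≤k k≤1900 = conclude (find-step (length qs) steps steps-valid 8≤k (s≤s k≤1900))
    where
    conclude : (∃₂ λ a b → ∃₂ λ L K → a ≤ length qs × length qs ≤ b × Valid small a b L K) → Certificate n
    conclude (a , b , L , K , a≤k , k≤b , ratio , 2^L≤ , 1≤L , outer) =
      below-certificate (take b small) K (692 * L) {{product≢0 (ascending-take b small-ascending)}} S
        (below-take b (small-below A))
        (subst (length qs ≤_) (sym (trans (length-take b small) (cong (b ⊓_) small-length))) (⊓-glb k≤b k≤1900))
        ratio outer
        (inner-2^ L {{>-nonZero 1≤L}} (≤-trans 2^L≤ (≤-trans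
          (below-product A (below-take a (small-below A))
            (subst (_≤ length qs) (sym (length-take a small)) (≤-trans (m⊓n≤m a (length small)) a≤k)))
          (product-support≤ S))))

  -- There are 1900 primes below 2¹⁴. The exponent 16384 = 2¹⁴ ensures ⌊log₂ n⌋ ≥ 2¹⁴, so that J ≥
  -- 14 in the asymptotic case.
  many-primes : ∀ {n} .{{_ : NonZero n}} (S : Support n 1) → 1900 ≤ length (Support.primes S) → 2 ^ 16384 ≤ n
  many-primes S@(support qs A _ _) 1900≤k = ≤-trans small-product (≤-trans
    (below-product A (small-below A) (subst (_≤ length qs) (sym small-length) 1900≤k))
    (product-support≤ S))

  next-prime : ∀ {a q qs} p k → primesIn a k ≡ p ∷ [] → AscendingPrimes a (q ∷ qs) →
               (q ≡ p × AscendingPrimes p qs) ⊎ AscendingPrimes p (q ∷ qs)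
  next-prime {q = q} {qs} p k eq ((a<q , pq) ∷ A)
    with p≤q ← subst (λ rs → Below rs (q ∷ qs)) eq (primesIn-below k ((a<q , pq) ∷ A))
    with p≤q
  ... | p≤q ∷ _ with m≤n⇒m<n∨m≡n p≤q
  ...   | inj₁ p<q  = inj₂ ((p<q , pq) ∷ A)
  ...   | inj₂ refl = inj₁ (refl , A)

  -- 570570 = 2 · 3 · 5 · 7 · 11 · 13 · 19 violates the bound, so that the n with
  -- this radical or with radical 510510 have to be at least twice it.
  data Shape (qs : List ℕ) : Set where
    large₁ : ∀ rs .{{_ : NonZero (product rs)}} → Below rs qs → length rs ≡ 7 →
             product (map suc rs) * 100 ≤ 335 * product rs → Shape qs
    large₂ : Below (2 ∷ 3 ∷ 5 ∷ 7 ∷ 11 ∷ 13 ∷ 23 ∷ []) qs → Shape qs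
    least  : 510510 ≤ product qs → product qs ≤ 570570 → Shape qs

  -- If one of 2, 3, 5, 7, 11, 13 is skipped, the best remaining choice up to 19 already has ratio
  -- at most 3.35. If none is, the seventh prime decides: 17, 19, or at least 23.
  shape : ∀ {q₁ q₂ q₃ q₄ q₅ q₆ q₇} → let qs = q₁ ∷ q₂ ∷ q₃ ∷ q₄ ∷ q₅ ∷ q₆ ∷ q₇ ∷ [] in
          AscendingPrimes 1 qs → Shape qs
  shape A with next-prime 2 1 refl A
  ... | inj₂ A₁ = large₁ (primesIn 2 17) (primesIn-below 17 A₁) refl (≤ᵇ⇒≤ _ _ _)
  ... | inj₁ (refl , A₁) with next-prime 3 1 refl A₁
  ... | inj₂ A₂ = large₁ (2 ∷ primesIn 3 16) (≤-refl ∷ primesIn-below 16 A₂) refl (≤ᵇ⇒≤ _ _ _)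
  ... | inj₁ (refl , A₂) with next-prime 5 2 refl A₂
  ... | inj₂ A₃ = large₁ (2 ∷ 3 ∷ primesIn 5 14) (≤-refl ∷ ≤-refl ∷ primesIn-below 14 A₃) refl (≤ᵇ⇒≤ _ _ _)
  ... | inj₁ (refl , A₃) with next-prime 7 2 refl A₃
  ... | inj₂ A₄ = large₁ (2 ∷ 3 ∷ 5 ∷ primesIn 7 12) (≤-refl ∷ ≤-refl ∷ ≤-refl ∷ primesIn-below 12 A₄) refl (≤ᵇ⇒≤ _ _ _)
  ... | inj₁ (refl , A₄) with next-prime 11 4 refl A₄
  ... | inj₂ A₅ = large₁ (2 ∷ 3 ∷ 5 ∷ 7 ∷ primesIn 11 8) (≤-refl ∷ ≤-refl ∷ ≤-refl ∷ ≤-refl ∷ primesIn-below 8 A₅) refl (≤ᵇ⇒≤ _ _ _)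
  ... | inj₁ (refl , A₅) with next-prime 13 2 refl A₅
  ... | inj₂ A₆ = large₁ (2 ∷ 3 ∷ 5 ∷ 7 ∷ 11 ∷ primesIn 13 6)
    (≤-refl ∷ ≤-refl ∷ ≤-refl ∷ ≤-refl ∷ ≤-refl ∷ primesIn-below 6 A₆) refl (≤ᵇ⇒≤ _ _ _)
  ... | inj₁ (refl , A₆) with next-prime 17 4 refl A₆
  ... | inj₁ (refl , A₇) = least (≤ᵇ⇒≤ 510510 510510 _) (≤ᵇ⇒≤ 510510 570570 _)
  ... | inj₂ A₇ with next-prime 19 2 refl A₇
  ... | inj₁ (refl , A₈) = least (≤ᵇ⇒≤ 510510 570570 _) (≤ᵇ⇒≤ 570570 570570 _)
  ... | inj₂ A₈ = large₂ (≤-refl ∷ ≤-refl ∷ ≤-refl ∷ ≤-refl ∷ ≤-refl ∷ ≤-refl ∷ primesIn-below 4 A₈)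

  ratio-trans : ∀ rs qs a b .{{_ : NonZero (product rs)}} →
                product (map suc qs) * product rs ≤ product (map suc rs) * product qs →
                product (map suc rs) * a ≤ b * product rs → product (map suc qs) * a ≤ b * product qs
  ratio-trans rs qs a b h r = *-cancelʳ-≤ _ _ (product rs) (begin
    product (map suc qs) * a * product rs    ≡⟨ rotate (product (map suc qs)) a (product rs) ⟩
    product (map suc qs) * product rs * a    ≤⟨ *-monoˡ-≤ a h ⟩
    product (map suc rs) * product qs * a    ≡⟨ rotate (product (map suc rs)) (product qs) a ⟩
    product (map suc rs) * a * product qs    ≤⟨ *-monoˡ-≤ (product qs) r ⟩
    b * product rs * product qs              ≡⟨ rotate b (product rs) (product qs) ⟩
    b * product qs * product rs              ∎)
    where
    open ≤-Reasoning
    rotate : ∀ x y z → x * y * z ≡ x * z * y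
    rotate = solve 3 (λ x y z → x :* y :* z := x :* z :* y) refl

  module Seven {n} .{{_ : NonZero n}} (570571≤n : 570571 ≤ n) where

    -- 2576 is the least K with 1.3007 · K/1000 ≥ 3.35, and 13240 lies between 1000 e^2.576 and 1000
    -- log 570571. The constants of the other two cases arise in the same way.
    case₁ : ∀ (S : Support n 1) rs .{{_ : NonZero (product rs)}} → Below rs (Support.primes S) →
            length (Support.primes S) ≤ length rs →
            product (map suc rs) * 100 ≤ 335 * product rs → Certificate n
    case₁ S rs B l r = certificate 2576 13240
      (ratio⇒sum≤ S 100 335 2576 (ratio-trans rs (Support.primes S) 100 335 (below-ratio B l) r) (≤ᵇ⇒≤ 3350000000 3350603200 _))
      (<ᵇ⇒< (1000 ^ 2576 * 1000) (13240 * 999 ^ 2576) _)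
      (inner-mono 13240 570571≤n (<ᵇ⇒< (1000 ^ 13240) (570571 * 999 ^ 13240) _))

    -- The ratio can reach 3.362 here, too much for n near 570571, but n is at least 690690 = 2 · 3
    -- · 5 · 7 · 11 · 13 · 23.
    case₂ : ∀ (S : Support n 1) → Below (2 ∷ 3 ∷ 5 ∷ 7 ∷ 11 ∷ 13 ∷ 23 ∷ []) (Support.primes S) →
            length (Support.primes S) ≡ 7 → Certificate n
    case₂ S@(support _ A _ _) B l = certificate 2591 13435
      (ratio⇒sum≤ S 100 337 2591
        (ratio-trans (2 ∷ 3 ∷ 5 ∷ 7 ∷ 11 ∷ 13 ∷ 23 ∷ []) (Support.primes S) 100 337 (below-ratio B (≤-reflexive l)) (≤ᵇ⇒≤ 232243200 232762530 _))
        (≤ᵇ⇒≤ 3370000000 3370113700 _))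
      (<ᵇ⇒< (1000 ^ 2591 * 1000) (13435 * 999 ^ 2591) _)
      (inner-mono 13435 (≤-trans (below-product A B (≤-reflexive (sym l))) (product-support≤ S))
        (<ᵇ⇒< (1000 ^ 13435) (690690 * 999 ^ 13435) _))

    case₃ : ∀ (S : Support n 1) → length (Support.primes S) ≡ 7 →
            510510 ≤ product (Support.primes S) → product (Support.primes S) ≤ 570570 → Certificate n
    case₃ S@(support qs A (divides c n≡) _) l lower upper = certificate 2624 13829
      (ratio⇒sum≤ S 1000 3412 2624
        (ratio-trans (primesIn 1 16) qs 1000 3412 (below-ratio (primesIn-below 16 A) (≤-reflexive l)) (≤ᵇ⇒≤ 1741824000 1741860120 _))
        (≤ᵇ⇒≤ 34120000000 34130368000 _))
      (<ᵇ⇒< (1000 ^ 2624 * 1000) (13829 * 999 ^ 2624) _)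
      -- 1021020 = 2 · 510510.
      (inner-mono 13829 (≤-trans (*-mono-≤ 2≤c lower) (≤-reflexive (sym n≡)))
        (<ᵇ⇒< (1000 ^ 13829) (1021020 * 999 ^ 13829) _))
      where
      2≤c : 2 ≤ c
      2≤c = ≰⇒> λ c≤1 → <⇒≱ 570571≤n (≤-trans (≤-reflexive n≡)
        (≤-trans (*-monoˡ-≤ (product qs) c≤1) (≤-trans (≤-reflexive (*-identityˡ (product qs))) upper)))

    seven : ∀ (S : Support n 1) → length (Support.primes S) ≡ 7 → Certificate n
    seven S@(support (_ ∷ _ ∷ _ ∷ _ ∷ _ ∷ _ ∷ _ ∷ []) A _ _) l = conclude (shape A)
      where
      conclude : Shape (Support.primes S) → Certificate n
      conclude (large₁ rs B l′ c) = case₁ S rs B (≤-reflexive (trans l (sym l′))) c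
      conclude (large₂ B)         = case₂ S B l
      conclude (least lo hi)      = case₃ S l lo hi

    at-most-six : ∀ (S : Support n 1) → length (Support.primes S) ≤ 6 → Certificate n
    at-most-six S@(support _ A _ _) l = case₁ S (primesIn 1 12) (primesIn-below 12 A) l (≤ᵇ⇒≤ _ _ _)

-- The asymptotic case

module Asymptotic where
  open import Data.List using (List; map)
  open import Data.List.Properties using (map-++)
  open import Data.List.Relation.Binary.Sublist.Propositional using (_⊆_)
  open import Data.Nat
  open import Data.Nat.ListAction using (product)
  open import Data.Nat.ListAction.Properties using (product-++)
  open import Data.Nat.Properties
  open import Data.Nat.Solver using (module +-*-Solver)
  open import Data.Product using (∃; ∃₂; _×_; _,_)
  open import Relation.Nullary using (yes; no)
  open import Relation.Binary.PropositionalEquality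
  open UnitaryDivisors
  open PrimeLists
  open Chebyshev using (^-distrib-*)
  open SmallPrimes
  open LargeProduct using (large-product)
  open FewPrimes
  open +-*-Solver using (solve; _:=_; _:+_; _:*_; con)

  floor-log₂ : ∀ n .{{_ : NonZero n}} → ∃ λ L → 2 ^ L ≤ n × n < 2 ^ suc L
  floor-log₂ 1 = 0 , ≤-refl , ≤-refl
  floor-log₂ (2+ n) with floor-log₂ (suc n)
  ... | L , 2^L≤n , n<2^L with 2+ n <? 2 ^ suc L
  ...   | yes lt = L , m≤n⇒m≤1+n 2^L≤n , lt
  ...   | no ≮   = suc L , ≮⇒≥ ≮ , ≤-<-trans n<2^L (^-monoʳ-< 2 (s≤s (s≤s z≤n)) (n<1+n (suc L)))

  -- `t` says in which quarter of [2^J, 2^(J+1)] the number L = ⌊log₂ n⌋ lies, and `d` is the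
  -- greatest integer with (1000/999)^d < 2 · 0.692 · (3 + t)/4. With the bounds for the whole
  -- interval at once, `quarter-sum` would fail at m = 0.
  data Quarter : ℕ → ℕ → Set where
    quarter₁ : Quarter 1 324
    quarter₂ : Quarter 2 547
    quarter₃ : Quarter 3 730
    quarter₄ : Quarter 4 884

  find-quarter : ∀ P L → P ≤ L → L < 2 * P → ∃₂ λ t d → Quarter t d × (3 + t) * P ≤ 4 * L × 4 * L ≤ (4 + t) * P
  find-quarter P L P≤L L<2P with 4 * L ≤? 5 * P
  ... | yes h₅ = 1 , 324 , quarter₁ , *-monoʳ-≤ 4 P≤L , h₅
  ... | no ≰₅ with 4 * L ≤? 6 * P
  ...   | yes h₆ = 2 , 547 , quarter₂ , <⇒≤ (≰⇒> ≰₅) , h₆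
  ...   | no ≰₆ with 4 * L ≤? 7 * P
  ...     | yes h₇ = 3 , 730 , quarter₃ , <⇒≤ (≰⇒> ≰₆) , h₇
  ...     | no ≰₇ = 4 , 884 , quarter₄ , <⇒≤ (≰⇒> ≰₇)
    , ≤-trans (*-monoʳ-≤ 4 (<⇒≤ L<2P)) (≤-reflexive (sym (*-assoc 4 2 P)))

  -- As m ≥ 0, comparing coefficients is enough, and three numerical checks settle all J at once.
  compare-quadratics : ∀ c s p q r k f g e m → c * p ≤ s * (k * g) → c * q ≤ s * (k * e + f * g) → c * r ≤ s * (f * e) →
                       c * (p * m * m + q * m + r) ≤ s * ((k * m + f) * (g * m + e))
  compare-quadratics c s p q r k f g e m h₂ h₁ h₀ = begin
    c * (p * m * m + q * m + r)
      ≡⟨ solve 5 (λ c p q r m → c :* (p :* m :* m :+ q :* m :+ r) := c :* p :* (m :* m) :+ c :* q :* m :+ c :* r) refl c p q r m ⟩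
    c * p * (m * m) + c * q * m + c * r
      ≤⟨ +-mono-≤ (+-mono-≤ (*-monoˡ-≤ (m * m) h₂) (*-monoˡ-≤ m h₁)) h₀ ⟩
    s * (k * g) * (m * m) + s * (k * e + f * g) * m + s * (f * e)
      ≡⟨ solve 6 (λ s k f g e m → s :* (k :* g) :* (m :* m) :+ s :* (k :* e :+ f :* g) :* m :+ s :* (f :* e) :=
           s :* ((k :* m :+ f) :* (g :* m :+ e))) refl s k f g e m ⟩
    s * ((k * m + f) * (g * m + e)) ∎
    where open ≤-Reasoning

  outer-arithmetic : ∀ {x y z u w v L} → x ≤ y * z → u * 2000 < 692 * v * w → v * (2 * y) ≤ 4 * L → .{{_ : NonZero x}} →
                     x * u * 1000 < 692 * L * (z * w)
  outer-arithmetic {x} {y} {z} {u} {w} {v} {L} x≤yz h vP≤4L = *-cancelˡ-< 4 _ _ (begin-strict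
    4 * (x * u * 1000)
      ≡⟨ solve 2 (λ x u → con 4 :* (x :* u :* con 1000) := con 2 :* x :* (u :* con 2000)) refl x u ⟩
    2 * x * (u * 2000)
      <⟨ *-monoʳ-< (2 * x) {{m*n≢0 2 x}} h ⟩
    2 * x * (692 * v * w)
      ≤⟨ *-monoˡ-≤ (692 * v * w) (*-monoʳ-≤ 2 x≤yz) ⟩
    2 * (y * z) * (692 * v * w)
      ≡⟨ solve 4 (λ y z v w → con 2 :* (y :* z) :* (con 692 :* v :* w) := (v :* (con 2 :* y)) :* (con 692 :* (z :* w))) refl y z v w ⟩
    v * (2 * y) * (692 * (z * w))
      ≤⟨ *-monoˡ-≤ (692 * (z * w)) vP≤4L ⟩
    4 * L * (692 * (z * w))
      ≡⟨ solve 3 (λ L z w → con 4 :* L :* (con 692 :* (z :* w)) := con 4 :* (con 692 :* L :* (z :* w))) refl L z w ⟩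
    4 * (692 * L * (z * w)) ∎)
    where open ≤-Reasoning

  -- The multiples of 692 are counted from M = J - 1: at t = 1 the factor 0.692 · (3 + t)/4 is below
  -- 1 and its logarithm negative, so one factor 2 is set aside and absorbed into `d`.
  quarter-outer : ∀ {t d} M L → Quarter t d → (3 + t) * 2 ^ suc M ≤ 4 * L →
                  1000 ^ (692 * M + d) * 1000 < 692 * L * 999 ^ (692 * M + d)
  quarter-outer {t} {d} M L q h = subst₂ (λ a b → a * 1000 < 692 * L * b)
    (sym (^-distribˡ-+-* 1000 (692 * M) d)) (sym (^-distribˡ-+-* 999 (692 * M) d))
    (outer-arithmetic {1000 ^ (692 * M)} {2 ^ M} {999 ^ (692 * M)} {1000 ^ d} {999 ^ d} {3 + t} {L} head (initial q) h {{m^n≢0 1000 (692 * M)}})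
    where
    open ≤-Reasoning
    head : 1000 ^ (692 * M) ≤ 2 ^ M * 999 ^ (692 * M)
    head = begin
      1000 ^ (692 * M)          ≡⟨ ^-*-assoc 1000 692 M ⟨
      (1000 ^ 692) ^ M          ≤⟨ ^-monoˡ-≤ M (<⇒≤ 1000^692<2*999^692) ⟩
      (2 * 999 ^ 692) ^ M       ≡⟨ ^-distrib-* 2 (999 ^ 692) M ⟩
      2 ^ M * (999 ^ 692) ^ M   ≡⟨ cong (2 ^ M *_) (^-*-assoc 999 692 M) ⟩
      2 ^ M * 999 ^ (692 * M)   ∎
    initial : ∀ {t d} → Quarter t d → 1000 ^ d * 2000 < 692 * (3 + t) * 999 ^ d
    initial quarter₁ = <ᵇ⇒< (1000 ^ 324 * 2000) (692 * 4 * 999 ^ 324) _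
    initial quarter₂ = <ᵇ⇒< (1000 ^ 547 * 2000) (692 * 5 * 999 ^ 547) _
    initial quarter₃ = <ᵇ⇒< (1000 ^ 730 * 2000) (692 * 6 * 999 ^ 730) _
    initial quarter₄ = <ᵇ⇒< (1000 ^ 884 * 2000) (692 * 7 * 999 ^ 884) _

  -- 42072 = 4000 · 10518 / 1000.
  quarter-sum : ∀ {t d} m → Quarter t d → ∃ λ e → NonZero e × e + 1000 * t ≡ 50120 ×
                42072 * 10000000 * (2 * m * m + 55 * m + 378) ≤ 13007 * 27 * ((692 * m + (8996 + d)) * (3580 * m + e))
  quarter-sum m quarter₁ = 49120 , _ , refl
    , compare-quadratics (42072 * 10000000) (13007 * 27) 2 55 378 692 (8996 + 324) 3580 49120 m (≤ᵇ⇒≤ _ _ _) (≤ᵇ⇒≤ _ _ _) (≤ᵇ⇒≤ _ _ _)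
  quarter-sum m quarter₂ = 48120 , _ , refl
    , compare-quadratics (42072 * 10000000) (13007 * 27) 2 55 378 692 (8996 + 547) 3580 48120 m (≤ᵇ⇒≤ _ _ _) (≤ᵇ⇒≤ _ _ _) (≤ᵇ⇒≤ _ _ _)
  quarter-sum m quarter₃ = 47120 , _ , refl
    , compare-quadratics (42072 * 10000000) (13007 * 27) 2 55 378 692 (8996 + 730) 3580 47120 m (≤ᵇ⇒≤ _ _ _) (≤ᵇ⇒≤ _ _ _) (≤ᵇ⇒≤ _ _ _)
  quarter-sum m quarter₄ = 46120 , _ , refl
    , compare-quadratics (42072 * 10000000) (13007 * 27) 2 55 378 692 (8996 + 884) 3580 46120 m (≤ᵇ⇒≤ _ _ _) (≤ᵇ⇒≤ _ _ _) (≤ᵇ⇒≤ _ _ _)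

  combine-ratio : ∀ {l⁺ l b⁺ b} c g h k x y .{{_ : NonZero c}} → g * h ≡ c * k → l⁺ * c ≤ g * l → b⁺ * x ≤ h * y * b →
                  (l⁺ * b⁺) * x ≤ k * y * (l * b)
  combine-ratio {l⁺} {l} {b⁺} {b} c g h k x y gh≡ck hl hb = *-cancelˡ-≤ c (begin
    c * ((l⁺ * b⁺) * x)
      ≡⟨ solve 4 (λ c l b x → c :* (l :* b :* x) := (l :* c) :* (b :* x)) refl c l⁺ b⁺ x ⟩
    (l⁺ * c) * (b⁺ * x)
      ≤⟨ *-mono-≤ hl hb ⟩
    (g * l) * (h * y * b)
      ≡⟨ solve 5 (λ g h l y b → (g :* l) :* (h :* y :* b) := g :* h :* (y :* (l :* b))) refl g h l y b ⟩
    g * h * (y * (l * b))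
      ≡⟨ cong (_* (y * (l * b))) gh≡ck ⟩
    c * k * (y * (l * b))
      ≡⟨ solve 5 (λ c k l y b → c :* k :* (y :* (l :* b)) := c :* (k :* y :* (l :* b))) refl c k l y b ⟩
    c * (k * y * (l * b)) ∎)
    where open ≤-Reasoning

  swapʳ : ∀ a b c → a * b * c ≡ a * c * b
  swapʳ = solve 3 (λ a b c → a :* b :* c := a :* c :* b) refl

  primes-ratio : ∀ {qs} m t L D .{{_ : NonZero D}} → D + 1000 * t ≡ 3580 * (m + 14) → AscendingPrimes 1 qs →
                 product qs < 2 ^ suc L → 4 * L ≤ (4 + t) * 2 ^ (m + 14) →
                 product (map suc qs) * (27 * D) ≤ 42072 * ((m + 14) * (27 + 2 * m)) * product qs
  primes-ratio {qs} m t L D D≡ A qs<2^L 4L≤ = conclude (split-primes (2 ^ 14) (ascending-weaken z≤n A))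
    where
    conclude : Split 0 (2 ^ 14) qs → product (map suc qs) * (27 * D) ≤ 42072 * ((m + 14) * (27 + 2 * m)) * product qs
    conclude (split low high qs≡ low⊆ asc) = subst₂ (λ a b → a * (27 * D) ≤ 42072 * ((m + 14) * (27 + 2 * m)) * b)
      (sym (trans (cong (λ xs → product (map suc xs)) qs≡) (trans (cong product (map-++ suc low high)) (product-++ (map suc low) (map suc high)))))
      (sym qs-product)
      (combine-ratio {product (map suc low)} {product low} {product (map suc high)} {product high} 1000 10518 4000 42072 (27 * D) ((m + 14) * (27 + 2 * m)) refl
        (ratio-trans small low 1000 10518 {{product≢0 small-ascending}}
          (⊆-ratio (subst (low ⊆_) (sym small≡) low⊆)) small-ratio)
        (subst (λ x → product (map suc high) * (27 * D) ≤ x * product high) (*-assoc 4000 (m + 14) (27 + 2 * m))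
          (large-product m t L D D≡ asc (≤-<-trans high≤ qs<2^L) 4L≤)))
      where
      qs-product : product qs ≡ product low * product high
      qs-product = trans (cong product qs≡) (product-++ low high)
      low≢0 : NonZero (product low)
      low≢0 = m*n≢0⇒m≢0 (product low) {{subst NonZero qs-product (product≢0 A)}}
      high≤ : product high ≤ product qs
      high≤ = subst (product high ≤_) (sym qs-product) (m≤n*m (product high) (product low) {{low≢0}})

  polynomial : ∀ m → 2 * m * m + 55 * m + 378 ≡ (m + 14) * (27 + 2 * m)
  polynomial = solve 1 (λ m → con 2 :* m :* m :+ con 55 :* m :+ con 378 := (m :+ con 14) :* (con 27 :+ con 2 :* m)) refl

  rescale : ∀ c d s r {P P′ K K′} D → P ≡ P′ → K ≡ K′ →
            c * d * P ≤ s * r * (K * D) → c * P′ * d ≤ s * K′ * (r * D)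
  rescale c d s r {P} {K = K} D refl refl = subst₂ _≤_ (swapʳ c d P) (interchange s r K D)

  shift-argument : ∀ g m a {e b} → e + b ≡ g * a → g * m + e + b ≡ g * (m + a)
  shift-argument g m a {e} {b} eq = trans (+-assoc (g * m) e b) (trans (cong (g * m +_) eq) (sym (*-distribˡ-+ g m a)))

  asymptotic-step : ∀ {n} .{{_ : NonZero n}} (S : Support n 1) m L {t d} → Quarter t d → 1 ≤ L → 2 ^ L ≤ n → n < 2 ^ suc L →
                    (3 + t) * 2 ^ (m + 14) ≤ 4 * L → 4 * L ≤ (4 + t) * 2 ^ (m + 14) → Certificate n
  asymptotic-step {n} S m L {t} {d} q 1≤L 2^L≤n n<2^L lower upper =
    let e , e≢0 , e≡ , quadratics = quarter-sum m q
        -- Since e = 3580 · 14 - 1000 t, this is the denominator 3580 J - 1000 t of `large-product`;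
        -- likewise 8996 = 692 · 13 in `quarter-sum`.
        D   = 3580 * m + e
        D≢0 = >-nonZero (≤-trans (>-nonZero⁻¹ e {{e≢0}}) (m≤n+m e (3580 * m)))
    in certificate (692 * (m + 13) + d) (692 * L)
      (ratio⇒sum≤ S (27 * D) (42072 * ((m + 14) * (27 + 2 * m))) (692 * (m + 13) + d) {{m*n≢0 27 D {{_}} {{D≢0}}}}
        (primes-ratio m t L D {{D≢0}} (shift-argument 3580 m 14 e≡) (Support.ascending S) (≤-<-trans (product-support≤ S) n<2^L) upper)
        (rescale 42072 10000000 13007 27 D (polynomial m)
          (trans (sym (+-assoc (692 * m) 8996 d)) (cong (_+ d) (sym (*-distribˡ-+ 692 m 13)))) quadratics))
      (quarter-outer (m + 13) L q (subst (λ x → (3 + t) * 2 ^ x ≤ 4 * L) (+-suc m 13) lower))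
      (inner-2^ L {{>-nonZero 1≤L}} 2^L≤n)

  2^-cancel-< : ∀ {m n} → 2 ^ m < 2 ^ n → m < n
  2^-cancel-< h = ≰⇒> λ n≤m → <⇒≱ h (^-monoʳ-≤ 2 n≤m)

  asymptotic : ∀ {n} .{{_ : NonZero n}} → Support n 1 → 2 ^ 16384 ≤ n → Certificate n
  asymptotic {n} S big = by-log (floor-log₂ n)
    where
    by-loglog : ∀ L → 2 ^ L ≤ n → n < 2 ^ suc L → 2 ^ 14 ≤ L → 1 ≤ L → (∃ λ J → 2 ^ J ≤ L × L < 2 ^ suc J) → Certificate n
    by-loglog L 2^L≤n n<2^L 2^14≤L 1≤L (J , 2^J≤L , L<2^J) =
      let t , d , q , lower , upper = find-quarter (2 ^ J) L 2^J≤L L<2^J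
          m   = J ∸ 14
          eq  = cong (2 ^_) (sym (m∸n+n≡m {J} {14} (s≤s⁻¹ (2^-cancel-< (≤-<-trans 2^14≤L L<2^J)))))
      in asymptotic-step S m L q 1≤L 2^L≤n n<2^L
           (subst (λ P → (3 + t) * P ≤ 4 * L) eq lower) (subst (λ P → 4 * L ≤ (4 + t) * P) eq upper)
    by-log : (∃ λ L → 2 ^ L ≤ n × n < 2 ^ suc L) → Certificate n
    by-log (L , 2^L≤n , n<2^L) = by-loglog L 2^L≤n n<2^L 16384≤L (≤-trans (s≤s z≤n) 16384≤L)
      (floor-log₂ L {{>-nonZero (≤-trans (s≤s z≤n) 16384≤L)}})
      where
      16384≤L : 16384 ≤ L
      16384≤L = s≤s⁻¹ (2^-cancel-< (≤-<-trans big n<2^L))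

-- Case distinction by the number of prime factors

module Assembly where
  open import Data.List using (length)
  open import Data.Nat
  open import Data.Nat.Properties
  open import Data.Sum using (inj₁; inj₂)
  open import Relation.Binary.PropositionalEquality using (sym)
  open import Relation.Nullary using (yes; no)
  open UnitaryDivisors
  open FewPrimes
  open Asymptotic

  certify : ∀ n → 570571 ≤ n → Certificate n
  certify n h = by-count (prime-support n)
    where
    instance
      _ : NonZero n
      _ = >-nonZero (≤-trans (s≤s z≤n) h)
    by-count : Support n 1 → Certificate n
    by-count S with length (Support.primes S) ≤? 6
    ... | yes k≤6 = Seven.at-most-six h S k≤6
    ... | no  k≰6 with m≤n⇒m<n∨m≡n (≰⇒> k≰6)
    ...   | inj₂ 7≡k = Seven.seven h S (sym 7≡k)
    ...   | inj₁ 7<k with length (Support.primes S) ≤? 1900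
    ...     | yes k≤1900 = table-certificate S 7<k k≤1900
    ...     | no  k≰1900 = asymptotic S (many-primes S (<⇒≤ (≰⇒> k≰1900)))

open import Data.Integer using (+_)
open import Data.Nat using (ℕ; _≤_; s≤s; z≤n)
open import Data.Nat.Properties using (≤-trans)
open import Data.Rational using (_/_; _*_)
open import Defs

theorem1 : (n : ℕ) (n≥570571 : 570571 ≤ n) →
    fromℕ (σ* n) ≤ᴿ ((+ 13007 / 10000) * ℕ→ℚ n) ⋆ loglog n (≤-trans (s≤s (s≤s z≤n)) n≥570571)
theorem1 n n≥570571 =
  let open FewPrimes.Certificate (Assembly.certify n n≥570571)
  in Criterion.criterion n (≤-trans (s≤s (s≤s z≤n)) n≥570571) 999 K K′ sum≤ outer inner
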